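{- For every composition $I$ (of some integer $n\ge 1$), \[ \mathrm{PT}^A_I(q)\;=\;e_I(q)\;=\;\sum_{J\succeq I}\left(-\tfrac{1}{q}\right)^{\ell(I)-\ell(J)}q^{ -\mathrm{st}'(I,J)}\,\mathrm{QFact}_A(J), \] where the sum runs over all compositions $J$ of $n$ coarser than or equal to $I$.
   Context: Compositions: a composition of $n$ is a sequence $I=(i_1,\dots,i_r)$ of positive integers with sum $n$; $\ell(I)=r$; $\mathrm{Des}(I)=\{i_1,i_1+i_2,\dots,i_1+\dots+i_{r-1}\}$. $I$ is finer than $J$ (equivalently $J$ is coarser than $I$), written $I\preceq J$ or $J\succeq I$, if $\mathrm{Des}(I)\supseteq\mathrm{Des}(J)$. For $I\preceq J$ set $\mathrm{st}'(I,J)=\#\{(a,b)\in\mathrm{Des}(I)\times\mathrm{Des}(J): a\le b\}$ and $\mathrm{st}(I,J)=\#\{(a,b)\in\mathrm{Des}(I)\times\mathrm{Des}(J): a\ge b\}$. $[m]_q=1+q+\dots+q^{m-1}$, and $\mathrm{QFact}_A(j_1,\dots,j_p)=[p]_q^{j_1}[p-1]_q^{j_2}\cdots[2]_q^{j_{p-1}}[1]_q^{j_p}$. Permutation tableaux: let $k\ge1$ and let $\lambda=(\lambda_1\ge\dots\ge\lambda_k\ge0)$ be a Young diagram with exactly $k$ rows (rows of length $0$ allowed) and exactly $n-k$ (nonempty) columns, drawn in French convention (rows left-justified, longest row at the bottom). Encode $\lambda$ by the composition $I=(i_1,\dots,i_k)$ of $n$ where, for $1\le t\le k$, $i_t-1$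 is the number of columns of length $k-t+1$; this is a bijection between such diagrams and compositions of $n$ with $k$ parts. A (type A) permutation tableau of shape $\lambda$ is a filling of the boxes of $\lambda$ with $0$'s and $1$'s such that (1) every column contains at least one $1$, and (2) no box containing a $0$ has both a $1$ below it in the same column and a $1$ to its left in the same row. Its rank is (number of $1$'s) minus (number of columns). $\mathrm{PT}^A_I(q)=\sum_T q^{\mathrm{rank}(T)}$, over permutation tableaux $T$ of the shape encoded by $I$. Algebraic setting: work over $\mathbb{K}(q)$, $\mathbb K$ a field of characteristic $0$. A packed word is a finite word over positive integers whose set of letters is $\{1,\dots,m\}$ for some $m$; $\mathrm{pack}(w)$ replaces each occurrence of the $t$-th smallest letter of $w$ by $t$. For a packed word $w=w_1\cdots w_n$: $\mathrm{DC}(w)$ is the composition of $n$ with descent set $\{i:w_i>w_{i+1}\}$; $\mathrm{WC}(w)$ is the composition of $n$ whose descent set is the set of positions $p<n$ such that the letter $w_p$ does not occur in $w_{p+1}\cdots w_n$; $\mathrm{sinv}(w)$ is the number of pairs $i<j$ with $w_i>w_j$ and $w_j$ not occurring in $w_{j+1}\cdots w_n$. $\mathbf{WQSym}$ is the vector space with basis $(\mathbf M_u)$ indexed by packed words, with product $\mathbf M_{u'}\mathbf M_{u''}=\sum\mathbf M_u$ over packed words $u=v\cdot w$ (concatenation) with $\mathrm{pack}(v)=u'$, $\mathrm{pack}(w)=u''$. The (associative) product $\star_q$ is the bilinear product with $\mathbf M_{u'}\star_q\mathbf M_{u''}=\sum q^{\mathrm{sinv}(u)-\mathrm{sinv}(u')-\mathrm{sinv}(u'')}\mathbf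 M_u$ over the same $u$. Let $\mathbf{Sym}$ be the quotient of $\mathbf{WQSym}$ by the span of all $\mathbf M_u-\mathbf M_v$ with $\mathrm{WC}(u)=\mathrm{WC}(v)$, $\zeta$ the quotient map, and $\Psi_I=\zeta(\mathbf M_u)$ for any $u$ with $\mathrm{WC}(u)=I$; $(\Psi_I)$ is a basis (this realizes noncommutative symmetric functions with Tevlin's monomial basis). Let $\tilde S_m=\sum\mathbf M_u$ over nondecreasing packed words $u$ of length $m$, and $S^{J}(q)=\zeta(\tilde S_{j_1}\star_q\cdots\star_q\tilde S_{j_l})$ for $J=(j_1,\dots,j_l)$. Let $L_J(q)=\sum_{I\preceq J}q^{\mathrm{st}(I,J)}\Psi_I$ (a basis). $e_I(q)$ denotes the coefficient of $L_I(q)$ in the expansion of $S^{(1^n)}(q)$, $(1^n)=(1,\dots,1)$. -}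

module Defs where

open import Algebra.Apartness.Bundles using (HeytingCommutativeRing; HeytingField)
open import Algebra.Bundles using (CommutativeRing)
open import Data.Bool.Base using (Bool; true; false)
open import Data.Bool.Properties using (T?) renaming (_≟_ to _≟ᵇ_)
open import Data.Empty using (⊥-elim)
open import Data.Fin.Base using (Fin; toℕ) renaming (_<_ to _<ᶠ_)
open import Data.Fin.Properties using () renaming (_<?_ to _<ᶠ?_)
open import Data.Integer.Base as ℤ using (ℤ; -[1+_])
open import Data.List.Base using (List; []; _∷_; _++_; allFin; applyUpTo; cartesianProduct; cartesianProductWith; concatMap; deduplicate; drop; filter; foldr; length; lookup; map; mapMaybe; replicate; take; upTo)
open import Data.Nat.ListAction using (sum)
open import Data.List.Extrema.Nat using (max; xs≤max; max≤v⁺)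
open import Data.List.Membership.DecPropositional using () renaming (_∈?_ to mem?)
open import Data.List.Membership.Propositional using (_∈_; _∉_)
open import Data.List.Membership.Propositional.Properties using (∈-++⁺ʳ; ∈-++⁻)
open import Data.List.Properties using (≡-dec)
open import Data.List.Relation.Binary.Subset.DecPropositional using () renaming (_⊆?_ to subset?)
open import Data.List.Relation.Binary.Subset.Propositional using (_⊆_)
open import Data.List.Relation.Unary.All as All using (All; []; _∷_)
open import Data.List.Relation.Unary.All.Properties using () renaming (replicate⁺ to All-replicate⁺)
open import Data.List.Relation.Unary.Any using (here; there)
open import Data.List.Relation.Unary.Linked using (linked?)
open import Data.Maybe.Base as Maybe using (Maybe; just; nothing)
open import Data.Maybe.Properties using () renaming (≡-dec to Maybe-≡-dec)
open import Data.Nat.Base using (ℕ; zero; suc; pred; _+_; _≤_; _<_; _>_; z≤n; s≤s; z<s)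
open import Data.Nat.Properties using (_≟_; _≤?_; _<?_; _≥?_; _>?_; allUpTo?; anyUpTo?; ≤-trans; ≤-refl; ≤-reflexive; <⇒≤; <-irrefl; m≤n⇒m<n∨m≡n; +-suc; +-identityʳ; m<m+n; ≤-<-trans; ≤-pred)
open import Data.Product.Base using (Σ; ∃; _×_; _,_; proj₁; proj₂)
open import Data.Sum.Base using (_⊎_; inj₁; inj₂)
open import Data.Vec.Base as Vec using (Vec; []; _∷_)
open import Function.Bundles using (_⇔_; mk⇔; Equivalence)
open import Level using (_⊔_)
open import Relation.Binary.Definitions using (DecidableEquality)
open import Relation.Binary.PropositionalEquality using (_≡_; refl; cong; sym; trans; subst)
open import Relation.Nullary.Decidable using (Dec; yes; no; ¬?; map′; _×-dec_; _→-dec_; dec⇒maybe; recompute)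
open import Relation.Nullary.Negation using (¬_; contradiction)
open import Relation.Unary using (Decidable; Pred)

import Algebra.Apartness.Properties.HeytingCommutativeRing as HeytingProperties
import Algebra.Definitions.RawMonoid as MonoidDefinitions
import Algebra.Properties.Ring as RingProperties
import Algebra.Properties.Semiring.Exp as Exponentiation
import Algebra.Solver.Ring.NaturalCoefficients.Default as SemiringSolver
import Relation.Binary.Reasoning.Setoid as SetoidReasoning

CharacteristicZero : ∀ {c ℓ₁ ℓ₂} → HeytingField c ℓ₁ ℓ₂ → Set ℓ₁
CharacteristicZero K = ∀ n → ¬ (suc n ×ᴷ 1# ≈ 0#)
  where
  open HeytingField K
  open MonoidDefinitions (CommutativeRing.+-rawMonoid (HeytingCommutativeRing.commutativeRing heytingCommutativeRing)) using () renaming (_×_ to _×ᴷ_)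

------------------------------------------------------------------------
-- The field of rational functions K(q)

-- Fractions n / d with d in a multiplicative set S of cancellable elements.
module Fractions {c ℓ s} (R : CommutativeRing c ℓ)
  (S : Pred (CommutativeRing.Carrier R) s) (1∈S : S (CommutativeRing.1# R))
  (·-closed : ∀ {x y} → S x → S y → S (CommutativeRing._*_ R x y))
  (cancel : ∀ {x y d} → S d → CommutativeRing._≈_ R (CommutativeRing._*_ R x d) (CommutativeRing._*_ R y d) → CommutativeRing._≈_ R x y) where

  open CommutativeRing R using (Carrier; _≈_; 1#)
  private
    module R = CommutativeRing R
    module Solver = SemiringSolver R.commutativeSemiring
  open Solver using (solve; _:=_; _:+_; _:*_; con)

  infix 7 _/_⟨_⟩
  record Fraction : Set (c ⊔ s) where
    constructor _/_⟨_⟩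
    field
      num : Carrier
      den : Carrier
      den∈S : S den
  open Fraction public

  infix 4 _≃_
  record _≃_ (x y : Fraction) : Set ℓ where
    constructor cross
    field
      uncross : num x R.* den y ≈ num y R.* den x
  open _≃_ public

  infixl 6 _⊕_
  infixl 7 _⊗_
  _⊕_ _⊗_ : Fraction → Fraction → Fraction
  (a / s ⟨ s∈S ⟩) ⊕ (b / t ⟨ t∈S ⟩) = (a R.* t R.+ b R.* s) / (s R.* t) ⟨ ·-closed s∈S t∈S ⟩
  (a / s ⟨ s∈S ⟩) ⊗ (b / t ⟨ t∈S ⟩) = (a R.* b) / (s R.* t) ⟨ ·-closed s∈S t∈S ⟩

  ⊖_ : Fraction → Fraction
  ⊖ (a / s ⟨ s∈S ⟩) = (R.- a) / s ⟨ s∈S ⟩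

  0ᶠ 1ᶠ : Fraction
  0ᶠ = R.0# / 1# ⟨ 1∈S ⟩
  1ᶠ = 1# / 1# ⟨ 1∈S ⟩

  private
    open SetoidReasoning R.setoid
    open RingProperties R.ring using (-‿distribˡ-*)

    ≃-refl : ∀ {x} → x ≃ x
    ≃-refl = cross R.refl

    ≃-sym : ∀ {x y} → x ≃ y → y ≃ x
    ≃-sym (cross e) = cross (R.sym e)

    ≃-trans : ∀ {x y z} → x ≃ y → y ≃ z → x ≃ z
    ≃-trans {a / s ⟨ _ ⟩} {b / t ⟨ t∈S ⟩} {c / u ⟨ _ ⟩} (cross e) (cross f) = cross (cancel t∈S (begin
      a R.* u R.* t    ≈⟨ solve 3 (λ a u t → a :* u :* t := a :* t :* u) R.refl a u t ⟩
      a R.* t R.* u    ≈⟨ R.*-congʳ e ⟩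
      b R.* s R.* u    ≈⟨ solve 3 (λ b s u → b :* s :* u := b :* u :* s) R.refl b s u ⟩
      b R.* u R.* s    ≈⟨ R.*-congʳ f ⟩
      c R.* t R.* s    ≈⟨ solve 3 (λ c t s → c :* t :* s := c :* s :* t) R.refl c t s ⟩
      c R.* s R.* t    ∎))

    ⊕-cong : ∀ {x x′ y y′} → x ≃ x′ → y ≃ y′ → x ⊕ y ≃ x′ ⊕ y′
    ⊕-cong {a / s ⟨ _ ⟩} {a′ / s′ ⟨ _ ⟩} {b / t ⟨ _ ⟩} {b′ / t′ ⟨ _ ⟩} (cross e) (cross f) = cross (begin
      (a R.* t R.+ b R.* s) R.* (s′ R.* t′)
        ≈⟨ solve 6 (λ a s s′ b t t′ → (a :* t :+ b :* s) :* (s′ :* t′) := (a :* s′) :* (t :* t′) :+ (b :* t′) :* (s :* s′)) R.refl a s s′ b t t′ ⟩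
      (a R.* s′) R.* (t R.* t′) R.+ (b R.* t′) R.* (s R.* s′)
        ≈⟨ R.+-cong (R.*-congʳ e) (R.*-congʳ f) ⟩
      (a′ R.* s) R.* (t R.* t′) R.+ (b′ R.* t) R.* (s R.* s′)
        ≈⟨ solve 6 (λ a′ s s′ b′ t t′ → (a′ :* s) :* (t :* t′) :+ (b′ :* t) :* (s :* s′) := (a′ :* t′ :+ b′ :* s′) :* (s :* t)) R.refl a′ s s′ b′ t t′ ⟩
      (a′ R.* t′ R.+ b′ R.* s′) R.* (s R.* t) ∎)

    ⊗-cong : ∀ {x x′ y y′} → x ≃ x′ → y ≃ y′ → x ⊗ y ≃ x′ ⊗ y′
    ⊗-cong {a / s ⟨ _ ⟩} {a′ / s′ ⟨ _ ⟩} {b / t ⟨ _ ⟩} {b′ / t′ ⟨ _ ⟩} (cross e) (cross f) = cross (begin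
      (a R.* b) R.* (s′ R.* t′)    ≈⟨ solve 4 (λ a b s′ t′ → (a :* b) :* (s′ :* t′) := (a :* s′) :* (b :* t′)) R.refl a b s′ t′ ⟩
      (a R.* s′) R.* (b R.* t′)    ≈⟨ R.*-cong e f ⟩
      (a′ R.* s) R.* (b′ R.* t)    ≈⟨ solve 4 (λ a′ s b′ t → (a′ :* s) :* (b′ :* t) := (a′ :* b′) :* (s :* t)) R.refl a′ s b′ t ⟩
      (a′ R.* b′) R.* (s R.* t)    ∎)

    ⊖-cong : ∀ {x y} → x ≃ y → ⊖ x ≃ ⊖ y
    ⊖-cong {a / s ⟨ _ ⟩} {b / t ⟨ _ ⟩} (cross e) = cross (begin
      (R.- a) R.* t     ≈⟨ -‿distribˡ-* a t ⟨
      R.- (a R.* t)     ≈⟨ R.-‿cong e ⟩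
      R.- (b R.* s)     ≈⟨ -‿distribˡ-* b s ⟩
      (R.- b) R.* s     ∎)

    ⊕-assoc : ∀ x y z → (x ⊕ y) ⊕ z ≃ x ⊕ (y ⊕ z)
    ⊕-assoc (a / s ⟨ _ ⟩) (b / t ⟨ _ ⟩) (c / u ⟨ _ ⟩) = cross
      (solve 6 (λ a s b t c u → ((a :* t :+ b :* s) :* u :+ c :* (s :* t)) :* (s :* (t :* u)) := (a :* (t :* u) :+ (b :* u :+ c :* t) :* s) :* ((s :* t) :* u)) R.refl a s b t c u)

    ⊕-comm : ∀ x y → x ⊕ y ≃ y ⊕ x
    ⊕-comm (a / s ⟨ _ ⟩) (b / t ⟨ _ ⟩) = cross
      (solve 4 (λ a s b t → (a :* t :+ b :* s) :* (t :* s) := (b :* s :+ a :* t) :* (s :* t)) R.refl a s b t)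

    ⊕-identityˡ : ∀ x → 0ᶠ ⊕ x ≃ x
    ⊕-identityˡ (a / s ⟨ _ ⟩) = cross
      (solve 2 (λ a s → (con 0 :* s :+ a :* con 1) :* s := a :* (con 1 :* s)) R.refl a s)

    ⊕-inverseˡ : ∀ x → (⊖ x) ⊕ x ≃ 0ᶠ
    ⊕-inverseˡ (a / s ⟨ _ ⟩) = cross (begin
      ((R.- a) R.* s R.+ a R.* s) R.* 1#   ≈⟨ R.*-congʳ (R.distribʳ s (R.- a) a) ⟨
      ((R.- a R.+ a) R.* s) R.* 1#         ≈⟨ R.*-congʳ (R.*-congʳ (R.-‿inverseˡ a)) ⟩
      (R.0# R.* s) R.* 1#                  ≈⟨ solve 1 (λ s → (con 0 :* s) :* con 1 := con 0 :* (s :* s)) R.refl s ⟩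
      R.0# R.* (s R.* s)                   ∎)

    ⊗-assoc : ∀ x y z → (x ⊗ y) ⊗ z ≃ x ⊗ (y ⊗ z)
    ⊗-assoc (a / s ⟨ _ ⟩) (b / t ⟨ _ ⟩) (c / u ⟨ _ ⟩) = cross
      (solve 6 (λ a s b t c u → ((a :* b) :* c) :* (s :* (t :* u)) := (a :* (b :* c)) :* ((s :* t) :* u)) R.refl a s b t c u)

    ⊗-comm : ∀ x y → x ⊗ y ≃ y ⊗ x
    ⊗-comm (a / s ⟨ _ ⟩) (b / t ⟨ _ ⟩) = cross
      (solve 4 (λ a s b t → (a :* b) :* (t :* s) := (b :* a) :* (s :* t)) R.refl a s b t)

    ⊗-identityˡ : ∀ x → 1ᶠ ⊗ x ≃ x
    ⊗-identityˡ (a / s ⟨ _ ⟩) = cross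
      (solve 2 (λ a s → (con 1 :* a) :* s := a :* (con 1 :* s)) R.refl a s)

    ⊗-distribˡ-⊕ : ∀ x y z → x ⊗ (y ⊕ z) ≃ (x ⊗ y) ⊕ (x ⊗ z)
    ⊗-distribˡ-⊕ (a / s ⟨ _ ⟩) (b / t ⟨ _ ⟩) (c / u ⟨ _ ⟩) = cross
      (solve 6 (λ a s b t c u → (a :* (b :* u :+ c :* t)) :* ((s :* t) :* (s :* u)) := ((a :* b) :* (s :* u) :+ (a :* c) :* (s :* t)) :* (s :* (t :* u))) R.refl a s b t c u)

  commutativeRing : CommutativeRing (c ⊔ s) ℓ
  commutativeRing = record
    { Carrier = Fraction ; _≈_ = _≃_ ; _+_ = _⊕_ ; _*_ = _⊗_ ; -_ = ⊖_ ; 0# = 0ᶠ ; 1# = 1ᶠ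
    ; isCommutativeRing = record
      { isRing = record
        { +-isAbelianGroup = record
          { isGroup = record
            { isMonoid = record
              { isSemigroup = record
                { isMagma = record
                  { isEquivalence = record { refl = ≃-refl ; sym = ≃-sym ; trans = ≃-trans }
                  ; ∙-cong = ⊕-cong }
                ; assoc = ⊕-assoc }
              ; identity = ⊕-identityˡ , λ x → ≃-trans (⊕-comm x 0ᶠ) (⊕-identityˡ x) }
            ; inverse = ⊕-inverseˡ , λ x → ≃-trans (⊕-comm x (⊖ x)) (⊕-inverseˡ x)
            ; ⁻¹-cong = ⊖-cong }
          ; comm = ⊕-comm }
        ; *-cong = ⊗-cong
        ; *-assoc = ⊗-assoc
        ; *-identity = ⊗-identityˡ , λ x → ≃-trans (⊗-comm x 1ᶠ) (⊗-identityˡ x)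
        ; distrib = ⊗-distribˡ-⊕ , λ x y z → ≃-trans (⊗-comm (y ⊕ z) x) (≃-trans (⊗-distribˡ-⊕ x y z) (⊕-cong (⊗-comm x y) (⊗-comm x z))) }
      ; *-comm = ⊗-comm } }

module RationalFunctions {c ℓ₁ ℓ₂} (K : HeytingField c ℓ₁ ℓ₂) where

  private
    module K = HeytingField K
    KR : CommutativeRing c ℓ₁
    KR = HeytingCommutativeRing.commutativeRing K.heytingCommutativeRing
    module KR = CommutativeRing KR
    open HeytingProperties K.heytingCommutativeRing
    open RingProperties KR.ring using (-0#≈0#; -‿involutive)
    module Solver = SemiringSolver KR.commutativeSemiring
    open Solver using (solve; _:=_; _:+_; _:*_; con)
  open K using (Carrier; _≈_; _#_; 0#; 1#)

  -- The polynomial a₀ + a₁ q + ⋯ is the list a₀ ∷ a₁ ∷ ⋯, up to trailing zeros.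
  Poly : Set c
  Poly = List Carrier

  coeff : Poly → ℕ → Carrier
  coeff []      i       = 0#
  coeff (a ∷ p) zero    = a
  coeff (a ∷ p) (suc i) = coeff p i

  infix 4 _≈ₚ_
  record _≈ₚ_ (p r : Poly) : Set ℓ₁ where
    constructor pointwise
    field
      at : ∀ i → coeff p i ≈ coeff r i
  open _≈ₚ_ public

  infixl 6 _+ₚ_
  _+ₚ_ : Poly → Poly → Poly
  []      +ₚ r       = r
  (a ∷ p) +ₚ []      = a ∷ p
  (a ∷ p) +ₚ (b ∷ r) = (a K.+ b) ∷ (p +ₚ r)

  -ₚ_ : Poly → Poly
  -ₚ p = map K.-_ p

  infixl 7 _·ₚ_ _*ₚ_
  _·ₚ_ : Carrier → Poly → Poly
  a ·ₚ p = map (a K.*_) p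

  _*ₚ_ : Poly → Poly → Poly
  []      *ₚ r = []
  (a ∷ p) *ₚ r = (a ·ₚ r) +ₚ (0# ∷ (p *ₚ r))

  0ₚ 1ₚ X : Poly
  0ₚ = []
  1ₚ = 1# ∷ []
  X  = 0# ∷ 1# ∷ []

  Nonzero : Pred Poly ℓ₂
  Nonzero p = ∃ λ i → coeff p i # 0#

  private
    open SetoidReasoning KR.setoid

    coeff-+ : ∀ p r i → coeff (p +ₚ r) i ≈ coeff p i K.+ coeff r i
    coeff-+ []      r       i       = K.sym (K.+-identityˡ (coeff r i))
    coeff-+ (a ∷ p) []      i       = K.sym (K.+-identityʳ (coeff (a ∷ p) i))
    coeff-+ (a ∷ p) (b ∷ r) zero    = K.refl
    coeff-+ (a ∷ p) (b ∷ r) (suc i) = coeff-+ p r i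

    coeff-neg : ∀ p i → coeff (-ₚ p) i ≈ K.- coeff p i
    coeff-neg []      i       = K.sym -0#≈0#
    coeff-neg (a ∷ p) zero    = K.refl
    coeff-neg (a ∷ p) (suc i) = coeff-neg p i

    coeff-· : ∀ a p i → coeff (a ·ₚ p) i ≈ a K.* coeff p i
    coeff-· a []      i       = K.sym (K.zeroʳ a)
    coeff-· a (b ∷ p) zero    = K.refl
    coeff-· a (b ∷ p) (suc i) = coeff-· a p i

    coeff-*-zero : ∀ a p r → coeff ((a ∷ p) *ₚ r) 0 ≈ a K.* coeff r 0
    coeff-*-zero a p r = begin
      coeff ((a ·ₚ r) +ₚ (0# ∷ (p *ₚ r))) 0    ≈⟨ coeff-+ (a ·ₚ r) (0# ∷ (p *ₚ r)) 0 ⟩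
      coeff (a ·ₚ r) 0 K.+ 0#                  ≈⟨ K.+-identityʳ _ ⟩
      coeff (a ·ₚ r) 0                         ≈⟨ coeff-· a r 0 ⟩
      a K.* coeff r 0                          ∎

    coeff-*-suc : ∀ a p r i → coeff ((a ∷ p) *ₚ r) (suc i) ≈ a K.* coeff r (suc i) K.+ coeff (p *ₚ r) i
    coeff-*-suc a p r i = K.trans (coeff-+ (a ·ₚ r) (0# ∷ (p *ₚ r)) (suc i)) (KR.+-congʳ (coeff-· a r (suc i)))

    coeff-*-zeroʳ : ∀ p b r → coeff (p *ₚ (b ∷ r)) 0 ≈ b K.* coeff p 0
    coeff-*-zeroʳ []      b r = K.sym (K.zeroʳ b)
    coeff-*-zeroʳ (a ∷ p) b r = K.trans (coeff-*-zero a p (b ∷ r)) (KR.*-comm a b)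

    coeff-*-sucʳ : ∀ p b r i → coeff (p *ₚ (b ∷ r)) (suc i) ≈ b K.* coeff p (suc i) K.+ coeff (p *ₚ r) i
    coeff-*-sucʳ []      b r i = solve 1 (λ b → con 0 := b :* con 0 :+ con 0) K.refl b
    coeff-*-sucʳ (a ∷ p) b r zero = begin
      coeff ((a ∷ p) *ₚ (b ∷ r)) 1                        ≈⟨ coeff-*-suc a p (b ∷ r) 0 ⟩
      a K.* coeff r 0 K.+ coeff (p *ₚ (b ∷ r)) 0          ≈⟨ KR.+-congˡ (coeff-*-zeroʳ p b r) ⟩
      a K.* coeff r 0 K.+ b K.* coeff p 0                 ≈⟨ KR.+-comm _ _ ⟩
      b K.* coeff p 0 K.+ a K.* coeff r 0                 ≈⟨ KR.+-congˡ (coeff-*-zero a p r) ⟨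
      b K.* coeff p 0 K.+ coeff ((a ∷ p) *ₚ r) 0          ∎
    coeff-*-sucʳ (a ∷ p) b r (suc i) = begin
      coeff ((a ∷ p) *ₚ (b ∷ r)) (suc (suc i))                                          ≈⟨ coeff-*-suc a p (b ∷ r) (suc i) ⟩
      a K.* coeff r (suc i) K.+ coeff (p *ₚ (b ∷ r)) (suc i)                            ≈⟨ KR.+-congˡ (coeff-*-sucʳ p b r i) ⟩
      a K.* coeff r (suc i) K.+ (b K.* coeff p (suc i) K.+ coeff (p *ₚ r) i)            ≈⟨ solve 3 (λ x y z → x :+ (y :+ z) := y :+ (x :+ z)) K.refl (a K.* coeff r (suc i)) (b K.* coeff p (suc i)) (coeff (p *ₚ r) i) ⟩
      b K.* coeff p (suc i) K.+ (a K.* coeff r (suc i) K.+ coeff (p *ₚ r) i)            ≈⟨ KR.+-congˡ (coeff-*-suc a p r i) ⟨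
      b K.* coeff p (suc i) K.+ coeff ((a ∷ p) *ₚ r) (suc i)                            ∎

    refl-ₚ : ∀ {p} → p ≈ₚ p
    refl-ₚ = pointwise λ i → K.refl

    sym-ₚ : ∀ {p r} → p ≈ₚ r → r ≈ₚ p
    sym-ₚ e = pointwise λ i → K.sym (at e i)

    trans-ₚ : ∀ {p r s} → p ≈ₚ r → r ≈ₚ s → p ≈ₚ s
    trans-ₚ e f = pointwise λ i → K.trans (at e i) (at f i)

    +ₚ-cong : ∀ {p p′ r r′} → p ≈ₚ p′ → r ≈ₚ r′ → p +ₚ r ≈ₚ p′ +ₚ r′
    +ₚ-cong {p} {p′} {r} {r′} e f = pointwise λ i →
      K.trans (coeff-+ p r i) (K.trans (K.+-cong (at e i) (at f i)) (K.sym (coeff-+ p′ r′ i)))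

    +ₚ-comm : ∀ p r → p +ₚ r ≈ₚ r +ₚ p
    +ₚ-comm p r = pointwise λ i → K.trans (coeff-+ p r i) (K.trans (KR.+-comm _ _) (K.sym (coeff-+ r p i)))

    +ₚ-assoc : ∀ p r s → (p +ₚ r) +ₚ s ≈ₚ p +ₚ (r +ₚ s)
    +ₚ-assoc p r s = pointwise λ i → begin
      coeff ((p +ₚ r) +ₚ s) i                      ≈⟨ coeff-+ (p +ₚ r) s i ⟩
      coeff (p +ₚ r) i K.+ coeff s i               ≈⟨ KR.+-congʳ (coeff-+ p r i) ⟩
      (coeff p i K.+ coeff r i) K.+ coeff s i      ≈⟨ K.+-assoc _ _ _ ⟩
      coeff p i K.+ (coeff r i K.+ coeff s i)      ≈⟨ KR.+-congˡ (coeff-+ r s i) ⟨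
      coeff p i K.+ coeff (r +ₚ s) i               ≈⟨ coeff-+ p (r +ₚ s) i ⟨
      coeff (p +ₚ (r +ₚ s)) i                      ∎

    -ₚ-cong : ∀ {p r} → p ≈ₚ r → -ₚ p ≈ₚ -ₚ r
    -ₚ-cong {p} {r} e = pointwise λ i → K.trans (coeff-neg p i) (K.trans (K.-‿cong (at e i)) (K.sym (coeff-neg r i)))

    -ₚ-inverseˡ : ∀ p → (-ₚ p) +ₚ p ≈ₚ 0ₚ
    -ₚ-inverseˡ p = pointwise λ i →
      K.trans (coeff-+ (-ₚ p) p i) (K.trans (KR.+-congʳ (coeff-neg p i)) (K.-‿inverseˡ (coeff p i)))

    *ₚ-congˡ : ∀ p {r s} → r ≈ₚ s → p *ₚ r ≈ₚ p *ₚ s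
    *ₚ-congˡ []      e = refl-ₚ
    *ₚ-congˡ (a ∷ p) {r} {s} e = pointwise λ where
      zero    → K.trans (coeff-*-zero a p r) (K.trans (KR.*-congˡ (at e 0)) (K.sym (coeff-*-zero a p s)))
      (suc i) → K.trans (coeff-*-suc a p r i) (K.trans (K.+-cong (KR.*-congˡ (at e (suc i))) (at (*ₚ-congˡ p e) i)) (K.sym (coeff-*-suc a p s i)))

    *ₚ-zeroʳ : ∀ p → p *ₚ [] ≈ₚ []
    *ₚ-zeroʳ []      = refl-ₚ
    *ₚ-zeroʳ (a ∷ p) = pointwise λ where
      zero    → K.refl
      (suc i) → at (*ₚ-zeroʳ p) i

    *ₚ-comm : ∀ p r → p *ₚ r ≈ₚ r *ₚ p
    *ₚ-comm []      r = sym-ₚ (*ₚ-zeroʳ r)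
    *ₚ-comm (a ∷ p) r = pointwise λ where
      zero    → K.trans (coeff-*-zero a p r) (K.sym (coeff-*-zeroʳ r a p))
      (suc i) → K.trans (coeff-*-suc a p r i) (K.trans (KR.+-congˡ (at (*ₚ-comm p r) i)) (K.sym (coeff-*-sucʳ r a p i)))

    *ₚ-cong : ∀ {p p′ r r′} → p ≈ₚ p′ → r ≈ₚ r′ → p *ₚ r ≈ₚ p′ *ₚ r′
    *ₚ-cong {p} {p′} {r} {r′} e f = trans-ₚ (*ₚ-congˡ p f) (trans-ₚ (*ₚ-comm p r′) (trans-ₚ (*ₚ-congˡ r′ e) (*ₚ-comm r′ p′)))

    *ₚ-distribˡ : ∀ p r s → p *ₚ (r +ₚ s) ≈ₚ (p *ₚ r) +ₚ (p *ₚ s)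
    *ₚ-distribˡ []      r s = refl-ₚ
    *ₚ-distribˡ (a ∷ p) r s = pointwise λ where
      zero → begin
        coeff ((a ∷ p) *ₚ (r +ₚ s)) 0                            ≈⟨ coeff-*-zero a p (r +ₚ s) ⟩
        a K.* coeff (r +ₚ s) 0                                   ≈⟨ KR.*-congˡ (coeff-+ r s 0) ⟩
        a K.* (coeff r 0 K.+ coeff s 0)                          ≈⟨ KR.distribˡ a _ _ ⟩
        a K.* coeff r 0 K.+ a K.* coeff s 0                      ≈⟨ K.+-cong (coeff-*-zero a p r) (coeff-*-zero a p s) ⟨
        coeff ((a ∷ p) *ₚ r) 0 K.+ coeff ((a ∷ p) *ₚ s) 0        ≈⟨ coeff-+ ((a ∷ p) *ₚ r) ((a ∷ p) *ₚ s) 0 ⟨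
        coeff (((a ∷ p) *ₚ r) +ₚ ((a ∷ p) *ₚ s)) 0               ∎
      (suc i) → begin
        coeff ((a ∷ p) *ₚ (r +ₚ s)) (suc i)
          ≈⟨ coeff-*-suc a p (r +ₚ s) i ⟩
        a K.* coeff (r +ₚ s) (suc i) K.+ coeff (p *ₚ (r +ₚ s)) i
          ≈⟨ K.+-cong (KR.*-congˡ (coeff-+ r s (suc i))) (K.trans (at (*ₚ-distribˡ p r s) i) (coeff-+ (p *ₚ r) (p *ₚ s) i)) ⟩
        a K.* (coeff r (suc i) K.+ coeff s (suc i)) K.+ (coeff (p *ₚ r) i K.+ coeff (p *ₚ s) i)
          ≈⟨ solve 5 (λ a x y z w → a :* (x :+ y) :+ (z :+ w) := (a :* x :+ z) :+ (a :* y :+ w)) K.refl a (coeff r (suc i)) (coeff s (suc i)) (coeff (p *ₚ r) i) (coeff (p *ₚ s) i) ⟩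
        (a K.* coeff r (suc i) K.+ coeff (p *ₚ r) i) K.+ (a K.* coeff s (suc i) K.+ coeff (p *ₚ s) i)
          ≈⟨ K.+-cong (coeff-*-suc a p r i) (coeff-*-suc a p s i) ⟨
        coeff ((a ∷ p) *ₚ r) (suc i) K.+ coeff ((a ∷ p) *ₚ s) (suc i)
          ≈⟨ coeff-+ ((a ∷ p) *ₚ r) ((a ∷ p) *ₚ s) (suc i) ⟨
        coeff (((a ∷ p) *ₚ r) +ₚ ((a ∷ p) *ₚ s)) (suc i) ∎

    *ₚ-distribʳ : ∀ p r s → (r +ₚ s) *ₚ p ≈ₚ (r *ₚ p) +ₚ (s *ₚ p)
    *ₚ-distribʳ p r s = trans-ₚ (*ₚ-comm (r +ₚ s) p) (trans-ₚ (*ₚ-distribˡ p r s) (+ₚ-cong (*ₚ-comm p r) (*ₚ-comm p s)))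

    ·ₚ-*ₚ-assoc : ∀ a r s → (a ·ₚ r) *ₚ s ≈ₚ a ·ₚ (r *ₚ s)
    ·ₚ-*ₚ-assoc a []      s = refl-ₚ
    ·ₚ-*ₚ-assoc a (b ∷ r) s = pointwise λ where
      zero → begin
        coeff ((a K.* b ∷ a ·ₚ r) *ₚ s) 0    ≈⟨ coeff-*-zero (a K.* b) (a ·ₚ r) s ⟩
        a K.* b K.* coeff s 0                ≈⟨ K.*-assoc a b _ ⟩
        a K.* (b K.* coeff s 0)              ≈⟨ KR.*-congˡ (coeff-*-zero b r s) ⟨
        a K.* coeff ((b ∷ r) *ₚ s) 0         ≈⟨ coeff-· a ((b ∷ r) *ₚ s) 0 ⟨
        coeff (a ·ₚ ((b ∷ r) *ₚ s)) 0        ∎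
      (suc i) → begin
        coeff ((a K.* b ∷ a ·ₚ r) *ₚ s) (suc i)
          ≈⟨ coeff-*-suc (a K.* b) (a ·ₚ r) s i ⟩
        a K.* b K.* coeff s (suc i) K.+ coeff ((a ·ₚ r) *ₚ s) i
          ≈⟨ KR.+-congˡ (K.trans (at (·ₚ-*ₚ-assoc a r s) i) (coeff-· a (r *ₚ s) i)) ⟩
        a K.* b K.* coeff s (suc i) K.+ a K.* coeff (r *ₚ s) i
          ≈⟨ solve 4 (λ a b x y → a :* b :* x :+ a :* y := a :* (b :* x :+ y)) K.refl a b (coeff s (suc i)) (coeff (r *ₚ s) i) ⟩
        a K.* (b K.* coeff s (suc i) K.+ coeff (r *ₚ s) i)
          ≈⟨ KR.*-congˡ (coeff-*-suc b r s i) ⟨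
        a K.* coeff ((b ∷ r) *ₚ s) (suc i)
          ≈⟨ coeff-· a ((b ∷ r) *ₚ s) (suc i) ⟨
        coeff (a ·ₚ ((b ∷ r) *ₚ s)) (suc i) ∎

    shift-* : ∀ p s → (0# ∷ p) *ₚ s ≈ₚ 0# ∷ (p *ₚ s)
    shift-* p s = pointwise λ where
      zero    → K.trans (coeff-*-zero 0# p s) (K.zeroˡ _)
      (suc i) → K.trans (coeff-*-suc 0# p s i) (K.trans (KR.+-congʳ (K.zeroˡ _)) (K.+-identityˡ _))

    *ₚ-assoc : ∀ p r s → (p *ₚ r) *ₚ s ≈ₚ p *ₚ (r *ₚ s)
    *ₚ-assoc []      r s = refl-ₚ
    *ₚ-assoc (a ∷ p) r s =
      trans-ₚ (*ₚ-distribʳ s (a ·ₚ r) (0# ∷ (p *ₚ r)))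
        (+ₚ-cong (·ₚ-*ₚ-assoc a r s)
          (trans-ₚ (shift-* (p *ₚ r) s) (pointwise λ where
            zero    → K.refl
            (suc i) → at (*ₚ-assoc p r s) i)))

    *ₚ-identityˡ : ∀ p → 1ₚ *ₚ p ≈ₚ p
    *ₚ-identityˡ p = pointwise λ where
      zero    → K.trans (coeff-*-zero 1# [] p) (K.*-identityˡ _)
      (suc i) → K.trans (coeff-*-suc 1# [] p i) (K.trans (K.+-identityʳ _) (K.*-identityˡ _))

  polynomialRing : CommutativeRing c ℓ₁
  polynomialRing = record
    { Carrier = Poly ; _≈_ = _≈ₚ_ ; _+_ = _+ₚ_ ; _*_ = _*ₚ_ ; -_ = -ₚ_ ; 0# = 0ₚ ; 1# = 1ₚ
    ; isCommutativeRing = record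
      { isRing = record
        { +-isAbelianGroup = record
          { isGroup = record
            { isMonoid = record
              { isSemigroup = record
                { isMagma = record
                  { isEquivalence = record { refl = refl-ₚ ; sym = sym-ₚ ; trans = trans-ₚ }
                  ; ∙-cong = +ₚ-cong }
                ; assoc = +ₚ-assoc }
              ; identity = (λ p → refl-ₚ) , λ p → +ₚ-comm p 0ₚ }
            ; inverse = -ₚ-inverseˡ , λ p → trans-ₚ (+ₚ-comm p (-ₚ p)) (-ₚ-inverseˡ p)
            ; ⁻¹-cong = -ₚ-cong }
          ; comm = +ₚ-comm }
        ; *-cong = *ₚ-cong
        ; *-assoc = *ₚ-assoc
        ; *-identity = *ₚ-identityˡ , λ p → trans-ₚ (*ₚ-comm p 1ₚ) (*ₚ-identityˡ p)
        ; distrib = *ₚ-distribˡ , *ₚ-distribʳ }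
      ; *-comm = *ₚ-comm } }

  private
    ¬0#0 : ¬ (0# # 0#)
    ¬0#0 = K.#-irrefl K.refl

    *-#0ˡ : ∀ {a b} → a K.* b # 0# → a # 0#
    *-#0ˡ {a} {b} ab#0 with K.#⇒invertible ab#0
    ... | u , _ , ab*u≈1 = invertibleʳ⇒# (b K.* u , (begin
      (a K.- 0#) K.* (b K.* u)    ≈⟨ KR.*-congʳ (x-0≈x a) ⟩
      a K.* (b K.* u)             ≈⟨ K.*-assoc a b u ⟨
      a K.* b K.* u               ≈⟨ KR.*-congʳ (x-0≈x (a K.* b)) ⟨
      (a K.* b K.- 0#) K.* u      ≈⟨ ab*u≈1 ⟩
      1#                          ∎))

    #-sub : ∀ {x y z} → z ≈ x K.- y → x # y → z # 0#
    #-sub {x} {y} {z} e x#y with K.#⇒invertible x#y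
    ... | u , u*≈1 , _ = invertibleˡ⇒# (u , K.trans (KR.*-congˡ (K.trans (x-0≈x z) e)) u*≈1)

    neg-#0 : ∀ {y} → K.- y # 0# → y # 0#
    neg-#0 {y} -y#0 = #-sub (K.sym (K.trans (K.+-identityˡ _) (-‿involutive y))) (K.#-sym -y#0)

    +-#0 : ∀ {x} y → x # 0# → (y K.+ x # 0#) ⊎ (y # 0#)
    +-#0 {x} y x#0 with K.#-cotrans x#0 (K.- y)
    ... | inj₁ x#-y = inj₁ (#-sub (K.trans (KR.+-comm y x) (KR.+-congˡ (K.sym (-‿involutive y)))) x#-y)
    ... | inj₂ -y#0 = inj₂ (neg-#0 -y#0)

    cons-Nonzero : ∀ {a} p r → a # 0# → Nonzero r → Nonzero ((a ∷ p) *ₚ r)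
    cons-Nonzero     p []      a#0 (_ , 0#0) = ⊥-elim (¬0#0 0#0)
    cons-Nonzero {a} p (b ∷ r) a#0 (zero , b#0) =
      0 , #-congʳ (K.sym (coeff-*-zero a p (b ∷ r))) (x#0y#0→xy#0 a#0 b#0)
    cons-Nonzero {a} p (b ∷ r) a#0 (suc j , h) with cons-Nonzero {a} p r a#0 (j , h)
    ... | k , h′ with +-#0 (b K.* coeff (a ∷ p) (suc k)) h′
    ...   | inj₁ h″ = suc k , #-congʳ (K.sym (coeff-*-sucʳ (a ∷ p) b r k)) h″
    ...   | inj₂ h″ = 0 , #-congʳ (K.sym (coeff-*-zero a p (b ∷ r))) (x#0y#0→xy#0 a#0 (*-#0ˡ h″))

  Nonzero-* : ∀ {p r} → Nonzero p → Nonzero r → Nonzero (p *ₚ r)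
  Nonzero-* {[]}    (_ , 0#0) _ = ⊥-elim (¬0#0 0#0)
  Nonzero-* {a ∷ p} {r} (zero , a#0) nz = cons-Nonzero p r a#0 nz
  Nonzero-* {a ∷ p} {r} (suc i , h)  nz with Nonzero-* {p} {r} (i , h) nz
  ... | k , h′ with +-#0 (a K.* coeff r (suc k)) h′
  ...   | inj₁ h″ = suc k , #-congʳ (K.sym (coeff-*-suc a p r k)) h″
  ...   | inj₂ h″ = cons-Nonzero p r (*-#0ˡ h″) nz

  Nonzero-1 : Nonzero 1ₚ
  Nonzero-1 = 0 , 1#0

  Nonzero-X : Nonzero X
  Nonzero-X = 1 , 1#0

  cancelₚ : ∀ {p r d} → Nonzero d → p *ₚ d ≈ₚ r *ₚ d → p ≈ₚ r
  cancelₚ {p} {r} {d} nz e = pointwise λ i → proj₁ (K.tight (coeff p i) (coeff r i)) (λ p#r → absurd i p#r)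
    where
    module P = CommutativeRing polynomialRing
    open RingProperties P.ring using (-‿distribˡ-*)

    difference : (p P.- r) *ₚ d ≈ₚ 0ₚ
    difference = P.trans (*ₚ-distribʳ d p (-ₚ r)) (P.trans (P.+-cong e (P.sym (-‿distribˡ-* r d))) (P.-‿inverseʳ (r *ₚ d)))

    absurd : ∀ i → ¬ (coeff p i # coeff r i)
    absurd i p#r with Nonzero-* {p P.- r} {d} (i , #-sub (K.trans (coeff-+ p (-ₚ r) i) (KR.+-congˡ (coeff-neg r i))) p#r) nz
    ... | k , h = ¬0#0 (#-congʳ (at difference k) h)

  open Fractions polynomialRing Nonzero Nonzero-1 (λ {p} {r} → Nonzero-* {p} {r}) (λ {p} {r} {d} → cancelₚ {p} {r} {d}) public
    using (Fraction; _/_⟨_⟩; num; den; _≃_; cross; uncross) renaming (commutativeRing to K⟨q⟩)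

  q q⁻¹ : Fraction
  q   = X / 1ₚ ⟨ Nonzero-1 ⟩
  q⁻¹ = 1ₚ / X ⟨ Nonzero-X ⟩

  q*q⁻¹≃1 : CommutativeRing._*_ K⟨q⟩ q q⁻¹ ≃ CommutativeRing.1# K⟨q⟩
  q*q⁻¹≃1 = cross (trans-ₚ (*ₚ-cong {X *ₚ 1ₚ} {1ₚ *ₚ X} {1ₚ} (*ₚ-comm X 1ₚ) refl-ₚ) (*ₚ-comm (1ₚ *ₚ X) 1ₚ))

------------------------------------------------------------------------
-- Compositions

record Composition : Set where
  constructor comp
  field
    parts     : List ℕ
    .positive : All (0 <_) parts
open Composition public using (parts)

parts-injective : ∀ {I J} → parts I ≡ parts J → I ≡ J
parts-injective {comp I _} {comp .I _} refl = refl

infix 4 _≟ᶜ_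
_≟ᶜ_ : DecidableEquality Composition
I ≟ᶜ J = map′ parts-injective (cong parts) (≡-dec _≟_ (parts I) (parts J))

size ℓ : Composition → ℕ
size I = sum (parts I)
ℓ I = length (parts I)

1^_ : ℕ → Composition
1^ n = comp (replicate n 1) (All-replicate⁺ n z<s)

-- A composition of n + 1 arises from a unique composition of n, either by
-- prepending a part 1 or by increasing the first part.
extend : Composition → List Composition
extend (comp []      _)   = comp (1 ∷ []) (z<s ∷ []) ∷ []
extend (comp (i ∷ I) pos) = comp (1 ∷ i ∷ I) (z<s ∷ pos) ∷ comp (suc i ∷ I) (z<s ∷ All.tail pos) ∷ []

compositions : ℕ → List Composition
compositions zero    = comp [] [] ∷ []
compositions (suc n) = concatMap extend (compositions n)

descents : List ℕ → List ℕ
descents []          = []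
descents (i ∷ [])    = []
descents (i ∷ j ∷ I) = i ∷ map (i +_) (descents (j ∷ I))

Des : Composition → List ℕ
Des I = descents (parts I)

infix 4 _⪯_ _⪯?_
_⪯_ : Composition → Composition → Set
I ⪯ J = size I ≡ size J × Des J ⊆ Des I

_⪯?_ : ∀ I J → Dec (I ⪯ J)
I ⪯? J = (size I ≟ size J) ×-dec subset? _≟_ (Des J) (Des I)

finerThan coarserThan : Composition → List Composition
finerThan   J = filter (_⪯? J) (compositions (size J))
coarserThan I = filter (I ⪯?_) (compositions (size I))

st st′ : Composition → Composition → ℕ
st  I J = length (filter (λ (a , b) → a ≥? b) (cartesianProduct (Des I) (Des J)))
st′ I J = length (filter (λ (a , b) → a ≤? b) (cartesianProduct (Des I) (Des J)))

------------------------------------------------------------------------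
-- Permutation tableaux

-- The column lengths, from left to right, of the diagram encoded by I.
columns : List ℕ → List ℕ
columns []      = []
columns (i ∷ I) = replicate (pred i) (length (i ∷ I)) ++ columns I

columnLengths : Composition → List ℕ
columnLengths I = columns (parts I)

-- A filling of the diagram with the given column lengths; each column is
-- listed from bottom to top, and true stands for 1.
Filling : List ℕ → Set
Filling = All (Vec Bool)

entry : ∀ {h} → Vec Bool h → ℕ → Maybe Bool
entry []      r       = nothing
entry (b ∷ v) zero    = just b
entry (b ∷ v) (suc r) = entry v r

-- box T c r is the entry in column c (counted from the left) and row r
-- (counted from the bottom), both from 0; it is nothing outside the diagram.
box : ∀ {hs} → Filling hs → ℕ → ℕ → Maybe Bool
box []      c       r = nothing
box (v ∷ T) zero    r = entry v r
box (v ∷ T) (suc c) r = box T c r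

ones : ∀ {hs} → Filling hs → ℕ
ones []      = 0
ones (v ∷ T) = Vec.count T? v + ones T

module _ (I : Composition) (T : Filling (columnLengths I)) where

  EveryColumnHasOne : Set
  EveryColumnHasOne = ∀ {c} → c < length (columnLengths I) → ∃ λ r → r < ℓ I × box T c r ≡ just true

  NoForbiddenZero : Set
  NoForbiddenZero = ∀ {c} → c < length (columnLengths I) → ∀ {r} → r < ℓ I → box T c r ≡ just false →
    ¬ ((∃ λ r′ → r′ < r × box T c r′ ≡ just true) × (∃ λ c′ → c′ < c × box T c′ r ≡ just true))

  IsPermutationTableau : Set
  IsPermutationTableau = EveryColumnHasOne × NoForbiddenZero

isPermutationTableau? : ∀ I → Decidable (IsPermutationTableau I)
isPermutationTableau? I T =
  allUpTo? (λ c → anyUpTo? (λ r → box T c r ≟ᵐ just true) (ℓ I)) (length (columnLengths I))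
  ×-dec
  allUpTo? (λ c → allUpTo? (λ r → (box T c r ≟ᵐ just false) →-dec
       ¬? (anyUpTo? (λ r′ → box T c r′ ≟ᵐ just true) r ×-dec anyUpTo? (λ c′ → box T c′ r ≟ᵐ just true) c))
    (ℓ I)) (length (columnLengths I))
  where
  _≟ᵐ_ : DecidableEquality (Maybe Bool)
  _≟ᵐ_ = Maybe-≡-dec _≟ᵇ_

bits : ∀ h → List (Vec Bool h)
bits zero    = [] ∷ []
bits (suc h) = cartesianProductWith _∷_ (false ∷ true ∷ []) (bits h)

fillings : ∀ hs → List (Filling hs)
fillings []       = [] ∷ []
fillings (h ∷ hs) = cartesianProductWith _∷_ (bits h) (fillings hs)

permutationTableaux : ∀ I → List (Filling (columnLengths I))
permutationTableaux I = filter (isPermutationTableau? I) (fillings (columnLengths I))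

rank : ∀ {hs} → Filling hs → ℤ
rank {hs} T = ℤ.+ ones T ℤ.- ℤ.+ length hs

------------------------------------------------------------------------
-- Packed words

Packed : List ℕ → Set
Packed w = ∃ λ m → ∀ x → x ∈ w ⇔ (1 ≤ x × x ≤ m)

packed? : Decidable Packed
packed? w = map′ to from (All.all? (1 ≤?_) w ×-dec allUpTo? (λ x → mem? _≟_ (suc x) w) (max 0 w))
  where
  Q : Set
  Q = All (1 ≤_) w × (∀ {x} → x < max 0 w → suc x ∈ w)

  to : Q → Packed w
  to (1≤w , full) = max 0 w , λ x → mk⇔ (λ x∈w → All.lookup 1≤w x∈w , All.lookup (xs≤max 0 w) x∈w) λ { (s≤s z≤n , x≤m) → full x≤m }

  from : Packed w → Q
  from (m , h) = All.tabulate (λ {x} x∈w → proj₁ (Equivalence.to (h x) x∈w)) ,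
    λ {x} x<max → Equivalence.from (h (suc x)) (s≤s z≤n , ≤-trans x<max (max≤v⁺ {xs = w} z≤n (All.tabulate λ {y} y∈w → proj₂ (Equivalence.to (h y) y∈w))))

record PackedWord : Set where
  constructor word
  field
    letters : List ℕ
    .packed : Packed letters
open PackedWord public using (letters)

letters-injective : ∀ {u v} → letters u ≡ letters v → u ≡ v
letters-injective {word u _} {word .u _} refl = refl

infix 4 _≟ʷ_
_≟ʷ_ : DecidableEquality PackedWord
u ≟ʷ v = map′ letters-injective (cong letters) (≡-dec _≟_ (letters u) (letters v))

ε : PackedWord
ε = word [] (0 , λ x → mk⇔ (λ ()) λ { (s≤s z≤n , ()) })

∣_∣ : PackedWord → ℕ
∣ u ∣ = length (letters u)

-- words m n consists of the words of length n over {1, …, m}.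
words : ℕ → ℕ → List (List ℕ)
words m zero    = [] ∷ []
words m (suc n) = cartesianProductWith _∷_ (applyUpTo suc m) (words m n)

-- The letters of a packed word of length n are at most n.
packedWords : ℕ → List PackedWord
packedWords n = mapMaybe (λ w → Maybe.map (λ p → word w p) (dec⇒maybe (packed? w))) (words n n)

pack : List ℕ → List ℕ
pack w = map (λ x → length (filter (_≤? x) (deduplicate _≟_ w))) w

sinvPair? : ∀ w ((i , j) : Fin (length w) × Fin (length w)) →
  Dec (i <ᶠ j × lookup w i > lookup w j × lookup w j ∉ drop (suc (toℕ j)) w)
sinvPair? w (i , j) =
  (i <ᶠ? j) ×-dec ((lookup w i >? lookup w j) ×-dec ¬? (mem? _≟_ (lookup w j) (drop (suc (toℕ j)) w)))

sinv : List ℕ → ℤ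
sinv w = ℤ.+ length (filter (sinvPair? w) (cartesianProduct (allFin (length w)) (allFin (length w))))

-- WC w cuts w after every position whose letter does not occur later; the
-- last position always is one, and the others form the descent set.
-- In cut a w, a letters already belong to the current part.
cut : ℕ → List ℕ → List ℕ
cut a []      = []
cut a (x ∷ w) with mem? _≟_ x w
... | yes _ = cut (suc a) w
... | no  _ = suc a ∷ cut 0 w

cut-positive : ∀ a w → All (0 <_) (cut a w)
cut-positive a []      = []
cut-positive a (x ∷ w) with mem? _≟_ x w
... | yes _ = cut-positive (suc a) w
... | no  _ = z<s ∷ cut-positive 0 w

WC : PackedWord → Composition
WC u = comp (cut 0 (letters u)) (cut-positive 0 (letters u))

-- blocks m (i₁ , … , iᵣ) is the word mⁱ¹ (m + 1)ⁱ² ⋯ (m + r - 1)ⁱʳ.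
blocks : ℕ → List ℕ → List ℕ
blocks m []      = []
blocks m (i ∷ I) = replicate i m ++ blocks (suc m) I

blocks-bounds : ∀ m I {x} → x ∈ blocks m I → m ≤ x × x < m + length I
blocks-bounds m (i ∷ I) x∈ with ∈-++⁻ (replicate i m) x∈
... | inj₁ x∈rep = subst (λ x → m ≤ x × x < m + suc (length I)) (sym (replicated i x∈rep)) (≤-refl , m<m+n m z<s)
  where
  replicated : ∀ k {x} → x ∈ replicate k m → x ≡ m
  replicated (suc k) (here eq)   = eq
  replicated (suc k) (there x∈′) = replicated k x∈′
... | inj₂ x∈blk with blocks-bounds (suc m) I x∈blk
...   | m<x , x<m+ = <⇒≤ m<x , ≤-trans x<m+ (≤-reflexive (sym (+-suc m (length I))))

blocks-full : ∀ m {I} → All (0 <_) I → ∀ {x} → m ≤ x → x < m + length I → x ∈ blocks m I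
blocks-full m [] {x} m≤x x<m = contradiction (≤-<-trans m≤x (subst (x <_) (+-identityʳ m) x<m)) (<-irrefl refl)
blocks-full m {suc i ∷ I} (_ ∷ pos) {x} m≤x x<m+ with m≤n⇒m<n∨m≡n m≤x
... | inj₂ refl = here refl
... | inj₁ m<x  = ∈-++⁺ʳ (replicate (suc i) m) (blocks-full (suc m) pos m<x (subst (x <_) (+-suc m (length I)) x<m+))

blocks-packed : ∀ {I} → All (0 <_) I → Packed (blocks 1 I)
blocks-packed {I} pos = length I , λ x → mk⇔
  (λ x∈ → let (1≤x , x<) = blocks-bounds 1 I x∈ in 1≤x , ≤-pred x<)
  (λ (1≤x , x≤) → blocks-full 1 pos 1≤x (s≤s x≤))

blockWord : Composition → PackedWord
blockWord (comp I pos) = word (blocks 1 I) (blocks-packed pos)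

cut-blocks : ∀ m {I} → All (0 <_) I → cut 0 (blocks m I) ≡ I
cut-blocks m [] = refl
cut-blocks m {suc i ∷ I} (_ ∷ pos) = trans (run 0 i) (cong (suc i ∷_) (cut-blocks (suc m) pos))
  where
  rest : List ℕ
  rest = blocks (suc m) I

  run : ∀ a k → cut a (replicate (suc k) m ++ rest) ≡ suc (a + k) ∷ cut 0 rest
  run a zero with mem? _≟_ m rest
  ... | yes m∈ = contradiction (proj₁ (blocks-bounds (suc m) I m∈)) (<-irrefl refl)
  ... | no  _  = cong (λ b → suc b ∷ cut 0 rest) (sym (+-identityʳ a))
  run a (suc k) with mem? _≟_ m (replicate (suc k) m ++ rest)
  ... | yes _ = trans (run (suc a) k) (cong (λ b → suc b ∷ cut 0 rest) (sym (+-suc a k)))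
  ... | no m∉ = contradiction (here refl) m∉

WC-blockWord : ∀ I → WC (blockWord I) ≡ I
WC-blockWord (comp I pos) = parts-injective (cut-blocks 1 (recompute (All.all? (0 <?_) I) pos))

------------------------------------------------------------------------
-- WQSym and Sym over K(q)

module Algebraic {c ℓ₁ ℓ₂} (K : HeytingField c ℓ₁ ℓ₂) where

  open RationalFunctions K public using (K⟨q⟩; q; q⁻¹)
  open CommutativeRing K⟨q⟩ public using (Carrier; _≈_; 0#; 1#; -_) renaming (_+_ to _⊕_; _*_ to _⊗_)
  open Exponentiation (CommutativeRing.semiring K⟨q⟩) public using (_^_)

  q^_ : ℤ → Carrier
  q^ (ℤ.+ n)    = q ^ n
  q^ (-[1+ n ]) = q⁻¹ ^ suc n

  ∑[_] : ∀ {a} {A : Set a} → List A → (A → Carrier) → Carrier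
  ∑[ xs ] f = foldr (λ x s → f x ⊕ s) 0# xs

  -- The free K(q)-module on a set, as formal linear combinations; it is
  -- considered up to equality of coefficients.
  Free : ∀ {a} → Set a → Set (c ⊔ ℓ₂ ⊔ a)
  Free A = List (Carrier × A)

  module _ {a} {A : Set a} where

    η : A → Free A
    η x = (1# , x) ∷ []

    infixr 7 _•_
    _•_ : Carrier → Free A → Free A
    k • x = map (λ (k′ , b) → k ⊗ k′ , b) x

    infixl 6 _⊞_ _⊟_
    _⊞_ _⊟_ : Free A → Free A → Free A
    x ⊞ y = x ++ y
    x ⊟ y = x ⊞ (- 1#) • y

    linear : ∀ {b} {B : Set b} → (B → Free A) → Free B → Free A
    linear f = concatMap (λ (k , b) → k • f b)

    coefficient : DecidableEquality A → Free A → A → Carrier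
    coefficient _≟_ x b = ∑[ filter (λ (_ , b′) → b′ ≟ b) x ] proj₁

  WQSym : Set (c ⊔ ℓ₂)
  WQSym = Free PackedWord

  M : PackedWord → WQSym
  M = η

  infix 4 _≈ʷ_
  _≈ʷ_ : WQSym → WQSym → Set ℓ₁
  x ≈ʷ y = ∀ u → coefficient _≟ʷ_ x u ≈ coefficient _≟ʷ_ y u

  M⋆M : PackedWord → PackedWord → WQSym
  M⋆M u′ u″ = map (λ u → q^ (sinv (letters u) ℤ.- sinv (letters u′) ℤ.- sinv (letters u″)) , u)
    (filter (λ u → ≡-dec _≟_ (pack (take ∣ u′ ∣ (letters u))) (letters u′)
                   ×-dec ≡-dec _≟_ (pack (drop ∣ u′ ∣ (letters u))) (letters u″))
      (packedWords (∣ u′ ∣ + ∣ u″ ∣)))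

  infixr 7 _⋆_
  _⋆_ : WQSym → WQSym → WQSym
  x ⋆ y = linear (λ u′ → linear (λ u″ → M⋆M u′ u″) y) x

  S̃ : ℕ → WQSym
  S̃ m = map (1# ,_) (filter (λ u → linked? _≤?_ (letters u)) (packedWords m))

  -- The quotient of WQSym by the span of all M u - M v with WC u = WC v has
  -- the elements of WQSym as its elements, and a coarser equality.
  Sym : Set (c ⊔ ℓ₂)
  Sym = WQSym

  ζ : WQSym → Sym
  ζ x = x

  Relator : Set
  Relator = Σ (PackedWord × PackedWord) λ (u , v) → WC u ≡ WC v

  infix 4 _≈ˢ_
  _≈ˢ_ : Sym → Sym → Set (c ⊔ ℓ₁ ⊔ ℓ₂)
  x ≈ˢ y = ∃ λ (r : Free Relator) → x ⊟ y ≈ʷ linear (λ ((u , v) , _) → M u ⊟ M v) r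

  -- By WC-blockWord, blockWord I is a word u with WC u = I.
  Ψ : Composition → Sym
  Ψ I = ζ (M (blockWord I))

  S : Composition → Sym
  S J = ζ (foldr (λ j x → S̃ j ⋆ x) (M ε) (parts J))

  L : Composition → Sym
  L J = linear Ψ (map (λ I → q ^ st I J , I) (finerThan J))

  infix 4 _≈ᶜ_
  _≈ᶜ_ : Free Composition → Free Composition → Set ℓ₁
  e ≈ᶜ f = ∀ I → coefficient _≟ᶜ_ e I ≈ coefficient _≟ᶜ_ f I

  infix 4 _IsLExpansionOf_
  _IsLExpansionOf_ : Free Composition → Sym → Set (c ⊔ ℓ₁ ⊔ ℓ₂)
  e IsLExpansionOf x = linear L e ≈ˢ x

  [_]q : ℕ → Carrier
  [ m ]q = ∑[ upTo m ] λ i → q ^ i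

  qfact : List ℕ → Carrier
  qfact []      = 1#
  qfact (j ∷ J) = [ length (j ∷ J) ]q ^ j ⊗ qfact J

  QFactA : Composition → Carrier
  QFactA J = qfact (parts J)

  PTA : Composition → Carrier
  PTA I = ∑[ permutationTableaux I ] λ T → q^ (rank T)

{-# OPTIONS --safe #-}
-- Every nonempty composition arises from a shorter one by prepending a part 1
-- or by increasing its first part, and all three quantities follow this
-- recursion.
--
-- Words: prepending a letter to a packed word u with m distinct letters either
-- repeats one of them, which increases the first part of WC u and contributes
-- [m], or inserts a new one, which prepends a part 1 and contributes [m + 1].
-- Hence the coefficient of Ψ_I in S^(1^n)(q) is QFact_A(I), and the theorem
-- says that ∑_{J ⪰ I} q^st(I,J) PT_J = QFact_A(I), together with the inversion
-- of this relation.
--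
-- Tableaux: add the columns from right to left.  A row is free as long as it
-- has no 0 above a 1.  If x marks free rows, then prepending a part 1 is
-- multiplication by x, and increasing the first part (adding a column) is the
-- operator C with C x^u = x ((1 + q x)^u - x^u) / (1 + (q - 1) x).  It suffices
-- to evaluate at x = [k], where 1 + q x = [k + 1] and the denominator is q^k.
-- The products F_m = ∏_{i < m} ([i] + q^i x) satisfy C F_m = [m] F_m and
-- (C + q^m x) F_m = F_{m + 1}, and since C + q^m x is what a part 1 becomes when
-- summed over coarser compositions with weight q^st, the sum above is a multiple
-- of F_ℓ(I), equal to QFact_A(I) at x = 1.
--
-- Inversion: under the same recursion the weights on the right-hand side of the
-- formula peel off one step of the transform at a time.
module Submission where

open import Defs
open import Algebra.Apartness.Bundles using (HeytingField)
open import Algebra.Bundles using (CommutativeRing)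
open import Data.Bool.Base using (Bool; true; false; _∧_; _∨_; not; if_then_else_)
open import Data.Bool.Properties using (T?; ∧-conicalˡ; ∧-conicalʳ)
open import Data.Empty using (⊥-elim; ⊥-elim-irr)
open import Data.Fin.Base as Fin using (Fin; toℕ)
open import Data.Integer.Base as ℤ using (ℤ; -[1+_])
open import Data.Integer.Properties as ℤ using ([1+m]⊖[1+n]≡m⊖n; m-n≡m⊖n)
open import Data.List.Base using (List; []; _∷_; _++_; allFin; applyUpTo; cartesianProduct; cartesianProductWith; concatMap; deduplicate; drop; filter; foldr; length; lookup; map; mapMaybe; tabulate; take; upTo)
open import Data.List.Membership.DecPropositional using () renaming (_∈?_ to mem?)
open import Data.List.Membership.Propositional using (_∈_; _∉_)
open import Data.List.Membership.Propositional.Properties using (∈-map⁺; ∈-map⁻; ∈-filter⁺; ∈-filter⁻; ∈-applyUpTo⁺; ∈-applyUpTo⁻; ∈-deduplicate⁺; ∈-deduplicate⁻; ∈-cartesianProductWith⁺)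
open import Data.List.Membership.Propositional.Properties.WithK using (unique∧set⇒bag)
open import Data.List.Properties using (map-∘; map-id; map-id-local; map-tabulate; map-upTo; length-map; length-++; length-applyUpTo; filter-++; filter-all; filter-none; filter-accept; filter-reject; ∷-injective; ≡-dec)
open import Data.List.Relation.Binary.BagAndSetEquality using (∼bag⇒↭)
open import Data.List.Relation.Binary.Permutation.Propositional.Properties using (↭-length)
open import Data.List.Relation.Binary.Subset.Propositional using (_⊆_)
open import Data.List.Relation.Unary.All as All using (All; []; _∷_)
open import Data.List.Relation.Unary.All.Properties using () renaming (++⁺ to All-++⁺; concat⁺ to All-concat⁺; map⁺ to All-map⁺; replicate⁺ to All-replicate⁺)
open import Data.List.Relation.Unary.AllPairs using ([]; _∷_)
open import Data.List.Relation.Unary.Any using (here; there)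
open import Data.List.Relation.Unary.Linked using (linked?)
open import Data.List.Relation.Unary.Unique.DecPropositional.Properties using (deduplicate-!)
open import Data.List.Relation.Unary.Unique.Propositional using (Unique)
open import Data.List.Relation.Unary.Unique.Propositional.Properties using (applyUpTo⁺₁; cartesianProductWith⁺) renaming (filter⁺ to Unique-filter⁺; map⁺ to Unique-map⁺)
open import Data.Maybe.Base as Maybe using (just)
open import Data.Nat.Base using (ℕ; zero; suc; pred; _+_; _∸_; _≤_; _<_; _>_; z≤n; s≤s; z<s)
open import Data.Nat.ListAction using (sum)
open import Data.Nat.Properties using (_≟_; _≤?_; _<?_; _≥?_; ≤-trans; ≤-refl; ≤-reflexive; ≤-pred; n≤1+n; m≤m+n; <⇒≤; <⇒≢; <⇒≱; ≮⇒≥; <-irrefl; <-asym; <-cmp; suc-injective; +-comm; +-suc; +-∸-assoc)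
open import Data.Nat.Solver using (module +-*-Solver)
open import Data.Product.Base using (Σ; Σ-syntax; ∃; _×_; _,_; proj₁; proj₂)
open import Data.Vec.Base as Vec using (Vec; []; _∷_)
open import Function.Base using (_∘_; id)
open import Function.Bundles using (mk⇔; Equivalence; _⇔_)
open import Level using (_⊔_) renaming (suc to lsuc)
open import Relation.Binary.Definitions using (DecidableEquality; tri<; tri≈; tri>)
open import Relation.Binary.PropositionalEquality as ≡ using (_≡_; _≢_)
open import Relation.Nullary.Decidable using (Dec; yes; no; _×-dec_; ¬?; dec⇒maybe; recompute)
open import Relation.Nullary.Negation using (¬_; contradiction)
open import Relation.Unary using (Pred; Decidable)

import Algebra.Properties.Group as GroupProperties
import Algebra.Properties.Ring as RingProperties
import Algebra.Properties.Semiring.Exp as Exponentiation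
import Algebra.Solver.Ring.NaturalCoefficients.Default as SemiringSolver
import Relation.Binary.Reasoning.Setoid as SetoidReasoning

-- The operator C is a geometric sum. In a new column over u free rows, the free rows below the
-- lowest 1 hold 0 and stay free (x each), the lowest 1 contributes q x, and each free row above it
-- contributes 1 + q x: a 0 there closes the row, a 1 keeps it. Summing x^i (q x) (1 + q x)^(u - 1 -
-- i) over i < u gives q C x^u, and the rank removes the q. At x = [k] the division by q^k becomes a
-- relation between the values at k and k + 1. Statements on tableaux are therefore proved for all
-- k, although only k = 1 enters the theorem; there F_m is the product of [k + i] over i < m, and
-- the shift of k telescopes. The other obstacle is equality in Sym, which asks for an explicit
-- combination of relators. It is traded for agreement under all linear functionals that see a word
-- only through `WC`; left multiplication by the word 1 then becomes a map on functions of
-- compositions. Tableaux supply an expansion, and a left inverse of the transform makes it unique.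

-- Finite sums and indicators in a commutative ring.

module FiniteSums {c ℓ₁} (R : CommutativeRing c ℓ₁) where

  open CommutativeRing R using (Carrier; _≈_; 0#; 1#; refl; sym; trans; +-cong; +-congˡ; +-assoc; +-identityˡ; +-identityʳ; *-congˡ; *-congʳ; *-identityˡ; zeroˡ; zeroʳ; distribˡ; commutativeSemiring) renaming (_+_ to _⊕_; _*_ to _⊗_)
  open SemiringSolver commutativeSemiring using (solve; _:=_; _:+_; _:*_; con)

  ∑[_] : ∀ {a} {A : Set a} → List A → (A → Carrier) → Carrier
  ∑[ xs ] f = foldr (λ x s → f x ⊕ s) 0# xs

  module _ {a} {A : Set a} where

    ∑-cong : ∀ (xs : List A) {f g : A → Carrier} → (∀ x → f x ≈ g x) → ∑[ xs ] f ≈ ∑[ xs ] g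
    ∑-cong []       e = refl
    ∑-cong (x ∷ xs) e = +-cong (e x) (∑-cong xs e)

    ∑-zero : ∀ (xs : List A) {f : A → Carrier} → (∀ x → f x ≈ 0#) → ∑[ xs ] f ≈ 0#
    ∑-zero []       e = refl
    ∑-zero (x ∷ xs) e = trans (+-cong (e x) (∑-zero xs e)) (+-identityˡ 0#)

    ∑-++ : ∀ (xs ys : List A) (f : A → Carrier) → ∑[ xs ++ ys ] f ≈ ∑[ xs ] f ⊕ ∑[ ys ] f
    ∑-++ []       ys f = sym (+-identityˡ _)
    ∑-++ (x ∷ xs) ys f = trans (+-congˡ (∑-++ xs ys f)) (sym (+-assoc _ _ _))

    ∑-⊕ : ∀ (xs : List A) (f g : A → Carrier) → ∑[ xs ] (λ x → f x ⊕ g x) ≈ ∑[ xs ] f ⊕ ∑[ xs ] g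
    ∑-⊕ []       f g = sym (+-identityˡ 0#)
    ∑-⊕ (x ∷ xs) f g = trans (+-congˡ (∑-⊕ xs f g))
      (solve 4 (λ a b c d → (a :+ b) :+ (c :+ d) := (a :+ c) :+ (b :+ d)) refl (f x) (g x) (∑[ xs ] f) (∑[ xs ] g))

    ∑-⊗ˡ : ∀ (xs : List A) k (f : A → Carrier) → ∑[ xs ] (λ x → k ⊗ f x) ≈ k ⊗ ∑[ xs ] f
    ∑-⊗ˡ []       k f = sym (zeroʳ k)
    ∑-⊗ˡ (x ∷ xs) k f = trans (+-congˡ (∑-⊗ˡ xs k f)) (sym (distribˡ k _ _))

    ∑-map : ∀ {b} {B : Set b} (h : B → A) (xs : List B) (f : A → Carrier) → ∑[ map h xs ] f ≈ ∑[ xs ] (f ∘ h)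
    ∑-map h []       f = refl
    ∑-map h (x ∷ xs) f = +-congˡ (∑-map h xs f)

    ∑-concatMap : ∀ {b} {B : Set b} (h : B → List A) (xs : List B) (f : A → Carrier) →
      ∑[ concatMap h xs ] f ≈ ∑[ xs ] (λ x → ∑[ h x ] f)
    ∑-concatMap h []       f = refl
    ∑-concatMap h (x ∷ xs) f = trans (∑-++ (h x) (concatMap h xs) f) (+-congˡ (∑-concatMap h xs f))

    ∑-cartesianProductWith : ∀ {b d} {B : Set b} {D : Set d} (h : B → D → A) (xs : List B) (ys : List D) (f : A → Carrier) →
      ∑[ cartesianProductWith h xs ys ] f ≈ ∑[ xs ] (λ x → ∑[ ys ] (λ y → f (h x y)))
    ∑-cartesianProductWith h []       ys f = refl
    ∑-cartesianProductWith h (x ∷ xs) ys f = trans (∑-++ (map (h x) ys) (cartesianProductWith h xs ys) f)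
      (+-cong (∑-map (h x) ys f) (∑-cartesianProductWith h xs ys f))

  ∑-swap : ∀ {a b} {A : Set a} {B : Set b} (xs : List A) (ys : List B) (f : A → B → Carrier) →
    ∑[ xs ] (λ x → ∑[ ys ] (f x)) ≈ ∑[ ys ] (λ y → ∑[ xs ] (λ x → f x y))
  ∑-swap []       ys f = sym (∑-zero ys (λ _ → refl))
  ∑-swap (x ∷ xs) ys f = trans (+-congˡ (∑-swap xs ys f)) (sym (∑-⊕ ys (f x) _))

  infix 8 ⟦_⟧
  ⟦_⟧ : ∀ {p} {P : Set p} → Dec P → Carrier
  ⟦ yes _ ⟧ = 1#
  ⟦ no  _ ⟧ = 0#

  module _ {p} {P : Set p} where

    ⟦⟧-true : (d : Dec P) → P → ⟦ d ⟧ ≈ 1#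
    ⟦⟧-true (yes _) _ = refl
    ⟦⟧-true (no ¬p) p = ⊥-elim (¬p p)

    ⟦⟧-false : (d : Dec P) → ¬ P → ⟦ d ⟧ ≈ 0#
    ⟦⟧-false (yes p) ¬p = ⊥-elim (¬p p)
    ⟦⟧-false (no _)  _  = refl

    ⟦⟧-⊗-cong : (d : Dec P) {x y : Carrier} → (P → x ≈ y) → ⟦ d ⟧ ⊗ x ≈ ⟦ d ⟧ ⊗ y
    ⟦⟧-⊗-cong (yes p) e = *-congˡ (e p)
    ⟦⟧-⊗-cong (no _)  e = trans (zeroˡ _) (sym (zeroˡ _))

  ⟦⟧-cong : ∀ {p r} {P : Set p} {Q : Set r} (d : Dec P) (e : Dec Q) → (P → Q) → (Q → P) → ⟦ d ⟧ ≈ ⟦ e ⟧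
  ⟦⟧-cong (yes p) e f g = sym (⟦⟧-true e (f p))
  ⟦⟧-cong (no ¬p) e f g = sym (⟦⟧-false e (¬p ∘ g))

  ⟦×-dec⟧ : ∀ {p r} {P : Set p} {Q : Set r} (d : Dec P) (e : Dec Q) → ⟦ d ×-dec e ⟧ ≈ ⟦ d ⟧ ⊗ ⟦ e ⟧
  ⟦×-dec⟧ (yes _) (yes _) = sym (*-identityˡ 1#)
  ⟦×-dec⟧ (yes _) (no _)  = sym (zeroʳ 1#)
  ⟦×-dec⟧ (no _)  e       = sym (zeroˡ ⟦ e ⟧)

  ∑-filter : ∀ {a p} {A : Set a} {P : Pred A p} (P? : Decidable P) (xs : List A) (f : A → Carrier) →
    ∑[ filter P? xs ] f ≈ ∑[ xs ] (λ x → ⟦ P? x ⟧ ⊗ f x)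
  ∑-filter P? []       f = refl
  ∑-filter P? (x ∷ xs) f with P? x
  ... | yes _ = +-cong (sym (*-identityˡ (f x))) (∑-filter P? xs f)
  ... | no  _ = trans (∑-filter P? xs f) (solve 2 (λ a b → b := con 0 :* a :+ b) refl (f x) (∑[ xs ] (λ x → ⟦ P? x ⟧ ⊗ f x)))

  module _ {a} {A : Set a} where

    ∑-cong-∈ : ∀ (xs : List A) {f g : A → Carrier} → (∀ {x} → x ∈ xs → f x ≈ g x) → ∑[ xs ] f ≈ ∑[ xs ] g
    ∑-cong-∈ []       e = refl
    ∑-cong-∈ (x ∷ xs) e = +-cong (e (here ≡.refl)) (∑-cong-∈ xs (e ∘ there))

    module _ (_≟_ : DecidableEquality A) where

      ∑-δ-∉ : ∀ {xs y} (f : A → Carrier) → All (y ≢_) xs → ∑[ xs ] (λ x → ⟦ x ≟ y ⟧ ⊗ f x) ≈ 0#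
      ∑-δ-∉ f []                        = refl
      ∑-δ-∉ {x ∷ xs} {y} f (y≢x ∷ y∉xs) =
        trans (+-cong (trans (*-congʳ (⟦⟧-false (x ≟ y) (y≢x ∘ ≡.sym))) (zeroˡ _)) (∑-δ-∉ f y∉xs)) (+-identityˡ 0#)

      ∑-δ : ∀ {xs y} (f : A → Carrier) → Unique xs → y ∈ xs → ∑[ xs ] (λ x → ⟦ x ≟ y ⟧ ⊗ f x) ≈ f y
      ∑-δ {x ∷ xs} f (x∉xs ∷ _) (here ≡.refl) =
        trans (+-cong (trans (*-congʳ (⟦⟧-true (x ≟ x) ≡.refl)) (*-identityˡ _)) (∑-δ-∉ f x∉xs)) (+-identityʳ _)
      ∑-δ {x ∷ xs} {y} f (x∉xs ∷ u) (there y∈) =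
        trans (+-cong (trans (*-congʳ (⟦⟧-false (x ≟ y) (All.lookup x∉xs y∈))) (zeroˡ _)) (∑-δ f u y∈)) (+-identityˡ _)

-- Compositions one unit at a time: refinement and the statistics `st`, `st′`.

module Compositions where

  open ≡ using (refl; cong; cong₂; sym; trans; subst; module ≡-Reasoning)
  open +-*-Solver using (solve; _:=_; _:+_)

  -- The value of `bump` at the empty composition is a default; in the sums below its coefficient
  -- vanishes.
  one∷_ bump : Composition → Composition
  one∷ comp I pos = comp (1 ∷ I) (z<s ∷ pos)
  bump (comp []      pos) = comp [] []
  bump (comp (i ∷ I) pos) = comp (suc i ∷ I) (z<s ∷ All.tail pos)

  0∷-impossible : ∀ {a} {A : Set a} {I} .(pos : All (0 <_) (0 ∷ I)) → A
  0∷-impossible pos = ⊥-elim-irr (contradiction (All.head pos) λ ())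

  one∷-injective : ∀ I J → one∷ I ≡ one∷ J → I ≡ J
  one∷-injective (comp I _) (comp .I _) refl = refl

  bump-injective : ∀ i I .(p : All (0 <_) (i ∷ I)) j J .(p′ : All (0 <_) (j ∷ J)) →
    bump (comp (i ∷ I) p) ≡ bump (comp (j ∷ J) p′) → comp (i ∷ I) p ≡ comp (j ∷ J) p′
  bump-injective i I p .i .I p′ refl = refl

  -- From a first part 0, `bump` would also make a first part 1, so positivity is what separates the
  -- two constructions.
  one≢bump : ∀ I j J .(pos : All (0 <_) (j ∷ J)) → one∷ I ≢ bump (comp (j ∷ J) pos)
  one≢bump I zero    J pos e = 0∷-impossible pos
  one≢bump I (suc j) J pos ()

  compositions-size : ∀ n → All (λ J → size J ≡ n) (compositions n)
  compositions-size zero    = refl ∷ []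
  compositions-size (suc n) = All-concat⁺ (All-map⁺ (All.map step (compositions-size n)))
    where
    step : ∀ {J} → size J ≡ n → All (λ J⁺ → size J⁺ ≡ suc n) (extend J)
    step {comp [] _}      e = cong suc e ∷ []
    step {comp (j ∷ J) _} e = cong suc e ∷ cong suc e ∷ []

  -- Recursion on the list of parts would drop a whole first part; this view drops one unit,
  -- matching `extend`.
  data Built : Composition → Set where
    empty   : Built (comp [] [])
    prepend : ∀ {I} → Built I → Built (one∷ I)
    grow    : ∀ {i I} .{pos : All (0 <_) (i ∷ I)} → Built (comp (i ∷ I) pos) → Built (bump (comp (i ∷ I) pos))

  built : ∀ I → Built I
  built (comp I pos) = go I pos
    where
    go   : ∀ I .(pos : All (0 <_) I) → Built (comp I pos)
    go⁺  : ∀ i I .(pos : All (0 <_) I) → Built (comp (suc i ∷ I) (z<s ∷ pos))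
    go []          pos = empty
    go (zero ∷ I)  pos = 0∷-impossible pos
    go (suc i ∷ I) pos = go⁺ i I (All.tail pos)
    go⁺ zero    I pos = prepend (go I pos)
    go⁺ (suc i) I pos = grow (go⁺ i I pos)

  positive : ∀ I → All (0 <_) (parts I)
  positive (comp I pos) = recompute (All.all? (0 <?_) I) pos

  size-positive : ∀ i I .(pos : All (0 <_) (i ∷ I)) → 0 < size (comp (i ∷ I) pos)
  size-positive i I pos = ≤-trans (All.head (positive (comp (i ∷ I) pos))) (m≤m+n i (sum I))

  descents-suc : ∀ i I → descents (suc i ∷ I) ≡ map suc (descents (i ∷ I))
  descents-suc i []      = refl
  descents-suc i (j ∷ I) = cong (suc i ∷_) (map-∘ (descents (j ∷ I)))

  length-descents : ∀ i I → length (descents (i ∷ I)) ≡ length I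
  length-descents i []      = refl
  length-descents i (j ∷ I) = cong suc (trans (length-map (i +_) (descents (j ∷ I))) (length-descents j I))

  descents-positive : ∀ {I} → All (0 <_) I → All (0 <_) (descents I)
  descents-positive []              = []
  descents-positive (_ ∷ [])        = []
  descents-positive {i ∷ _} (p ∷ p′ ∷ pos) = p ∷ All-map⁺ (All.universal (λ x → ≤-trans p (m≤m+n i x)) _)

  suc-⊆ : ∀ {xs ys} → xs ⊆ ys → map suc xs ⊆ map suc ys
  suc-⊆ xs⊆ys x∈ with ∈-map⁻ suc x∈
  ... | _ , x∈xs , refl = ∈-map⁺ suc (xs⊆ys x∈xs)

  ∈-suc⁻ : ∀ {x xs} → suc x ∈ map suc xs → x ∈ xs
  ∈-suc⁻ x∈ with ∈-map⁻ suc x∈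
  ... | _ , x∈xs , refl = x∈xs

  1∉suc : ∀ {xs} → All (0 <_) xs → 1 ∉ map suc xs
  1∉suc pos 1∈ with ∈-map⁻ suc 1∈
  ... | _ , 0∈xs , refl = contradiction (All.lookup pos 0∈xs) λ ()

  ⊆-suc⁻ : ∀ {xs ys} → map suc xs ⊆ map suc ys → xs ⊆ ys
  ⊆-suc⁻ h x∈ = ∈-suc⁻ (h (∈-map⁺ suc x∈))

  ⊆-1∷suc⁻ : ∀ {xs ys} → All (0 <_) xs → map suc xs ⊆ 1 ∷ map suc ys → xs ⊆ ys
  ⊆-1∷suc⁻ pos h x∈ with h (∈-map⁺ suc x∈)
  ... | here refl = contradiction (All.lookup pos x∈) λ ()
  ... | there sx∈ = ∈-suc⁻ sx∈

  -- Both constructions shift all descents by one, and only `one∷_` adds the descent 1. Since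
  -- shifted descents exceed 1, the new descent can be missing on the coarser side but never on the
  -- finer side alone.
  module Refinement i I .(pos : All (0 <_) (i ∷ I)) j J .(pos′ : All (0 <_) (j ∷ J)) where
    private
      I₀ = comp (i ∷ I) pos
      J₀ = comp (j ∷ J) pos′

      Des-J-positive : All (0 <_) (Des J₀)
      Des-J-positive = descents-positive (positive J₀)

    one⪯one⁺ : I₀ ⪯ J₀ → one∷ I₀ ⪯ one∷ J₀
    one⪯one⁺ (e , h) = cong suc e , λ { (here refl) → here refl ; (there x∈) → there (suc-⊆ h x∈) }

    one⪯one⁻ : one∷ I₀ ⪯ one∷ J₀ → I₀ ⪯ J₀
    one⪯one⁻ (e , h) = suc-injective e , ⊆-1∷suc⁻ Des-J-positive (h ∘ there)

    one⪯bump⁺ : I₀ ⪯ J₀ → one∷ I₀ ⪯ bump J₀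
    one⪯bump⁺ (e , h) = cong suc e , λ x∈ → there (suc-⊆ h (subst (_ ∈_) (descents-suc j J) x∈))

    one⪯bump⁻ : one∷ I₀ ⪯ bump J₀ → I₀ ⪯ J₀
    one⪯bump⁻ (e , h) = suc-injective e , ⊆-1∷suc⁻ Des-J-positive (h ∘ subst (_ ∈_) (sym (descents-suc j J)))

    bump⪯bump⁺ : I₀ ⪯ J₀ → bump I₀ ⪯ bump J₀
    bump⪯bump⁺ (e , h) = cong suc e , λ x∈ → subst (_ ∈_) (sym (descents-suc i I)) (suc-⊆ h (subst (_ ∈_) (descents-suc j J) x∈))

    bump⪯bump⁻ : bump I₀ ⪯ bump J₀ → I₀ ⪯ J₀
    bump⪯bump⁻ (e , h) = suc-injective e , ⊆-suc⁻ (λ x∈ → subst (_ ∈_) (descents-suc i I) (h (subst (_ ∈_) (sym (descents-suc j J)) x∈)))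

    bump⋠one : ¬ (bump I₀ ⪯ one∷ J₀)
    bump⋠one (_ , h) = 1∉suc (descents-positive (positive I₀)) (subst (1 ∈_) (descents-suc i I) (h (here refl)))

  -- Once J is nonempty, a part prepended to it forces a part prepended to I, by `bump⋠one`. The
  -- bound ensures that the truncated subtraction in `weight` is a true difference.
  ⪯⇒ℓ≥ : ∀ {I J} → I ⪯ J → ℓ J ≤ ℓ I
  ⪯⇒ℓ≥ {I} {J} = go (built I) (built J)
    where
    go : ∀ {I J} → Built I → Built J → I ⪯ J → ℓ J ≤ ℓ I
    go empty       empty       h = z≤n
    go empty       (prepend _) (() , _)
    go empty       (grow _)    (() , _)
    go (prepend _) empty       (() , _)
    go (grow _)    empty       (() , _)
    go (prepend {I} _) (prepend {comp [] _} _) h = s≤s z≤n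
    go (grow _)        (prepend {comp [] _} _) h = s≤s z≤n
    go (prepend {comp [] _} _) (prepend {comp (j ∷ J) pos} _) (e , _) = contradiction (suc-injective e) (<⇒≢ (size-positive j J pos))
    go (prepend {comp [] _} _) (grow {j} {J} {pos} _)         (e , _) = contradiction (suc-injective e) (<⇒≢ (size-positive j J pos))
    go (prepend {comp (i ∷ I) p} b) (prepend {comp (j ∷ J) p′} b′) h = s≤s (go b b′ (Refinement.one⪯one⁻ i I p j J p′ h))
    go (prepend {comp (i ∷ I) p} b) (grow {j} {J} {p′} b′)         h = ≤-trans (go b b′ (Refinement.one⪯bump⁻ i I p j J p′ h)) (n≤1+n _)
    go (grow {i} {I} {p} b)         (prepend {comp (j ∷ J) p′} b′) h = contradiction h (Refinement.bump⋠one i I p j J p′)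
    go (grow {i} {I} {p} b)         (grow {j} {J} {p′} b′)         h = go b b′ (Refinement.bump⪯bump⁻ i I p j J p′ h)

  count-map : ∀ {a b p r} {A : Set a} {B : Set b} {P : Pred B p} {Q : Pred A r} (P? : Decidable P) (Q? : Decidable Q) (f : A → B) →
    (∀ {x} → Q x → P (f x)) → (∀ {x} → P (f x) → Q x) → ∀ xs → length (filter P? (map f xs)) ≡ length (filter Q? xs)
  count-map P? Q? f to from []       = refl
  count-map P? Q? f to from (x ∷ xs) with P? (f x) | Q? x
  ... | yes _ | yes _ = cong suc (count-map P? Q? f to from xs)
  ... | yes p | no ¬q = contradiction (from p) ¬q
  ... | no ¬p | yes q = contradiction (to q) ¬p
  ... | no _  | no _  = count-map P? Q? f to from xs

  module _ {a b r} {A : Set a} {B : Set b} {_~_ : A → B → Set r} (_~?_ : ∀ x y → Dec (x ~ y)) where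

    row : A → List B → ℕ
    row x ys = length (filter (x ~?_) ys)

    -- `st`, `st′` and the count inside `sinv` all unfold to this form.
    pairs : List A → List B → ℕ
    pairs xs ys = length (filter (λ (x , y) → x ~? y) (cartesianProduct xs ys))

    row-all : ∀ x {ys} → All (x ~_) ys → row x ys ≡ length ys
    row-all x all = cong length (filter-all (x ~?_) all)

    row-none : ∀ x {ys} → All (λ y → ¬ (x ~ y)) ys → row x ys ≡ 0
    row-none x none = cong length (filter-none (x ~?_) none)

    pairs-∷ : ∀ x xs ys → pairs (x ∷ xs) ys ≡ row x ys + pairs xs ys
    pairs-∷ x xs ys = begin
      length (filter R? (map (x ,_) ys ++ rest))                       ≡⟨ cong length (filter-++ R? (map (x ,_) ys) rest) ⟩
      length (filter R? (map (x ,_) ys) ++ filter R? rest)             ≡⟨ length-++ (filter R? (map (x ,_) ys)) ⟩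
      length (filter R? (map (x ,_) ys)) + length (filter R? rest)     ≡⟨ cong (_+ length (filter R? rest)) (count-map R? (x ~?_) (x ,_) id id ys) ⟩
      row x ys + pairs xs ys                                           ∎
      where
      open ≡-Reasoning
      rest = cartesianProduct xs ys

      R? : ∀ ((x , y) : A × B) → Dec (x ~ y)
      R? (x , y) = x ~? y

  pairs-map : ∀ {a b r s} {A A′ : Set a} {B B′ : Set b} {_~_ : A → B → Set r} {_≁_ : A′ → B′ → Set s}
    (_~?_ : ∀ x y → Dec (x ~ y)) (_≁?_ : ∀ x y → Dec (x ≁ y)) (f : A → A′) (g : B → B′) →
    (∀ {x y} → x ~ y → f x ≁ g y) → (∀ {x y} → f x ≁ g y → x ~ y) →
    ∀ xs ys → pairs _≁?_ (map f xs) (map g ys) ≡ pairs _~?_ xs ys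
  pairs-map _~?_ _≁?_ f g to from []       ys = refl
  pairs-map _~?_ _≁?_ f g to from (x ∷ xs) ys = trans (pairs-∷ _≁?_ (f x) (map f xs) (map g ys))
    (trans (cong₂ _+_ (count-map (f x ≁?_) (x ~?_) g to from ys) (pairs-map _~?_ _≁?_ f g to from xs ys)) (sym (pairs-∷ _~?_ x xs ys)))

  -- The entry 1 lies weakly below every shifted entry, which gives one extra pair for each of them.
  pairs≥-1∷ : ∀ xs ys → pairs _≥?_ (map suc xs) (1 ∷ map suc ys) ≡ length xs + pairs _≥?_ xs ys
  pairs≥-1∷ []       ys = refl
  pairs≥-1∷ (x ∷ xs) ys = begin
    pairs _≥?_ (suc x ∷ map suc xs) (1 ∷ map suc ys)                                     ≡⟨ pairs-∷ _≥?_ (suc x) (map suc xs) (1 ∷ map suc ys) ⟩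
    suc (row _≥?_ (suc x) (map suc ys)) + pairs _≥?_ (map suc xs) (1 ∷ map suc ys)       ≡⟨ cong₂ (λ a b → suc a + b) (count-map (suc x ≥?_) (x ≥?_) suc s≤s ≤-pred ys) (pairs≥-1∷ xs ys) ⟩
    suc (row _≥?_ x ys) + (length xs + pairs _≥?_ xs ys)                                 ≡⟨ cong suc (solve 3 (λ a b c → a :+ (b :+ c) := b :+ (a :+ c)) refl (row _≥?_ x ys) (length xs) (pairs _≥?_ xs ys)) ⟩
    suc (length xs) + (row _≥?_ x ys + pairs _≥?_ xs ys)                                 ≡⟨ cong (suc (length xs) +_) (pairs-∷ _≥?_ x xs ys) ⟨
    suc (length xs) + pairs _≥?_ (x ∷ xs) ys                                             ∎
    where open ≡-Reasoning

  -- Shifted positive entries are at least 2, so none of them is paired with 1.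
  pairs≤-1∷ : ∀ {xs} ys → All (0 <_) xs → pairs _≤?_ (map suc xs) (1 ∷ map suc ys) ≡ pairs _≤?_ xs ys
  pairs≤-1∷ ys [] = refl
  pairs≤-1∷ {suc x ∷ xs} ys (_ ∷ pos) = begin
    pairs _≤?_ (suc (suc x) ∷ map suc xs) (1 ∷ map suc ys)                               ≡⟨ pairs-∷ _≤?_ (suc (suc x)) (map suc xs) (1 ∷ map suc ys) ⟩
    row _≤?_ (suc (suc x)) (map suc ys) + pairs _≤?_ (map suc xs) (1 ∷ map suc ys)       ≡⟨ cong₂ _+_ (count-map (suc (suc x) ≤?_) (suc x ≤?_) suc s≤s ≤-pred ys) (pairs≤-1∷ ys pos) ⟩
    row _≤?_ (suc x) ys + pairs _≤?_ xs ys                                               ≡⟨ pairs-∷ _≤?_ (suc x) xs ys ⟨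
    pairs _≤?_ (suc x ∷ xs) ys                                                           ∎
    where open ≡-Reasoning

  module Statistics i I .(pos : All (0 <_) (i ∷ I)) j J .(pos′ : All (0 <_) (j ∷ J)) where
    private
      I₀ = comp (i ∷ I) pos
      J₀ = comp (j ∷ J) pos′
      D  = Des I₀
      E  = Des J₀

      1≱suc : All (λ y → ¬ (y ≤ 1)) (map suc E)
      1≱suc = All-map⁺ (All.map (λ { 0<y (s≤s y≤0) → <⇒≱ 0<y y≤0 }) (descents-positive (positive J₀)))

      1≤suc : All (1 ≤_) (map suc E)
      1≤suc = All-map⁺ (All.universal (λ _ → s≤s z≤n) E)

    -- The new pairs are (1, 1) and one (a, 1) for each of the `ℓ I₀` - 1 shifted descents a.
    st-one-one : st (one∷ I₀) (one∷ J₀) ≡ ℓ I₀ + st I₀ J₀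
    st-one-one = begin
      pairs _≥?_ (1 ∷ map suc D) (1 ∷ map suc E)                             ≡⟨ pairs-∷ _≥?_ 1 (map suc D) (1 ∷ map suc E) ⟩
      suc (row _≥?_ 1 (map suc E)) + pairs _≥?_ (map suc D) (1 ∷ map suc E)  ≡⟨ cong₂ (λ a b → suc a + b) (row-none _≥?_ 1 1≱suc) (pairs≥-1∷ D E) ⟩
      suc (length D + st I₀ J₀)                                              ≡⟨ cong (λ a → suc (a + st I₀ J₀)) (length-descents i I) ⟩
      ℓ I₀ + st I₀ J₀                                                        ∎
      where open ≡-Reasoning

    st-one-bump : st (one∷ I₀) (bump J₀) ≡ st I₀ J₀
    st-one-bump = begin
      pairs _≥?_ (1 ∷ map suc D) (descents (suc j ∷ J))                      ≡⟨ cong (pairs _≥?_ (1 ∷ map suc D)) (descents-suc j J) ⟩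
      pairs _≥?_ (1 ∷ map suc D) (map suc E)                                 ≡⟨ pairs-∷ _≥?_ 1 (map suc D) (map suc E) ⟩
      row _≥?_ 1 (map suc E) + pairs _≥?_ (map suc D) (map suc E)            ≡⟨ cong₂ _+_ (row-none _≥?_ 1 1≱suc) (pairs-map _≥?_ _≥?_ suc suc s≤s ≤-pred D E) ⟩
      st I₀ J₀                                                               ∎
      where open ≡-Reasoning

    st-bump-bump : st (bump I₀) (bump J₀) ≡ st I₀ J₀
    st-bump-bump = trans (cong₂ (pairs _≥?_) (descents-suc i I) (descents-suc j J)) (pairs-map _≥?_ _≥?_ suc suc s≤s ≤-pred D E)

    st′-one-one : st′ (one∷ I₀) (one∷ J₀) ≡ ℓ J₀ + st′ I₀ J₀
    st′-one-one = begin
      pairs _≤?_ (1 ∷ map suc D) (1 ∷ map suc E)                             ≡⟨ pairs-∷ _≤?_ 1 (map suc D) (1 ∷ map suc E) ⟩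
      suc (row _≤?_ 1 (map suc E)) + pairs _≤?_ (map suc D) (1 ∷ map suc E)  ≡⟨ cong₂ (λ a b → suc a + b) (row-all _≤?_ 1 1≤suc) (pairs≤-1∷ E (descents-positive (positive I₀))) ⟩
      suc (length (map suc E) + st′ I₀ J₀)                                   ≡⟨ cong (λ a → suc (a + st′ I₀ J₀)) (trans (length-map suc E) (length-descents j J)) ⟩
      ℓ J₀ + st′ I₀ J₀                                                       ∎
      where open ≡-Reasoning

    -- Compared with `st′-one-one` just the pair (1, 1) is lost; the `suc` on the left avoids a
    -- subtraction.
    st′-one-bump : suc (st′ (one∷ I₀) (bump J₀)) ≡ ℓ J₀ + st′ I₀ J₀
    st′-one-bump = cong suc (begin
      pairs _≤?_ (1 ∷ map suc D) (descents (suc j ∷ J))                      ≡⟨ cong (pairs _≤?_ (1 ∷ map suc D)) (descents-suc j J) ⟩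
      pairs _≤?_ (1 ∷ map suc D) (map suc E)                                 ≡⟨ pairs-∷ _≤?_ 1 (map suc D) (map suc E) ⟩
      row _≤?_ 1 (map suc E) + pairs _≤?_ (map suc D) (map suc E)            ≡⟨ cong₂ _+_ (row-all _≤?_ 1 1≤suc) (pairs-map _≤?_ _≤?_ suc suc s≤s ≤-pred D E) ⟩
      length (map suc E) + st′ I₀ J₀                                         ≡⟨ cong (_+ st′ I₀ J₀) (trans (length-map suc E) (length-descents j J)) ⟩
      length J + st′ I₀ J₀                                                   ∎)
      where open ≡-Reasoning

    st′-bump-bump : st′ (bump I₀) (bump J₀) ≡ st′ I₀ J₀
    st′-bump-bump = trans (cong₂ (pairs _≤?_) (descents-suc i I) (descents-suc j J)) (pairs-map _≤?_ _≤?_ suc suc s≤s ≤-pred D E)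

open Compositions

-- Permutation tableaux as a Boolean recursion over columns.

module Tableaux where

  open ≡ using (refl; cong; cong₂; sym; trans)

  -- In a column listed from bottom to top, blocked s v r says that row r holds a
  -- 0 above a 1, where s tells whether there is a 1 below the column itself.
  blocked : ∀ {h} → Bool → Vec Bool h → ℕ → Bool
  blocked s []      r       = false
  blocked s (b ∷ v) zero    = s ∧ not b
  blocked s (b ∷ v) (suc r) = blocked (s ∨ b) v r

  -- A row is free when no box of it is a 0 above a 1: only such rows may carry a
  -- 1 in a column further left.
  free : ∀ {hs} → Filling hs → ℕ → Bool
  free []      r = true
  free (v ∷ T) r = free T r ∧ not (blocked false v r)

  hasOne : ∀ {h} → Vec Bool h → Bool
  hasOne []      = false
  hasOne (b ∷ v) = b ∨ hasOne v

  fits : ∀ {h} → Vec Bool h → (ℕ → Bool) → Bool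
  fits []      f = true
  fits (b ∷ v) f = (not b ∨ f 0) ∧ fits v (f ∘ suc)

  -- The leftmost column has nothing to its left, so its own 0s are harmless; it can break the rule
  -- only by a 1 in a row that a column further right has blocked. Validity is thus decided column
  -- by column, and its indicator factors accordingly.
  valid : ∀ {hs} → Filling hs → Bool
  valid []      = true
  valid (v ∷ T) = valid T ∧ (hasOne v ∧ fits v (free T))

  countBelow : ℕ → (ℕ → Bool) → ℕ
  countBelow zero    f = 0
  countBelow (suc h) f = (if f 0 then 1 else 0) + countBelow h (f ∘ suc)

  -- `countBelow` peels rows off at the bottom, whereas prepending a part 1 adds a row on top.
  countBelow-top : ∀ h f → f h ≡ true → countBelow (suc h) f ≡ suc (countBelow h f)
  countBelow-top zero    f e rewrite e = refl
  countBelow-top (suc h) f e with f 0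
  ... | true  = cong suc (countBelow-top h (f ∘ suc) e)
  ... | false = countBelow-top h (f ∘ suc) e

  ¬blocked-above : ∀ {h} s (v : Vec Bool h) {r} → h ≤ r → blocked s v r ≡ false
  ¬blocked-above s []      _         = refl
  ¬blocked-above s (b ∷ v) (s≤s h≤r) = ¬blocked-above (s ∨ b) v h≤r

  free-above : ∀ {hs} (T : Filling hs) {r} → All (_≤ r) hs → free T r ≡ true
  free-above []      []           = refl
  free-above (v ∷ T) (h≤r ∷ hs≤r) rewrite free-above T hs≤r | ¬blocked-above false v h≤r = refl

  entry⇒< : ∀ {h} (v : Vec Bool h) {r b} → entry v r ≡ just b → r < h
  entry⇒< (b ∷ v) {zero}  e = z<s
  entry⇒< (b ∷ v) {suc r} e = s≤s (entry⇒< v e)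

  box⇒< : ∀ {hs} (T : Filling hs) {c r b} → box T c r ≡ just b → c < length hs
  box⇒< (v ∷ T) {zero}  e = z<s
  box⇒< (v ∷ T) {suc c} e = s≤s (box⇒< T e)

  hasOne⁻ : ∀ {h} (v : Vec Bool h) → hasOne v ≡ true → ∃ λ r → entry v r ≡ just true
  hasOne⁻ (true  ∷ v) e = 0 , refl
  hasOne⁻ (false ∷ v) e = let (r , e′) = hasOne⁻ v e in suc r , e′

  hasOne⁺ : ∀ {h} (v : Vec Bool h) {r} → entry v r ≡ just true → hasOne v ≡ true
  hasOne⁺ (true  ∷ v) e = refl
  hasOne⁺ (false ∷ v) {suc r} e = hasOne⁺ v {r} e

  fits⁻ : ∀ {h} (v : Vec Bool h) f → fits v f ≡ true → ∀ {r} → entry v r ≡ just true → f r ≡ true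
  fits⁻ (true  ∷ v) f e {zero}  e′ = ∧-conicalˡ (f 0) _ e
  fits⁻ (b     ∷ v) f e {suc r} e′ = fits⁻ v (f ∘ suc) (∧-conicalʳ (not b ∨ f 0) _ e) e′

  fits⁺ : ∀ {h} (v : Vec Bool h) f → (∀ {r} → entry v r ≡ just true → f r ≡ true) → fits v f ≡ true
  fits⁺ []          f h = refl
  fits⁺ (true  ∷ v) f h = cong₂ _∧_ (h {0} refl) (fits⁺ v (f ∘ suc) (λ {r} → h {suc r}))
  fits⁺ (false ∷ v) f h = fits⁺ v (f ∘ suc) (λ {r} → h {suc r})

  ZeroAboveOne : ∀ {h} → Vec Bool h → ℕ → Set
  ZeroAboveOne v r = entry v r ≡ just false × ∃ λ r′ → r′ < r × entry v r′ ≡ just true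

  blocked⁺-seen : ∀ {h} (v : Vec Bool h) {r} → entry v r ≡ just false → blocked true v r ≡ true
  blocked⁺-seen (false ∷ v) {zero}  e = refl
  blocked⁺-seen (b     ∷ v) {suc r} e = blocked⁺-seen v e

  blocked⁺ : ∀ {h} (v : Vec Bool h) {r} → ZeroAboveOne v r → blocked false v r ≡ true
  blocked⁺ (true  ∷ v) {suc r} (e , _)                   = blocked⁺-seen v e
  blocked⁺ (false ∷ v) {suc r} (e , suc r′ , s≤s lt , e′) = blocked⁺ v (e , r′ , lt , e′)

  blocked⁻-entry : ∀ {h} s (v : Vec Bool h) {r} → blocked s v r ≡ true → entry v r ≡ just false
  blocked⁻-entry true (false ∷ v) {zero}  e = refl
  blocked⁻-entry s    (b     ∷ v) {suc r} e = blocked⁻-entry (s ∨ b) v e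

  blocked⁻ : ∀ {h} (v : Vec Bool h) {r} → blocked false v r ≡ true → ZeroAboveOne v r
  blocked⁻ (true  ∷ v) {suc r} e = blocked⁻-entry true v e , 0 , z<s , refl
  blocked⁻ (false ∷ v) {suc r} e = let (e′ , r′ , lt , e″) = blocked⁻ v e in e′ , suc r′ , s≤s lt , e″

  BlockedRow : ∀ {hs} → Filling hs → ℕ → Set
  BlockedRow T r = ∃ λ c → box T c r ≡ just false × ∃ λ r′ → r′ < r × box T c r′ ≡ just true

  free⁻ : ∀ {hs} (T : Filling hs) {r} → free T r ≡ true → ¬ BlockedRow T r
  free⁻ (v ∷ T) {r} e (zero , z) with trans (cong not (sym (blocked⁺ v z))) (∧-conicalʳ (free T r) _ e)
  ... | ()
  free⁻ (v ∷ T) {r} e (suc c , z) = free⁻ T (∧-conicalˡ (free T r) _ e) (c , z)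

  free⁺ : ∀ {hs} (T : Filling hs) {r} → ¬ BlockedRow T r → free T r ≡ true
  free⁺ []          ¬b = refl
  free⁺ (v ∷ T) {r} ¬b rewrite free⁺ T {r} (λ (c , z) → ¬b (suc c , z)) with blocked false v r in e
  ... | true  = contradiction (0 , blocked⁻ v e) ¬b
  ... | false = refl

  -- IsPermutationTableau I T unfolds to IsTableau (ℓ I) T.
  IsTableau : ∀ {hs} → ℕ → Filling hs → Set
  IsTableau {hs} k T =
    (∀ {c} → c < length hs → ∃ λ r → r < k × box T c r ≡ just true) ×
    (∀ {c} → c < length hs → ∀ {r} → r < k → box T c r ≡ just false →
      ¬ ((∃ λ r′ → r′ < r × box T c r′ ≡ just true) × (∃ λ c′ → c′ < c × box T c′ r ≡ just true)))

  -- The number of rows is an arbitrary bound k on the column lengths, so that it stays fixed while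
  -- columns are removed.
  valid⁺ : ∀ {hs k} (T : Filling hs) → All (_≤ k) hs → IsTableau k T → valid T ≡ true
  valid⁺         []      []           _             = refl
  valid⁺ {h ∷ hs} {k} (v ∷ T) (h≤k ∷ hs≤k) (col , nofz) = cong₂ _∧_ (valid⁺ T hs≤k (col′ , nofz′)) (cong₂ _∧_ hasOne-v fits-v)
    where
    col′ : ∀ {c} → c < length hs → ∃ λ r → r < k × box T c r ≡ just true
    col′ c< = col (s≤s c<)

    nofz′ : ∀ {c} → c < length hs → ∀ {r} → r < k → box T c r ≡ just false →
      ¬ ((∃ λ r′ → r′ < r × box T c r′ ≡ just true) × (∃ λ c′ → c′ < c × box T c′ r ≡ just true))
    nofz′ c< r< e (below , c′ , c′< , e′) = nofz (s≤s c<) r< e (below , suc c′ , s≤s c′< , e′)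

    hasOne-v : hasOne v ≡ true
    hasOne-v = let (r , _ , e) = col z<s in hasOne⁺ v {r} e

    fits-v : fits v (free T) ≡ true
    fits-v = fits⁺ v (free T) λ {r} e → free⁺ T λ (c , e₀ , below) →
      nofz (s≤s (box⇒< T e₀)) (≤-trans (entry⇒< v e) h≤k) e₀ (below , 0 , z<s , e)

  valid⁻ : ∀ {hs k} (T : Filling hs) → All (_≤ k) hs → valid T ≡ true → IsTableau k T
  valid⁻ []      []           _  = (λ ()) , (λ ())
  valid⁻ {h ∷ hs} {k} (v ∷ T) (h≤k ∷ hs≤k) ok = col , nofz
    where
    T-ok = valid⁻ T hs≤k (∧-conicalˡ (valid T) _ ok)
    v-ok = ∧-conicalʳ (valid T) _ ok

    col : ∀ {c} → c < suc (length hs) → ∃ λ r → r < k × box (v ∷ T) c r ≡ just true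
    col {zero}  _        = let (r , e) = hasOne⁻ v (∧-conicalˡ (hasOne v) _ v-ok) in r , ≤-trans (entry⇒< v e) h≤k , e
    col {suc c} (s≤s c<) = proj₁ T-ok c<

    nofz : ∀ {c} → c < suc (length hs) → ∀ {r} → r < k → box (v ∷ T) c r ≡ just false →
      ¬ ((∃ λ r′ → r′ < r × box (v ∷ T) c r′ ≡ just true) × (∃ λ c′ → c′ < c × box (v ∷ T) c′ r ≡ just true))
    -- Nothing lies to the left of column 0. Elsewhere the 1 on the left is either in the new
    -- column, which `fits` excludes, or already inside `T`.
    nofz {suc c} (s≤s c<) r< e (below , zero , _ , e′) =
      free⁻ T (fits⁻ v (free T) (∧-conicalʳ (hasOne v) _ v-ok) e′) (c , e , below)
    nofz {suc c} (s≤s c<) r< e (below , suc c′ , s≤s c′< , e′) = proj₂ T-ok c< r< e (below , c′ , c′< , e′)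

  columns-≤ : ∀ I → All (_≤ length I) (columns I)
  columns-≤ []      = []
  columns-≤ (i ∷ I) = All-++⁺ (All-replicate⁺ (pred i) ≤-refl) (All.map (λ h≤ → ≤-trans h≤ (n≤1+n _)) (columns-≤ I))

open Tableaux

-- Packed words, last occurrences, and the effect of a new first letter.

module Words where

  open ≡ using (refl; cong; cong₂; sym; trans; subst; module ≡-Reasoning)
  open import Data.Fin.Base using (zero; suc)

  -- Duplicate-free lists with the same elements are permutations of each other, so cardinalities
  -- can be compared through membership alone.
  unique-length : ∀ {a} {A : Set a} {xs ys : List A} → Unique xs → Unique ys → (∀ {x} → x ∈ xs → x ∈ ys) → (∀ {x} → x ∈ ys → x ∈ xs) → length xs ≡ length ys
  unique-length u v to from = ↭-length (∼bag⇒↭ (unique∧set⇒bag u v (mk⇔ to from)))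

  interval-unique : ∀ n → Unique (applyUpTo suc n)
  interval-unique n = applyUpTo⁺₁ suc n λ i<j _ e → <⇒≢ i<j (suc-injective e)

  ∈-interval⁺ : ∀ {x n} → 1 ≤ x → x ≤ n → x ∈ applyUpTo suc n
  ∈-interval⁺ (s≤s _) x≤n = ∈-applyUpTo⁺ suc x≤n

  ∈-interval⁻ : ∀ {x n} → x ∈ applyUpTo suc n → 1 ≤ x × x ≤ n
  ∈-interval⁻ x∈ with ∈-applyUpTo⁻ suc x∈
  ... | _ , i<n , refl = s≤s z≤n , i<n

  -- The letters of a word in the order of their last occurrences; these are the
  -- positions counted by sinv and the places where WC cuts.
  lasts : List ℕ → List ℕ
  lasts []      = []
  lasts (x ∷ w) with mem? _≟_ x w
  ... | yes _ = lasts w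
  ... | no  _ = x ∷ lasts w

  lasts-∈ : ∀ {x w} → x ∈ w → lasts (x ∷ w) ≡ lasts w
  lasts-∈ {x} {w} x∈ with mem? _≟_ x w
  ... | yes _ = refl
  ... | no x∉ = contradiction x∈ x∉

  lasts-∉ : ∀ {x w} → x ∉ w → lasts (x ∷ w) ≡ x ∷ lasts w
  lasts-∉ {x} {w} x∉ with mem? _≟_ x w
  ... | yes x∈ = contradiction x∈ x∉
  ... | no _   = refl

  ∈-lasts⁻ : ∀ w {x} → x ∈ lasts w → x ∈ w
  ∈-lasts⁻ (y ∷ w) x∈ with mem? _≟_ y w
  ∈-lasts⁻ (y ∷ w) x∈         | yes _ = there (∈-lasts⁻ w x∈)
  ∈-lasts⁻ (y ∷ w) (here e)   | no _  = here e
  ∈-lasts⁻ (y ∷ w) (there x∈) | no _  = there (∈-lasts⁻ w x∈)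

  ∈-lasts⁺ : ∀ w {x} → x ∈ w → x ∈ lasts w
  ∈-lasts⁺ (y ∷ w) x∈ with mem? _≟_ y w
  ∈-lasts⁺ (y ∷ w) (here refl) | yes y∈ = ∈-lasts⁺ w y∈
  ∈-lasts⁺ (y ∷ w) (there x∈)  | yes _  = ∈-lasts⁺ w x∈
  ∈-lasts⁺ (y ∷ w) (here e)    | no _   = here e
  ∈-lasts⁺ (y ∷ w) (there x∈)  | no _   = there (∈-lasts⁺ w x∈)

  lasts-unique : ∀ w → Unique (lasts w)
  lasts-unique []      = []
  lasts-unique (y ∷ w) with mem? _≟_ y w
  ... | yes _ = lasts-unique w
  ... | no y∉ = All.tabulate (λ {x} x∈ y≡x → y∉ (subst (_∈ w) (sym y≡x) (∈-lasts⁻ w x∈))) ∷ lasts-unique w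

  length-lasts-≤ : ∀ w → length (lasts w) ≤ length w
  length-lasts-≤ []      = z≤n
  length-lasts-≤ (y ∷ w) with mem? _≟_ y w
  ... | yes _ = ≤-trans (length-lasts-≤ w) (n≤1+n _)
  ... | no _  = s≤s (length-lasts-≤ w)

  length-cut : ∀ a w → length (cut a w) ≡ length (lasts w)
  length-cut a []      = refl
  length-cut a (y ∷ w) with mem? _≟_ y w
  ... | yes _ = length-cut (suc a) w
  ... | no _  = cong suc (length-cut 0 w)

  lasts-packed : ∀ w {m} → (∀ x → x ∈ w ⇔ (1 ≤ x × x ≤ m)) → length (lasts w) ≡ m
  lasts-packed w {m} h = trans (unique-length (lasts-unique w) (interval-unique m)
      (λ {x} x∈ → let (p , q) = Equivalence.to (h x) (∈-lasts⁻ w x∈) in ∈-interval⁺ p q)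
      (λ {x} x∈ → ∈-lasts⁺ w (Equivalence.from (h x) (∈-interval⁻ x∈))))
    (length-applyUpTo suc m)

  smallerLasts : ℕ → List ℕ → ℕ
  smallerLasts x w = length (filter (_<? x) (lasts w))

  -- Each letter counts once, at its last occurrence, so a letter `suc b` in front of w sees exactly
  -- 1, ..., b. The resulting powers q^b are the terms of the q-integers.
  smallerLasts-packed : ∀ w {m} → (∀ x → x ∈ w ⇔ (1 ≤ x × x ≤ m)) → ∀ {b} → b ≤ m → smallerLasts (suc b) w ≡ b
  smallerLasts-packed w {m} h {b} b≤m = trans (unique-length (Unique-filter⁺ (_<? suc b) (lasts-unique w)) (interval-unique b)
      (λ {x} x∈ → let (x∈l , x<) = ∈-filter⁻ (_<? suc b) {xs = lasts w} x∈ in ∈-interval⁺ (proj₁ (Equivalence.to (h x) (∈-lasts⁻ w x∈l))) (≤-pred x<))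
      (λ {x} x∈ → let (1≤x , x≤b) = ∈-interval⁻ x∈ in ∈-filter⁺ (_<? suc b) (∈-lasts⁺ w (Equivalence.from (h x) (1≤x , ≤-trans x≤b b≤m))) (s≤s x≤b)))
    (length-applyUpTo suc b)

  sinvCount : List ℕ → ℕ
  sinvCount w = pairs (λ i j → sinvPair? w (i , j)) (allFin (length w)) (allFin (length w))

  lastBelow? : ∀ x w (j : Fin (length w)) → Dec (x > lookup w j × lookup w j ∉ drop (suc (toℕ j)) w)
  lastBelow? x w j = (lookup w j <? x) ×-dec ¬? (mem? _≟_ (lookup w j) (drop (suc (toℕ j)) w))

  allFin-suc : ∀ n → tabulate Fin.suc ≡ map Fin.suc (allFin n)
  allFin-suc n = sym (map-tabulate id Fin.suc)

  lastBelow-smallerLasts : ∀ x w → length (filter (lastBelow? x w) (allFin (length w))) ≡ smallerLasts x w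
  lastBelow-smallerLasts x []      = refl
  lastBelow-smallerLasts x (y ∷ w) = trans (cong (λ js → length (filter (lastBelow? x (y ∷ w)) (zero ∷ js))) (allFin-suc (length w))) (head (mem? _≟_ y w) (y <? x))
    where
    tail : length (filter (lastBelow? x (y ∷ w)) (map suc (allFin (length w)))) ≡ smallerLasts x w
    tail = trans (count-map (lastBelow? x (y ∷ w)) (lastBelow? x w) suc id id (allFin (length w))) (lastBelow-smallerLasts x w)

    head : Dec (y ∈ w) → Dec (y < x) → length (filter (lastBelow? x (y ∷ w)) (zero ∷ map suc (allFin (length w)))) ≡ smallerLasts x (y ∷ w)
    head (yes y∈) _         = trans (cong length (filter-reject (lastBelow? x (y ∷ w)) {zero} (λ (_ , y∉) → y∉ y∈)))
                                (trans tail (cong (length ∘ filter (_<? x)) (sym (lasts-∈ y∈))))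
    head (no y∉)  (yes y<x) = trans (cong length (filter-accept (lastBelow? x (y ∷ w)) {zero} (y<x , y∉)))
                                (trans (cong suc tail) (trans (sym (cong length (filter-accept (_<? x) y<x))) (cong (length ∘ filter (_<? x)) (sym (lasts-∉ y∉)))))
    head (no y∉)  (no y≮x)  = trans (cong length (filter-reject (lastBelow? x (y ∷ w)) {zero} (λ (y<x , _) → y≮x y<x)))
                                (trans tail (trans (sym (cong length (filter-reject (_<? x) y≮x))) (cong (length ∘ filter (_<? x)) (sym (lasts-∉ y∉)))))

  -- Whether a position is a last occurrence depends only on what follows it, so a new first letter
  -- leaves the old pairs unchanged.
  sinvCount-∷ : ∀ x w → sinvCount (x ∷ w) ≡ smallerLasts x w + sinvCount w
  sinvCount-∷ x w = begin
    pairs _~?_ (zero ∷ tabulate suc) (zero ∷ tabulate suc)         ≡⟨ cong (λ js → pairs _~?_ (zero ∷ js) (zero ∷ js)) (allFin-suc n) ⟩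
    pairs _~?_ (zero ∷ map suc (allFin n)) (zero ∷ map suc (allFin n)) ≡⟨ pairs-∷ _~?_ zero (map suc (allFin n)) (zero ∷ map suc (allFin n)) ⟩
    row _~?_ zero (zero ∷ map suc (allFin n)) + pairs _~?_ (map suc (allFin n)) (zero ∷ map suc (allFin n)) ≡⟨ cong₂ _+_ first (others (allFin n)) ⟩
    smallerLasts x w + sinvCount w ∎
    where
    open ≡-Reasoning
    n = length w
    _~?_ = λ i j → sinvPair? (x ∷ w) (i , j)
    _~ʷ?_ = λ i j → sinvPair? w (i , j)

    first : row _~?_ zero (zero ∷ map suc (allFin n)) ≡ smallerLasts x w
    first = begin
      row _~?_ zero (zero ∷ map suc (allFin n))           ≡⟨ cong length (filter-reject (zero ~?_) {zero} {map suc (allFin n)} (λ (0<0 , _) → <-irrefl refl 0<0)) ⟩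
      row _~?_ zero (map suc (allFin n))                  ≡⟨ count-map (zero ~?_) (lastBelow? x w) suc (λ p → z<s , p) proj₂ (allFin n) ⟩
      length (filter (lastBelow? x w) (allFin n))         ≡⟨ lastBelow-smallerLasts x w ⟩
      smallerLasts x w                                    ∎

    others : ∀ is → pairs _~?_ (map suc is) (zero ∷ map suc (allFin n)) ≡ pairs _~ʷ?_ is (allFin n)
    others []       = refl
    others (i ∷ is) = begin
      pairs _~?_ (suc i ∷ map suc is) (zero ∷ map suc (allFin n))
        ≡⟨ pairs-∷ _~?_ (suc i) (map suc is) (zero ∷ map suc (allFin n)) ⟩
      row _~?_ (suc i) (zero ∷ map suc (allFin n)) + pairs _~?_ (map suc is) (zero ∷ map suc (allFin n))
        ≡⟨ cong₂ _+_ (trans (cong length (filter-reject (suc i ~?_) {zero} {map suc (allFin n)} (λ { (() , _) })))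
             (count-map (suc i ~?_) (i ~ʷ?_) suc (λ (p , r) → s≤s p , r) (λ (p , r) → ≤-pred p , r) (allFin n))) (others is) ⟩
      row _~ʷ?_ i (allFin n) + pairs _~ʷ?_ is (allFin n)
        ≡⟨ pairs-∷ _~ʷ?_ i is (allFin n) ⟨
      pairs _~ʷ?_ (i ∷ is) (allFin n) ∎

  -- Relabelling by a strictly increasing map

  module Increasing (f : ℕ → ℕ) (mono : ∀ {x y} → x < y → f x < f y) where

    cancel-< : ∀ {x y} → f x < f y → x < y
    cancel-< {x} {y} fx<fy with <-cmp x y
    ... | tri< x<y _ _   = x<y
    ... | tri≈ _ refl _  = contradiction fx<fy (<-irrefl refl)
    ... | tri> _ _ y<x   = contradiction fx<fy (<-asym (mono y<x))

    injective : ∀ {x y} → f x ≡ f y → x ≡ y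
    injective {x} {y} e with <-cmp x y
    ... | tri< x<y _ _ = contradiction e (<⇒≢ (mono x<y))
    ... | tri≈ _ x≡y _ = x≡y
    ... | tri> _ _ y<x = contradiction (sym e) (<⇒≢ (mono y<x))

    mono-≤ : ∀ {x y} → x ≤ y → f x ≤ f y
    mono-≤ {x} {y} x≤y = ≮⇒≥ λ fy<fx → <⇒≱ (cancel-< fy<fx) x≤y

    cancel-≤ : ∀ {x y} → f x ≤ f y → x ≤ y
    cancel-≤ {x} {y} fx≤fy = ≮⇒≥ λ y<x → <⇒≱ (mono y<x) fx≤fy

    ∈-cancel : ∀ {x w} → f x ∈ map f w → x ∈ w
    ∈-cancel {x} {w} fx∈ with ∈-map⁻ f fx∈
    ... | y , y∈ , fx≡fy = subst (_∈ w) (sym (injective fx≡fy)) y∈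

    lasts-map : ∀ w → lasts (map f w) ≡ map f (lasts w)
    lasts-map []      = refl
    lasts-map (x ∷ w) with mem? _≟_ x w | mem? _≟_ (f x) (map f w)
    ... | yes _ | yes _  = lasts-map w
    ... | yes p | no ¬p  = contradiction (∈-map⁺ f p) ¬p
    ... | no ¬p | yes p  = contradiction (∈-cancel p) ¬p
    ... | no _  | no _   = cong (f x ∷_) (lasts-map w)

    cut-map : ∀ a w → cut a (map f w) ≡ cut a w
    cut-map a []      = refl
    cut-map a (x ∷ w) with mem? _≟_ x w | mem? _≟_ (f x) (map f w)
    ... | yes _ | yes _  = cut-map (suc a) w
    ... | yes p | no ¬p  = contradiction (∈-map⁺ f p) ¬p
    ... | no ¬p | yes p  = contradiction (∈-cancel p) ¬p
    ... | no _  | no _   = cong (suc a ∷_) (cut-map 0 w)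

    sinvCount-map : ∀ w → sinvCount (map f w) ≡ sinvCount w
    sinvCount-map []      = refl
    sinvCount-map (x ∷ w) = begin
      sinvCount (f x ∷ map f w)                          ≡⟨ sinvCount-∷ (f x) (map f w) ⟩
      smallerLasts (f x) (map f w) + sinvCount (map f w) ≡⟨ cong₂ _+_ smaller (sinvCount-map w) ⟩
      smallerLasts x w + sinvCount w                     ≡⟨ sinvCount-∷ x w ⟨
      sinvCount (x ∷ w)                                  ∎
      where
      open ≡-Reasoning
      smaller : smallerLasts (f x) (map f w) ≡ smallerLasts x w
      smaller = trans (cong (length ∘ filter (_<? f x)) (lasts-map w)) (count-map (_<? f x) (_<? x) f mono cancel-< (lasts w))

    -- As u is packed, the letters of `map f u` up to `f x` are the images of 1, ..., x, so `f x`
    -- has rank x.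
    pack-map : ∀ {u} → Packed u → pack (map f u) ≡ u
    pack-map {u} (m , h) = trans (sym (map-∘ u)) (map-id-local (All.tabulate rank-f))
      where
      D = deduplicate _≟_ (map f u)
      rank-f : ∀ {x} → x ∈ u → length (filter (_≤? f x) D) ≡ x
      rank-f {x} x∈u = trans (unique-length (Unique-filter⁺ (_≤? f x) (deduplicate-! _≟_ (map f u))) (Unique-map⁺ injective (interval-unique x)) to from)
        (trans (length-map f (applyUpTo suc x)) (length-applyUpTo suc x))
        where
        to : ∀ {y} → y ∈ filter (_≤? f x) D → y ∈ map f (applyUpTo suc x)
        to y∈ with ∈-filter⁻ (_≤? f x) {xs = D} y∈
        ... | y∈D , y≤fx with ∈-map⁻ f (∈-deduplicate⁻ _≟_ (map f u) y∈D)
        ...   | z , z∈u , refl = ∈-map⁺ f (∈-interval⁺ (proj₁ (Equivalence.to (h z) z∈u)) (cancel-≤ y≤fx))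

        from : ∀ {y} → y ∈ map f (applyUpTo suc x) → y ∈ filter (_≤? f x) D
        from y∈ with ∈-map⁻ f y∈
        ... | z , z∈ , refl with ∈-interval⁻ z∈
        ...   | 1≤z , z≤x = ∈-filter⁺ (_≤? f x)
          (∈-deduplicate⁺ _≟_ (∈-map⁺ f (Equivalence.from (h z) (1≤z , ≤-trans z≤x (proj₂ (Equivalence.to (h x) x∈u)))))) (mono-≤ z≤x)

  pack-packed : ∀ {u} → Packed u → pack u ≡ u
  pack-packed {u} p = trans (cong pack (sym (map-id u))) (Increasing.pack-map id id p)

  -- `punchIn a` lists the numbers other than a in order and so makes room for a new letter a.
  -- `punchOut a` undoes it; its value at a itself is a default.
  punchIn punchOut : ℕ → ℕ → ℕ
  punchIn zero    x       = suc x
  punchIn (suc a) zero    = zero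
  punchIn (suc a) (suc x) = suc (punchIn a x)
  punchOut zero    x       = pred x
  punchOut (suc a) zero    = zero
  punchOut (suc a) (suc x) = suc (punchOut a x)

  punchIn-mono : ∀ a {x y} → x < y → punchIn a x < punchIn a y
  punchIn-mono zero    x<y                             = s≤s x<y
  punchIn-mono (suc a) {zero}  {suc y} _               = z<s
  punchIn-mono (suc a) {suc x} {suc y} (s≤s x<y)       = s≤s (punchIn-mono a x<y)

  punchIn-< : ∀ a {x} → x < a → punchIn a x < a
  punchIn-< (suc a) {zero}  _         = z<s
  punchIn-< (suc a) {suc x} (s≤s x<a) = s≤s (punchIn-< a x<a)

  punchIn-<⁻ : ∀ a {x} → punchIn a x < a → x < a
  punchIn-<⁻ (suc a) {zero}  _         = z<s
  punchIn-<⁻ (suc a) {suc x} (s≤s lt)  = s≤s (punchIn-<⁻ a lt)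

  punchIn-≢ : ∀ a {x} → punchIn a x ≢ a
  punchIn-≢ (suc a) {suc x} e = punchIn-≢ a (suc-injective e)

  punchIn-punchOut : ∀ a {x} → x ≢ a → punchIn a (punchOut a x) ≡ x
  punchIn-punchOut zero    {zero}  x≢a = contradiction refl x≢a
  punchIn-punchOut zero    {suc x} x≢a = refl
  punchIn-punchOut (suc a) {zero}  x≢a = refl
  punchIn-punchOut (suc a) {suc x} x≢a = cong suc (punchIn-punchOut a (x≢a ∘ cong suc))

  punchOut-punchIn : ∀ a x → punchOut a (punchIn a x) ≡ x
  punchOut-punchIn zero    x       = refl
  punchOut-punchIn (suc a) zero    = refl
  punchOut-punchIn (suc a) (suc x) = cong suc (punchOut-punchIn a x)

  ≤-punchIn : ∀ a x → x ≤ punchIn a x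
  ≤-punchIn zero    x       = n≤1+n x
  ≤-punchIn (suc a) zero    = z≤n
  ≤-punchIn (suc a) (suc x) = s≤s (≤-punchIn a x)

  punchIn-≤ : ∀ a x → punchIn a x ≤ suc x
  punchIn-≤ zero    x       = ≤-refl
  punchIn-≤ (suc a) zero    = z≤n
  punchIn-≤ (suc a) (suc x) = s≤s (punchIn-≤ a x)

  punchOut-≤ : ∀ a {x m} → a ≤ suc m → x ≤ suc m → x ≢ a → punchOut a x ≤ m
  punchOut-≤ zero    {zero}  _ _ x≢a = contradiction refl x≢a
  punchOut-≤ zero    {suc x} _ (s≤s x≤m) _ = x≤m
  punchOut-≤ (suc a) {zero}  _ _ _ = z≤n
  punchOut-≤ (suc zero)    {suc zero}    {zero}  _ _ x≢a = contradiction refl x≢a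
  punchOut-≤ (suc (suc a)) {_}           {zero}  (s≤s ()) _ _
  punchOut-≤ (suc zero)    {suc (suc x)} {zero}  _ (s≤s ()) _
  punchOut-≤ (suc a) {suc x} {suc m} (s≤s a≤) (s≤s x≤) x≢a = s≤s (punchOut-≤ a a≤ x≤ (x≢a ∘ cong suc))

  1≤punchOut : ∀ {a x} → 1 ≤ a → 1 ≤ x → 1 ≤ punchOut a x
  1≤punchOut (s≤s _) (s≤s _) = s≤s z≤n

  module PunchIn a = Increasing (punchIn a) (punchIn-mono a)

  -- Words whose packed tail is u

  module _ {u m} (h : ∀ x → x ∈ u ⇔ (1 ≤ x × x ≤ m)) where

    packed-old : ∀ {a} → 1 ≤ a → a ≤ m → Packed (a ∷ u)
    packed-old {a} 1≤a a≤m = m , λ x → mk⇔ (λ { (here refl) → 1≤a , a≤m ; (there x∈) → Equivalence.to (h x) x∈ }) (there ∘ Equivalence.from (h x))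

    packed-new : ∀ {a} → 1 ≤ a → a ≤ suc m → Packed (a ∷ map (punchIn a) u)
    packed-new {a} 1≤a a≤m = suc m , λ x → mk⇔ to from
      where
      to : ∀ {x} → x ∈ a ∷ map (punchIn a) u → 1 ≤ x × x ≤ suc m
      to (here refl) = 1≤a , a≤m
      to (there x∈) with ∈-map⁻ (punchIn a) x∈
      ... | y , y∈ , refl = let (1≤y , y≤m) = Equivalence.to (h y) y∈ in ≤-trans 1≤y (≤-punchIn a y) , ≤-trans (punchIn-≤ a y) (s≤s y≤m)
      from : ∀ {x} → 1 ≤ x × x ≤ suc m → x ∈ a ∷ map (punchIn a) u
      from {x} (1≤x , x≤) with x ≟ a
      ... | yes x≡a = here x≡a
      ... | no x≢a  = there (subst (_∈ map (punchIn a) u) (punchIn-punchOut a x≢a)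
        (∈-map⁺ (punchIn a) (Equivalence.from (h _) (1≤punchOut 1≤a 1≤x , punchOut-≤ a a≤m x≤ x≢a))))

    -- Removing a repeated letter leaves the set of letters unchanged, so w is packed already and
    -- `pack` fixes it.
    packed-tail-old : ∀ {a w} → Packed (a ∷ w) → a ∈ w → pack w ≡ u → w ≡ u × a ≤ m
    packed-tail-old {a} {w} (M , k) a∈w e = w≡u , proj₂ (Equivalence.to (h a) (subst (a ∈_) w≡u a∈w))
      where
      w≡u : w ≡ u
      w≡u = trans (sym (pack-packed (M , λ x → mk⇔ (Equivalence.to (k x) ∘ there) (λ p → drop-a (Equivalence.from (k x) p))))) e
        where
        drop-a : ∀ {x} → x ∈ a ∷ w → x ∈ w
        drop-a (here refl) = a∈w
        drop-a (there x∈)  = x∈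

    -- Removing the only occurrence of a leaves a gap at a, which `punchOut a` closes. The closed
    -- word is packed and has the same packing as w, hence it is u.
    packed-tail-new : ∀ {a w} → Packed (a ∷ w) → a ∉ w → pack w ≡ u → w ≡ map (punchIn a) u × a ≤ suc m
    packed-tail-new {a} {w} (zero , k) a∉w e = contradiction (Equivalence.to (k a) (here refl)) λ { (s≤s _ , ()) }
    packed-tail-new {a} {w} (suc M , k) a∉w e = trans (sym re-in) (cong (map (punchIn a)) w′≡u) , subst (λ n → a ≤ suc n) M≡m a≤
      where
      w′ = map (punchOut a) w
      1≤a = proj₁ (Equivalence.to (k a) (here refl))
      a≤  = proj₂ (Equivalence.to (k a) (here refl))

      ≢a : ∀ {x} → x ∈ w → x ≢ a
      ≢a x∈ refl = a∉w x∈

      re-in : map (punchIn a) w′ ≡ w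
      re-in = trans (sym (map-∘ w)) (map-id-local (All.tabulate λ x∈ → punchIn-punchOut a (≢a x∈)))

      packed-w′ : ∀ x → x ∈ w′ ⇔ (1 ≤ x × x ≤ M)
      packed-w′ x = mk⇔ to from
        where
        to : x ∈ w′ → 1 ≤ x × x ≤ M
        to x∈ with ∈-map⁻ (punchOut a) x∈
        ... | y , y∈ , refl = let (1≤y , y≤) = Equivalence.to (k y) (there y∈) in 1≤punchOut 1≤a 1≤y , punchOut-≤ a a≤ y≤ (≢a y∈)
        from : 1 ≤ x × x ≤ M → x ∈ w′
        from (1≤x , x≤M) with Equivalence.from (k (punchIn a x)) (≤-trans 1≤x (≤-punchIn a x) , ≤-trans (punchIn-≤ a x) (s≤s x≤M))
        ... | here e     = contradiction e (punchIn-≢ a)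
        ... | there fx∈w = subst (_∈ w′) (punchOut-punchIn a x) (∈-map⁺ (punchOut a) fx∈w)

      w′≡u : w′ ≡ u
      w′≡u = trans (sym (PunchIn.pack-map a (M , packed-w′))) (trans (cong pack re-in) e)

      -- The bound of a packed word is determined by the word: it is the number of last occurrences.
      M≡m : M ≡ m
      M≡m = trans (sym (lasts-packed w′ packed-w′)) (trans (cong (length ∘ lasts) w′≡u) (lasts-packed u h))

  letters-packed : ∀ u → Packed (letters u)
  letters-packed (word w p) = recompute (packed? w) p

  words-unique : ∀ N n → Unique (words N n)
  words-unique N zero    = [] ∷ []
  words-unique N (suc n) = cartesianProductWith⁺ _∷_ ∷-injective (interval-unique N) (words-unique N n)

  ∈-words : ∀ N w → All (λ x → 1 ≤ x × x ≤ N) w → w ∈ words N (length w)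
  ∈-words N []      []              = here refl
  ∈-words N (x ∷ w) ((p , p′) ∷ ps) = ∈-cartesianProductWith⁺ _∷_ (∈-interval⁺ p p′) (∈-words N w ps)

  WCʷ : List ℕ → Composition
  WCʷ w = comp (cut 0 w) (cut-positive 0 w)

  -- The accumulator of `cut` holds the letters of the unfinished part, so raising it lengthens the
  -- first part and nothing else.
  parts-bump-cut : ∀ I a w → parts I ≡ cut a w → parts (bump I) ≡ cut (suc a) w
  parts-bump-cut (comp []      _) a []      e = refl
  parts-bump-cut I                a (x ∷ w) e with mem? _≟_ x w
  parts-bump-cut I                a (x ∷ w) e    | yes _ = parts-bump-cut I (suc a) w e
  parts-bump-cut (comp .(suc a ∷ cut 0 w) _) a (x ∷ w) refl | no _ = refl

  WC-old : ∀ {a w} → a ∈ w → WCʷ (a ∷ w) ≡ bump (WCʷ w)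
  WC-old {a} {w} a∈w = parts-injective (trans cut-∈ (sym (parts-bump-cut (WCʷ w) 0 w refl)))
    where
    cut-∈ : cut 0 (a ∷ w) ≡ cut 1 w
    cut-∈ with mem? _≟_ a w
    ... | yes _  = refl
    ... | no a∉w = contradiction a∈w a∉w

  WC-new : ∀ {a w} → a ∉ w → WCʷ (a ∷ w) ≡ one∷ (WCʷ w)
  WC-new {a} {w} a∉w = parts-injective cut-∉
    where
    cut-∉ : cut 0 (a ∷ w) ≡ 1 ∷ cut 0 w
    cut-∉ with mem? _≟_ a w
    ... | yes a∈w = contradiction a∈w a∉w
    ... | no _    = refl

  ∉-punchIn : ∀ a w → a ∉ map (punchIn a) w
  ∉-punchIn a w a∈ with ∈-map⁻ (punchIn a) a∈
  ... | _ , _ , e = punchIn-≢ a (sym e)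

  module _ {u m} (h : ∀ x → x ∈ u ⇔ (1 ≤ x × x ≤ m)) {b : ℕ} where

    sinvCount-old : b ≤ m → sinvCount (suc b ∷ u) ≡ b + sinvCount u
    sinvCount-old b≤m = trans (sinvCount-∷ (suc b) u) (cong (_+ sinvCount u) (smallerLasts-packed u h b≤m))

    -- `punchIn (suc b)` moves no letter across `suc b`, so a new letter has the same smaller
    -- letters as a repeated one.
    sinvCount-new : b ≤ m → sinvCount (suc b ∷ map (punchIn (suc b)) u) ≡ b + sinvCount u
    sinvCount-new b≤m = trans (sinvCount-∷ (suc b) (map f u)) (cong₂ _+_ smaller (PunchIn.sinvCount-map (suc b) u))
      where
      f = punchIn (suc b)
      smaller : smallerLasts (suc b) (map f u) ≡ b
      smaller = trans (cong (length ∘ filter (_<? suc b)) (PunchIn.lasts-map (suc b) u))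
        (trans (count-map (_<? suc b) (_<? suc b) f (punchIn-< (suc b)) (punchIn-<⁻ (suc b)) (lasts u)) (smallerLasts-packed u h b≤m))

    WC-punchIn : WCʷ (map (punchIn (suc b)) u) ≡ WCʷ u
    WC-punchIn = parts-injective (PunchIn.cut-map (suc b) 0 u)

open Words

-- The data of K(q) on which the proof depends.  Abstracting from K keeps its
-- arithmetic from unfolding; q^_ and qfact are fields because they are defined
-- by recursion in Defs, so that copies of them would not be definitionally equal.
record WeightRing c ℓ₁ : Set (lsuc (c ⊔ ℓ₁)) where
  field
    R : CommutativeRing c ℓ₁
  open CommutativeRing R public using (Carrier; _≈_; 0#; 1#; -_) renaming (_+_ to _⊕_; _*_ to _⊗_)
  open Exponentiation (CommutativeRing.semiring R) public using (_^_)
  open FiniteSums R public using (∑[_])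
  field
    q q⁻¹     : Carrier
    q*q⁻¹≈1   : q ⊗ q⁻¹ ≈ 1#
    q^_       : ℤ → Carrier
    q^-nonneg : ∀ n → q^ (ℤ.+ n) ≈ q ^ n
    q^-neg    : ∀ n → q^ -[1+ n ] ≈ q⁻¹ ^ suc n

  [_]q : ℕ → Carrier
  [ m ]q = ∑[ upTo m ] (q ^_)

  field
    qfact    : List ℕ → Carrier
    qfact-[] : qfact [] ≈ 1#
    qfact-∷  : ∀ j J → qfact (j ∷ J) ≈ [ length (j ∷ J) ]q ^ j ⊗ qfact J

-- The identities over a ring with an invertible q.

module Weighted {c ℓ₁} (W : WeightRing c ℓ₁) where

  open WeightRing W
  private
    module R = CommutativeRing R
  open R using (refl; sym; trans; setoid; reflexive; +-cong; +-congˡ; +-congʳ; +-assoc; +-identityˡ; +-identityʳ; *-cong; *-congˡ; *-congʳ; *-assoc; *-identityˡ; *-identityʳ; zeroˡ; zeroʳ; -‿inverseʳ; -‿cong) renaming (*-comm to ⊗-comm; _-_ to _⊝_)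
  open FiniteSums R hiding (∑[_])
  open Exponentiation R.semiring using (^-homo-*; ^-congˡ)
  open RingProperties R.ring using (-‿distribˡ-*; -‿distribʳ-*; +-cancelʳ; -1*x≈-x; -0#≈0#)
  open GroupProperties R.+-group using () renaming (x∙y⁻¹≈ε⇒x≈y to x-y≈0⇒x≈y; x≈y⇒x∙y⁻¹≈ε to x≈y⇒x-y≈0)
  open SemiringSolver R.commutativeSemiring using (solve; _:=_; _:+_; _:*_; con)
  open SetoidReasoning setoid

  -- Sums over coarser compositions

  ∑-coarser-cong : ∀ I {f g : Composition → Carrier} → (∀ J → I ⪯ J → f J ≈ g J) → ∑[ coarserThan I ] f ≈ ∑[ coarserThan I ] g
  ∑-coarser-cong I {f} {g} e = trans (∑-filter (I ⪯?_) (compositions (size I)) f)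
    (trans (∑-cong (compositions (size I)) (λ J → ⟦⟧-⊗-cong (I ⪯? J) (e J))) (sym (∑-filter (I ⪯?_) (compositions (size I)) g)))

  -- The statistics are computed for nonempty compositions; equality of sizes excludes the empty J.
  ∑-coarser-cong⁺ : ∀ i I .(pos : All (0 <_) (i ∷ I)) {f g : Composition → Carrier} →
    (∀ j J .(pos′ : All (0 <_) (j ∷ J)) → comp (i ∷ I) pos ⪯ comp (j ∷ J) pos′ → f (comp (j ∷ J) pos′) ≈ g (comp (j ∷ J) pos′)) →
    ∑[ coarserThan (comp (i ∷ I) pos) ] f ≈ ∑[ coarserThan (comp (i ∷ I) pos) ] g
  ∑-coarser-cong⁺ i I pos e = ∑-coarser-cong (comp (i ∷ I) pos) λ where
    (comp [] _)       (h , _) → contradiction (≡.sym h) (<⇒≢ (size-positive i I pos))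
    (comp (j ∷ J) p′) h       → e j J p′ h

  module _ i I .(pos : All (0 <_) (i ∷ I)) (f : Composition → Carrier) where
    private
      I₀ = comp (i ∷ I) pos

      ∑-coarser-extend : ∀ I⁺ g → size I⁺ ≡ suc (size I₀) → (∀ J → ∑[ extend J ] (λ J⁺ → ⟦ I⁺ ⪯? J⁺ ⟧ ⊗ f J⁺) ≈ ⟦ I₀ ⪯? J ⟧ ⊗ g J) →
        ∑[ coarserThan I⁺ ] f ≈ ∑[ coarserThan I₀ ] g
      ∑-coarser-extend I⁺ g e h = begin
        ∑[ coarserThan I⁺ ] f                                                                   ≈⟨ ∑-filter (I⁺ ⪯?_) (compositions (size I⁺)) f ⟩
        ∑[ compositions (size I⁺) ] (λ J → ⟦ I⁺ ⪯? J ⟧ ⊗ f J)                                   ≡⟨ ≡.cong (λ n → ∑[ compositions n ] (λ J → ⟦ I⁺ ⪯? J ⟧ ⊗ f J)) e ⟩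
        ∑[ concatMap extend (compositions (size I₀)) ] (λ J → ⟦ I⁺ ⪯? J ⟧ ⊗ f J)                ≈⟨ ∑-concatMap extend (compositions (size I₀)) _ ⟩
        ∑[ compositions (size I₀) ] (λ J → ∑[ extend J ] (λ J⁺ → ⟦ I⁺ ⪯? J⁺ ⟧ ⊗ f J⁺))          ≈⟨ ∑-cong (compositions (size I₀)) h ⟩
        ∑[ compositions (size I₀) ] (λ J → ⟦ I₀ ⪯? J ⟧ ⊗ g J)                                   ≈⟨ ∑-filter (I₀ ⪯?_) (compositions (size I₀)) g ⟨
        ∑[ coarserThan I₀ ] g                                                                   ∎

      ⋠[] : ∀ .{p : All (0 <_) []} → ¬ (I₀ ⪯ comp [] p)
      ⋠[] (h , _) = <⇒≢ (size-positive i I pos) (≡.sym h)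

      -- The empty J contributes 0 on both sides: its only extension has size 1, too small for `I⁺`,
      -- and J itself is too small for `I₀`. Hence g may be arbitrary there.
      vanish : ∀ {I⁺ J⁺} .{p : All (0 <_) []} (g : Composition → Carrier) → ¬ (I⁺ ⪯ J⁺) → ⟦ I⁺ ⪯? J⁺ ⟧ ⊗ f J⁺ ⊕ 0# ≈ ⟦ I₀ ⪯? comp [] p ⟧ ⊗ g (comp [] p)
      vanish {I⁺} {J⁺} {p} g ¬h = begin
        ⟦ I⁺ ⪯? J⁺ ⟧ ⊗ f J⁺ ⊕ 0#            ≈⟨ +-congʳ (*-congʳ (⟦⟧-false (I⁺ ⪯? J⁺) ¬h)) ⟩
        0# ⊗ f J⁺ ⊕ 0#                      ≈⟨ solve 2 (λ a b → con 0 :* a :+ con 0 := con 0 :* b) refl (f J⁺) (g (comp [] p)) ⟩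
        0# ⊗ g (comp [] p)                  ≈⟨ *-congʳ (⟦⟧-false (I₀ ⪯? comp [] p) (⋠[] {p})) ⟨
        ⟦ I₀ ⪯? comp [] p ⟧ ⊗ g (comp [] p) ∎

    ∑-coarser-one : ∑[ coarserThan (one∷ I₀) ] f ≈ ∑[ coarserThan I₀ ] (λ J → f (one∷ J) ⊕ f (bump J))
    ∑-coarser-one = ∑-coarser-extend (one∷ I₀) (λ J → f (one∷ J) ⊕ f (bump J)) ≡.refl step
      where
      step : ∀ J → ∑[ extend J ] (λ J⁺ → ⟦ one∷ I₀ ⪯? J⁺ ⟧ ⊗ f J⁺) ≈ ⟦ I₀ ⪯? J ⟧ ⊗ (f (one∷ J) ⊕ f (bump J))
      step (comp [] p)           = vanish {one∷ I₀} {comp (1 ∷ []) (z<s ∷ [])} {p} (λ J → f (one∷ J) ⊕ f (bump J)) (λ h → <⇒≢ (size-positive i I pos) (≡.sym (suc-injective (proj₁ h))))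
      step J₀@(comp (j ∷ J) p′) = begin
        ⟦ one∷ I₀ ⪯? one∷ J₀ ⟧ ⊗ f (one∷ J₀) ⊕ (⟦ one∷ I₀ ⪯? bump J₀ ⟧ ⊗ f (bump J₀) ⊕ 0#)
          ≈⟨ +-cong (*-congʳ (⟦⟧-cong (one∷ I₀ ⪯? one∷ J₀) (I₀ ⪯? J₀) one⪯one⁻ one⪯one⁺))
                    (+-congʳ (*-congʳ (⟦⟧-cong (one∷ I₀ ⪯? bump J₀) (I₀ ⪯? J₀) one⪯bump⁻ one⪯bump⁺))) ⟩
        ⟦ I₀ ⪯? J₀ ⟧ ⊗ f (one∷ J₀) ⊕ (⟦ I₀ ⪯? J₀ ⟧ ⊗ f (bump J₀) ⊕ 0#)
          ≈⟨ solve 3 (λ a b c → a :* b :+ (a :* c :+ con 0) := a :* (b :+ c)) refl ⟦ I₀ ⪯? J₀ ⟧ (f (one∷ J₀)) (f (bump J₀)) ⟩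
        ⟦ I₀ ⪯? J₀ ⟧ ⊗ (f (one∷ J₀) ⊕ f (bump J₀)) ∎
        where
        open Refinement i I pos j J p′

    ∑-coarser-bump : ∑[ coarserThan (bump I₀) ] f ≈ ∑[ coarserThan I₀ ] (f ∘ bump)
    ∑-coarser-bump = ∑-coarser-extend (bump I₀) (f ∘ bump) ≡.refl step
      where
      step : ∀ J → ∑[ extend J ] (λ J⁺ → ⟦ bump I₀ ⪯? J⁺ ⟧ ⊗ f J⁺) ≈ ⟦ I₀ ⪯? J ⟧ ⊗ f (bump J)
      step (comp [] p)           = vanish {bump I₀} {comp (1 ∷ []) (z<s ∷ [])} {p} (f ∘ bump) (λ h → <⇒≢ (size-positive i I pos) (≡.sym (suc-injective (proj₁ h))))
      step J₀@(comp (j ∷ J) p′) = begin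
        ⟦ bump I₀ ⪯? one∷ J₀ ⟧ ⊗ f (one∷ J₀) ⊕ (⟦ bump I₀ ⪯? bump J₀ ⟧ ⊗ f (bump J₀) ⊕ 0#)
          ≈⟨ +-cong (*-congʳ (⟦⟧-false (bump I₀ ⪯? one∷ J₀) bump⋠one))
                    (+-congʳ (*-congʳ (⟦⟧-cong (bump I₀ ⪯? bump J₀) (I₀ ⪯? J₀) bump⪯bump⁻ bump⪯bump⁺))) ⟩
        0# ⊗ f (one∷ J₀) ⊕ (⟦ I₀ ⪯? J₀ ⟧ ⊗ f (bump J₀) ⊕ 0#)
          ≈⟨ solve 3 (λ a b c → con 0 :* b :+ (a :* c :+ con 0) := a :* c) refl ⟦ I₀ ⪯? J₀ ⟧ (f (one∷ J₀)) (f (bump J₀)) ⟩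
        ⟦ I₀ ⪯? J₀ ⟧ ⊗ f (bump J₀) ∎
        where
        open Refinement i I pos j J p′

  q⁻¹^*q^ : ∀ n → q⁻¹ ^ n ⊗ q ^ n ≈ 1#
  q⁻¹^*q^ zero    = *-identityˡ 1#
  q⁻¹^*q^ (suc n) = begin
    (q⁻¹ ⊗ q⁻¹ ^ n) ⊗ (q ⊗ q ^ n)   ≈⟨ solve 4 (λ a b c d → (a :* b) :* (c :* d) := (c :* a) :* (b :* d)) refl q⁻¹ (q⁻¹ ^ n) q (q ^ n) ⟩
    (q ⊗ q⁻¹) ⊗ (q⁻¹ ^ n ⊗ q ^ n)   ≈⟨ *-cong q*q⁻¹≈1 (q⁻¹^*q^ n) ⟩
    1# ⊗ 1#                         ≈⟨ *-identityˡ 1# ⟩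
    1#                              ∎

  q^-‿+ : ∀ n → q^ (ℤ.- ℤ.+ n) ≈ q⁻¹ ^ n
  q^-‿+ zero    = q^-nonneg 0
  q^-‿+ (suc n) = q^-neg n

  -- Möbius inversion

  -- This is the passage from coordinates in the `L J` to coordinates in the `Ψ I`.
  transform : (Composition → Carrier) → Composition → Carrier
  transform e I = ∑[ coarserThan I ] (λ J → q ^ st I J ⊗ e J)

  weight : Composition → Composition → Carrier
  weight I J = (- q⁻¹) ^ (ℓ I ∸ ℓ J) ⊗ q^ (ℤ.- ℤ.+ st′ I J)

  inverse : (Composition → Carrier) → Composition → Carrier
  inverse f I = ∑[ coarserThan I ] (λ J → weight I J ⊗ f J)

  inverse-cong : ∀ I {f g} → (∀ J → I ⪯ J → f J ≈ g J) → inverse f I ≈ inverse g I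
  inverse-cong I e = ∑-coarser-cong I (λ J h → *-congˡ (e J h))

  module _ i I .(pos : All (0 <_) (i ∷ I)) where
    private
      I₀ = comp (i ∷ I) pos

    -- Against `one∷ J` the exponent grows by `ℓ I₀`, which does not depend on J and leaves the sum;
    -- against `bump J` it does not grow.
    transform-one : ∀ e → transform e (one∷ I₀) ≈ q ^ ℓ I₀ ⊗ transform (e ∘ one∷_) I₀ ⊕ transform (e ∘ bump) I₀
    transform-one e = begin
      transform e (one∷ I₀)
        ≈⟨ ∑-coarser-one i I pos _ ⟩
      ∑[ coarserThan I₀ ] (λ J → q ^ st (one∷ I₀) (one∷ J) ⊗ e (one∷ J) ⊕ q ^ st (one∷ I₀) (bump J) ⊗ e (bump J))
        ≈⟨ ∑-coarser-cong⁺ i I pos (λ j J p′ _ → step j J p′) ⟩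
      ∑[ coarserThan I₀ ] (λ J → q ^ ℓ I₀ ⊗ (q ^ st I₀ J ⊗ e (one∷ J)) ⊕ q ^ st I₀ J ⊗ e (bump J))
        ≈⟨ ∑-⊕ (coarserThan I₀) _ _ ⟩
      ∑[ coarserThan I₀ ] (λ J → q ^ ℓ I₀ ⊗ (q ^ st I₀ J ⊗ e (one∷ J))) ⊕ transform (e ∘ bump) I₀
        ≈⟨ +-congʳ (∑-⊗ˡ (coarserThan I₀) _ _) ⟩
      q ^ ℓ I₀ ⊗ transform (e ∘ one∷_) I₀ ⊕ transform (e ∘ bump) I₀ ∎
      where
      step : ∀ j J .(p′ : All (0 <_) (j ∷ J)) → let J₀ = comp (j ∷ J) p′ in
        q ^ st (one∷ I₀) (one∷ J₀) ⊗ e (one∷ J₀) ⊕ q ^ st (one∷ I₀) (bump J₀) ⊗ e (bump J₀) ≈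
        q ^ ℓ I₀ ⊗ (q ^ st I₀ J₀ ⊗ e (one∷ J₀)) ⊕ q ^ st I₀ J₀ ⊗ e (bump J₀)
      step j J p′ = +-cong
        (trans (*-congʳ (trans (reflexive (≡.cong (q ^_) st-one-one)) (^-homo-* q (ℓ I₀) _))) (*-assoc _ _ _))
        (*-congʳ (reflexive (≡.cong (q ^_) st-one-bump)))
        where
        open Statistics i I pos j J p′

    transform-bump : ∀ e → transform e (bump I₀) ≈ transform (e ∘ bump) I₀
    transform-bump e = trans (∑-coarser-bump i I pos _)
      (∑-coarser-cong⁺ i I pos (λ j J p′ _ → *-congʳ (reflexive (≡.cong (q ^_) (Statistics.st-bump-bump i I pos j J p′)))))

    module _ j J .(pos′ : All (0 <_) (j ∷ J)) where
      private
        J₀ = comp (j ∷ J) pos′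
        open Statistics i I pos j J pos′

      weight-one-one : weight (one∷ I₀) (one∷ J₀) ≈ weight I₀ J₀ ⊗ q⁻¹ ^ ℓ J₀
      weight-one-one = begin
        x ⊗ q^ (ℤ.- ℤ.+ st′ (one∷ I₀) (one∷ J₀))   ≡⟨ ≡.cong (λ n → x ⊗ q^ (ℤ.- ℤ.+ n)) st′-one-one ⟩
        x ⊗ q^ (ℤ.- ℤ.+ (ℓ J₀ + st′ I₀ J₀))       ≈⟨ *-congˡ (trans (q^-‿+ (ℓ J₀ + st′ I₀ J₀)) (^-homo-* q⁻¹ (ℓ J₀) _)) ⟩
        x ⊗ (q⁻¹ ^ ℓ J₀ ⊗ q⁻¹ ^ st′ I₀ J₀)        ≈⟨ solve 3 (λ a b c → a :* (b :* c) := a :* c :* b) refl x (q⁻¹ ^ ℓ J₀) (q⁻¹ ^ st′ I₀ J₀) ⟩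
        x ⊗ q⁻¹ ^ st′ I₀ J₀ ⊗ q⁻¹ ^ ℓ J₀          ≈⟨ *-congʳ (*-congˡ (q^-‿+ (st′ I₀ J₀))) ⟨
        weight I₀ J₀ ⊗ q⁻¹ ^ ℓ J₀                 ∎
        where x = (- q⁻¹) ^ (ℓ I₀ ∸ ℓ J₀)

      -- The length difference grows by one and contributes - q⁻¹, while `st′` is one less than for
      -- `one∷ J₀`. The powers of q agree with `weight-one-one`, and only the sign differs.
      weight-one-bump : I₀ ⪯ J₀ → weight (one∷ I₀) (bump J₀) ≈ - (weight I₀ J₀ ⊗ q⁻¹ ^ ℓ J₀)
      weight-one-bump h = begin
        (- q⁻¹) ^ (suc (ℓ I₀) ∸ ℓ J₀) ⊗ q^ (ℤ.- ℤ.+ s)   ≡⟨ ≡.cong (λ n → (- q⁻¹) ^ n ⊗ q^ (ℤ.- ℤ.+ s)) (+-∸-assoc 1 (⪯⇒ℓ≥ {I₀} {J₀} h)) ⟩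
        ((- q⁻¹) ⊗ x) ⊗ q^ (ℤ.- ℤ.+ s)                     ≈⟨ *-congˡ (q^-‿+ s) ⟩
        ((- q⁻¹) ⊗ x) ⊗ q⁻¹ ^ s                            ≈⟨ trans (*-congʳ (sym (-‿distribˡ-* q⁻¹ x))) (sym (-‿distribˡ-* _ _)) ⟩
        - (q⁻¹ ⊗ x ⊗ q⁻¹ ^ s)                              ≈⟨ -‿cong (solve 3 (λ a b c → a :* b :* c := b :* (a :* c)) refl q⁻¹ x (q⁻¹ ^ s)) ⟩
        - (x ⊗ q⁻¹ ^ suc s)                                ≡⟨ ≡.cong (λ n → - (x ⊗ q⁻¹ ^ n)) st′-one-bump ⟩
        - (x ⊗ q⁻¹ ^ (ℓ J₀ + st′ I₀ J₀))                  ≈⟨ -‿cong (*-congˡ (^-homo-* q⁻¹ (ℓ J₀) _)) ⟩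
        - (x ⊗ (q⁻¹ ^ ℓ J₀ ⊗ q⁻¹ ^ st′ I₀ J₀))            ≈⟨ -‿cong (solve 3 (λ a b c → a :* (b :* c) := a :* c :* b) refl x (q⁻¹ ^ ℓ J₀) (q⁻¹ ^ st′ I₀ J₀)) ⟩
        - (x ⊗ q⁻¹ ^ st′ I₀ J₀ ⊗ q⁻¹ ^ ℓ J₀)              ≈⟨ -‿cong (*-congʳ (*-congˡ (q^-‿+ (st′ I₀ J₀)))) ⟨
        - (weight I₀ J₀ ⊗ q⁻¹ ^ ℓ J₀)                     ∎
        where
        x = (- q⁻¹) ^ (ℓ I₀ ∸ ℓ J₀)
        s = st′ (one∷ I₀) (bump J₀)

    -- The opposite signs produce a difference, which is what cancels the second term of
    -- `transform-one`.
    inverse-one : ∀ f → inverse f (one∷ I₀) ≈ inverse (λ J → q⁻¹ ^ ℓ J ⊗ (f (one∷ J) ⊝ f (bump J))) I₀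
    inverse-one f = trans (∑-coarser-one i I pos _) (∑-coarser-cong⁺ i I pos step)
      where
      step : ∀ j J .(p′ : All (0 <_) (j ∷ J)) → let J₀ = comp (j ∷ J) p′ in I₀ ⪯ J₀ →
        weight (one∷ I₀) (one∷ J₀) ⊗ f (one∷ J₀) ⊕ weight (one∷ I₀) (bump J₀) ⊗ f (bump J₀) ≈
        weight I₀ J₀ ⊗ (q⁻¹ ^ ℓ J₀ ⊗ (f (one∷ J₀) ⊝ f (bump J₀)))
      step j J p′ h = begin
        weight (one∷ I₀) (one∷ J₀) ⊗ f (one∷ J₀) ⊕ weight (one∷ I₀) (bump J₀) ⊗ f (bump J₀)
          ≈⟨ +-cong (*-congʳ (weight-one-one j J p′)) (*-congʳ (weight-one-bump j J p′ h)) ⟩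
        (w ⊗ k) ⊗ f (one∷ J₀) ⊕ (- (w ⊗ k)) ⊗ f (bump J₀)
          ≈⟨ +-congˡ (trans (sym (-‿distribˡ-* (w ⊗ k) _)) (-‿distribʳ-* (w ⊗ k) _)) ⟩
        (w ⊗ k) ⊗ f (one∷ J₀) ⊕ (w ⊗ k) ⊗ (- f (bump J₀))
          ≈⟨ solve 4 (λ w k a b → (w :* k) :* a :+ (w :* k) :* b := w :* (k :* (a :+ b))) refl w k (f (one∷ J₀)) (- f (bump J₀)) ⟩
        w ⊗ (k ⊗ (f (one∷ J₀) ⊝ f (bump J₀))) ∎
        where
        J₀ = comp (j ∷ J) p′
        w  = weight I₀ J₀
        k  = q⁻¹ ^ ℓ J₀

    inverse-bump : ∀ f → inverse f (bump I₀) ≈ inverse (f ∘ bump) I₀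
    inverse-bump f = trans (∑-coarser-bump i I pos _)
      (∑-coarser-cong⁺ i I pos (λ j J p′ _ → *-congʳ (reflexive (≡.cong (λ n → (- q⁻¹) ^ (ℓ I₀ ∸ ℓ (comp (j ∷ J) p′)) ⊗ q^ (ℤ.- ℤ.+ n)) (Statistics.st′-bump-bump i I pos j J p′)))))

  ⊕-⊖-cancel : ∀ x y → (x ⊕ y) ⊝ y ≈ x
  ⊕-⊖-cancel x y = trans (+-assoc x y (- y)) (trans (+-congˡ (-‿inverseʳ y)) (+-identityʳ x))

  -- For a prepended part, the difference in `inverse-one` leaves `q ^ ℓ J` times the transform of
  -- `e ∘ one∷_`, and `q⁻¹ ^ ℓ J` removes the power. The function e changes at every step, so the
  -- induction runs over all e.
  inverse-transform : ∀ {I} → Built I → ∀ e → inverse (transform e) I ≈ e I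
  inverse-transform empty e = trans (+-congʳ (*-congʳ (*-congˡ (q^-nonneg 0))))
    (solve 1 (λ x → con 1 :* con 1 :* (con 1 :* x :+ con 0) :+ con 0 := x) refl (e (comp [] [])))
  inverse-transform (prepend {comp [] _} b) e = trans (+-congʳ (*-congʳ (*-congˡ (q^-nonneg 0))))
    (solve 1 (λ x → con 1 :* con 1 :* (con 1 :* x :+ con 0) :+ con 0 := x) refl (e (comp (1 ∷ []) (z<s ∷ []))))
  inverse-transform (prepend {comp (i ∷ I) pos} b) e = begin
    inverse (transform e) (one∷ I₀)
      ≈⟨ inverse-one i I pos (transform e) ⟩
    inverse (λ J → q⁻¹ ^ ℓ J ⊗ (transform e (one∷ J) ⊝ transform e (bump J))) I₀
      ≈⟨ ∑-coarser-cong⁺ i I pos (λ j J p′ _ → *-congˡ (step j J p′)) ⟩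
    inverse (transform (e ∘ one∷_)) I₀
      ≈⟨ inverse-transform b (e ∘ one∷_) ⟩
    e (one∷ I₀) ∎
    where
    I₀ = comp (i ∷ I) pos
    step : ∀ j J .(p′ : All (0 <_) (j ∷ J)) → let J₀ = comp (j ∷ J) p′ in
      q⁻¹ ^ ℓ J₀ ⊗ (transform e (one∷ J₀) ⊝ transform e (bump J₀)) ≈ transform (e ∘ one∷_) J₀
    step j J p′ = begin
      q⁻¹ ^ ℓ J₀ ⊗ (transform e (one∷ J₀) ⊝ transform e (bump J₀))
        ≈⟨ *-congˡ (+-cong (transform-one j J p′ e) (-‿cong (transform-bump j J p′ e))) ⟩
      q⁻¹ ^ ℓ J₀ ⊗ ((q ^ ℓ J₀ ⊗ transform (e ∘ one∷_) J₀ ⊕ transform (e ∘ bump) J₀) ⊝ transform (e ∘ bump) J₀)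
        ≈⟨ *-congˡ (⊕-⊖-cancel _ _) ⟩
      q⁻¹ ^ ℓ J₀ ⊗ (q ^ ℓ J₀ ⊗ transform (e ∘ one∷_) J₀)
        ≈⟨ trans (sym (*-assoc _ _ _)) (trans (*-congʳ (q⁻¹^*q^ (ℓ J₀))) (*-identityˡ _)) ⟩
      transform (e ∘ one∷_) J₀ ∎
      where J₀ = comp (j ∷ J) p′
  inverse-transform (grow {i} {I} {pos} b) e = begin
    inverse (transform e) (bump I₀)           ≈⟨ inverse-bump i I pos (transform e) ⟩
    inverse (transform e ∘ bump) I₀           ≈⟨ ∑-coarser-cong⁺ i I pos (λ j J p′ _ → *-congˡ (transform-bump j J p′ e)) ⟩
    inverse (transform (e ∘ bump)) I₀         ≈⟨ inverse-transform b (e ∘ bump) ⟩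
    e (bump I₀)                               ∎
    where I₀ = comp (i ∷ I) pos

  [suc]q : ∀ m → [ suc m ]q ≈ 1# ⊕ q ⊗ [ m ]q
  [suc]q m = +-congˡ (begin
    ∑[ applyUpTo suc m ] (q ^_)       ≡⟨ ≡.cong (λ xs → ∑[ xs ] (q ^_)) (map-upTo suc m) ⟨
    ∑[ map suc (upTo m) ] (q ^_)      ≈⟨ ∑-map suc (upTo m) (q ^_) ⟩
    ∑[ upTo m ] (λ i → q ⊗ q ^ i)     ≈⟨ ∑-⊗ˡ (upTo m) q (q ^_) ⟩
    q ⊗ [ m ]q                        ∎)

  [1]q : [ 1 ]q ≈ 1#
  [1]q = +-identityʳ 1#

  [+]q : ∀ m k → [ m + k ]q ≈ [ m ]q ⊕ q ^ m ⊗ [ k ]q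
  [+]q zero    k = solve 1 (λ x → x := con 0 :+ con 1 :* x) refl [ k ]q
  [+]q (suc m) k = begin
    [ suc (m + k) ]q                            ≈⟨ [suc]q (m + k) ⟩
    1# ⊕ q ⊗ [ m + k ]q                         ≈⟨ +-congˡ (*-congˡ ([+]q m k)) ⟩
    1# ⊕ q ⊗ ([ m ]q ⊕ q ^ m ⊗ [ k ]q)          ≈⟨ solve 4 (λ q m p k → con 1 :+ q :* (m :+ p :* k) := (con 1 :+ q :* m) :+ (q :* p) :* k) refl q [ m ]q (q ^ m) [ k ]q ⟩
    (1# ⊕ q ⊗ [ m ]q) ⊕ q ^ suc m ⊗ [ k ]q      ≈⟨ +-congʳ ([suc]q m) ⟨
    [ suc m ]q ⊕ q ^ suc m ⊗ [ k ]q             ∎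

  -- Together with `[suc]q` this gives 1 + q [k] = [k] + q^k, which identifies the denominator of C
  -- at x = [k].
  [suc]q′ : ∀ k → [ suc k ]q ≈ [ k ]q ⊕ q ^ k
  [suc]q′ k = begin
    [ suc k ]q                  ≡⟨ ≡.cong [_]q (+-comm 1 k) ⟩
    [ k + 1 ]q                  ≈⟨ [+]q k 1 ⟩
    [ k ]q ⊕ q ^ k ⊗ [ 1 ]q     ≈⟨ +-congˡ (trans (*-congˡ [1]q) (*-identityʳ _)) ⟩
    [ k ]q ⊕ q ^ k              ∎

  q^-⊖ : ∀ m n → q^ (m ℤ.⊖ n) ≈ q ^ m ⊗ q⁻¹ ^ n
  q^-⊖ m       zero    = trans (q^-nonneg m) (sym (*-identityʳ _))
  q^-⊖ zero    (suc n) = trans (q^-neg n) (sym (*-identityˡ _))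
  q^-⊖ (suc m) (suc n) = begin
    q^ (suc m ℤ.⊖ suc n)             ≡⟨ ≡.cong q^_ ([1+m]⊖[1+n]≡m⊖n m n) ⟩
    q^ (m ℤ.⊖ n)                     ≈⟨ q^-⊖ m n ⟩
    q ^ m ⊗ q⁻¹ ^ n                  ≈⟨ *-identityˡ _ ⟨
    1# ⊗ (q ^ m ⊗ q⁻¹ ^ n)           ≈⟨ *-congʳ q*q⁻¹≈1 ⟨
    (q ⊗ q⁻¹) ⊗ (q ^ m ⊗ q⁻¹ ^ n)    ≈⟨ solve 4 (λ a b c d → (a :* b) :* (c :* d) := (a :* c) :* (b :* d)) refl q q⁻¹ (q ^ m) (q⁻¹ ^ n) ⟩
    q ^ suc m ⊗ q⁻¹ ^ suc n          ∎

  q^-cancelˡ : ∀ n {x y} → q ^ n ⊗ x ≈ q ^ n ⊗ y → x ≈ y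
  q^-cancelˡ n {x} {y} e = begin
    x                            ≈⟨ *-identityˡ x ⟨
    1# ⊗ x                       ≈⟨ *-congʳ (q⁻¹^*q^ n) ⟨
    (q⁻¹ ^ n ⊗ q ^ n) ⊗ x        ≈⟨ *-assoc _ _ _ ⟩
    q⁻¹ ^ n ⊗ (q ^ n ⊗ x)        ≈⟨ *-congˡ e ⟩
    q⁻¹ ^ n ⊗ (q ^ n ⊗ y)        ≈⟨ *-assoc _ _ _ ⟨
    (q⁻¹ ^ n ⊗ q ^ n) ⊗ y        ≈⟨ *-congʳ (q⁻¹^*q^ n) ⟩
    1# ⊗ y                       ≈⟨ *-identityˡ y ⟩
    y                            ∎

  -- Generating functions of permutation tableaux

  χ : Bool → Carrier
  χ true  = 1#
  χ false = 0#

  χ-∧ : ∀ a b → χ (a ∧ b) ≈ χ a ⊗ χ b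
  χ-∧ true  b = sym (*-identityˡ _)
  χ-∧ false b = sym (zeroˡ _)

  ∑-bits : ∀ h (f : Vec Bool (suc h) → Carrier) → ∑[ bits (suc h) ] f ≈ ∑[ bits h ] (λ v → f (false ∷ v)) ⊕ ∑[ bits h ] (λ v → f (true ∷ v))
  ∑-bits h f = trans (∑-cartesianProductWith _∷_ (false ∷ true ∷ []) (bits h) f) (+-congˡ (+-identityʳ _))

  module _ (x : Carrier) where

    -- The contribution of a column v placed to the left of a tableau with free rows f: q for each 1
    -- and x for each row still free. The flag s tells whether a 1 lies below v.
    columnTerm : ∀ {h} → Bool → (ℕ → Bool) → Vec Bool h → Carrier
    columnTerm {h} s f v = χ ((s ∨ hasOne v) ∧ fits v f) ⊗ (q ^ Vec.count T? v ⊗ x ^ countBelow h (λ r → f r ∧ not (blocked s v r)))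

    columnSum : Bool → ℕ → (ℕ → Bool) → Carrier
    columnSum s h f = ∑[ bits h ] (columnTerm s f)

    -- A 1 requires a free row, keeps it free, and exposes all rows above it to blocking.
    columnTerm-true : ∀ {h} s f (v : Vec Bool h) → columnTerm s f (true ∷ v) ≈ (χ (f 0) ⊗ (q ⊗ x)) ⊗ columnTerm true (f ∘ suc) v
    columnTerm-true {h} true f v with f 0
    ... | true  = solve 5 (λ a q x b c → a :* ((q :* b) :* (x :* c)) := (con 1 :* (q :* x)) :* (a :* (b :* c))) refl
                    (χ (fits v (f ∘ suc))) q x (q ^ Vec.count T? v) (x ^ countBelow h (λ r → f (suc r) ∧ not (blocked true v r)))
    ... | false = solve 4 (λ y q x z → con 0 :* y := (con 0 :* (q :* x)) :* z) refl _ q x _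
    columnTerm-true {h} false f v with f 0
    ... | true  = solve 5 (λ a q x b c → a :* ((q :* b) :* (x :* c)) := (con 1 :* (q :* x)) :* (a :* (b :* c))) refl
                    (χ (fits v (f ∘ suc))) q x (q ^ Vec.count T? v) (x ^ countBelow h (λ r → f (suc r) ∧ not (blocked true v r)))
    ... | false = solve 4 (λ y q x z → con 0 :* y := (con 0 :* (q :* x)) :* z) refl _ q x _

    -- Above a 1, a 0 closes the row, so no x remains whether or not the row was free.
    columnTerm-seen-false : ∀ {h} f (v : Vec Bool h) → columnTerm true f (false ∷ v) ≈ columnTerm true (f ∘ suc) v
    columnTerm-seen-false f v with f 0
    ... | true  = refl
    ... | false = refl

    columnTerm-unseen-false : ∀ {h} f (v : Vec Bool h) → columnTerm false f (false ∷ v) ≈ x ^ (if f 0 then 1 else 0) ⊗ columnTerm false (f ∘ suc) v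
    columnTerm-unseen-false {h} f v with f 0
    ... | true  = solve 4 (λ a b x c → a :* (b :* (x :* c)) := (x :* con 1) :* (a :* (b :* c))) refl
                    (χ (hasOne v ∧ fits v (f ∘ suc))) (q ^ Vec.count T? v) x (x ^ countBelow h (λ r → f (suc r) ∧ not (blocked false v r)))
    ... | false = sym (*-identityˡ _)

    columnSum-step : ∀ h f s {k} → (∀ v → columnTerm s f (false ∷ v) ≈ k ⊗ columnTerm s (f ∘ suc) v) →
      columnSum s (suc h) f ≈ k ⊗ columnSum s h (f ∘ suc) ⊕ (χ (f 0) ⊗ (q ⊗ x)) ⊗ columnSum true h (f ∘ suc)
    columnSum-step h f s {k} e = trans (∑-bits h (columnTerm s f)) (+-cong
      (trans (∑-cong (bits h) e) (∑-⊗ˡ (bits h) k _))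
      (trans (∑-cong (bits h) (columnTerm-true s f)) (∑-⊗ˡ (bits h) _ _)))

    -- Rows above a 1 are independent: a free one offers 0 or 1, with total 1 + q x, and any other
    -- must hold 0.
    columnSum-seen : ∀ h f → columnSum true h f ≈ (1# ⊕ q ⊗ x) ^ countBelow h f
    columnSum-seen zero    f = solve 0 (con 1 :* (con 1 :* con 1) :+ con 0 := con 1) refl
    columnSum-seen (suc h) f = trans (columnSum-step h f true (λ v → trans (columnTerm-seen-false f v) (sym (*-identityˡ _))))
      (trans (+-cong (*-congˡ (columnSum-seen h (f ∘ suc))) (*-congˡ (columnSum-seen h (f ∘ suc)))) (step (f 0)))
      where
      Y = (1# ⊕ q ⊗ x) ^ countBelow h (f ∘ suc)
      step : ∀ b → 1# ⊗ Y ⊕ (χ b ⊗ (q ⊗ x)) ⊗ Y ≈ (1# ⊕ q ⊗ x) ^ ((if b then 1 else 0) + countBelow h (f ∘ suc))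
      step true  = solve 3 (λ q x y → con 1 :* y :+ (con 1 :* (q :* x)) :* y := (con 1 :+ q :* x) :* y) refl q x Y
      step false = solve 3 (λ q x y → con 1 :* y :+ (con 0 :* (q :* x)) :* y := y) refl q x Y

    -- Up to the factor q this is C x^u = x ((1 + q x)^u - x^u) / (1 + (q - 1) x);
    -- p stands for the denominator.
    columnSum-unseen : ∀ {p} → 1# ⊕ q ⊗ x ≈ x ⊕ p → ∀ h f →
      p ⊗ columnSum false h f ⊕ (q ⊗ x) ⊗ x ^ countBelow h f ≈ (q ⊗ x) ⊗ (1# ⊕ q ⊗ x) ^ countBelow h f
    columnSum-unseen {p} e zero    f = solve 3 (λ p q x → p :* (con 0 :* (con 1 :* con 1) :+ con 0) :+ (q :* x) :* con 1 := (q :* x) :* con 1) refl p q x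
    columnSum-unseen {p} e (suc h) f = trans (+-congʳ (*-congˡ
      (trans (columnSum-step h f false (columnTerm-unseen-false f)) (+-congˡ (*-congˡ (columnSum-seen h (f ∘ suc))))))) (step (f 0))
      where
      u = countBelow h (f ∘ suc)
      C = columnSum false h (f ∘ suc)
      Y = (1# ⊕ q ⊗ x) ^ u
      ih : p ⊗ C ⊕ (q ⊗ x) ⊗ x ^ u ≈ (q ⊗ x) ⊗ Y
      ih = columnSum-unseen e h (f ∘ suc)
      step : ∀ b → p ⊗ (x ^ (if b then 1 else 0) ⊗ C ⊕ (χ b ⊗ (q ⊗ x)) ⊗ Y) ⊕ (q ⊗ x) ⊗ x ^ ((if b then 1 else 0) + u) ≈ (q ⊗ x) ⊗ (1# ⊕ q ⊗ x) ^ ((if b then 1 else 0) + u)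
      -- In a free bottom row, a 0 multiplies the remaining sum by x, and a 1 passes to the sum
      -- already known from `columnSum-seen`.
      step true = begin
        p ⊗ ((x ⊗ 1#) ⊗ C ⊕ (1# ⊗ (q ⊗ x)) ⊗ Y) ⊕ (q ⊗ x) ⊗ (x ⊗ x ^ u)
          ≈⟨ solve 6 (λ p x C q Y X → p :* ((x :* con 1) :* C :+ (con 1 :* (q :* x)) :* Y) :+ (q :* x) :* (x :* X) := x :* (p :* C :+ (q :* x) :* X) :+ p :* ((q :* x) :* Y)) refl p x C q Y (x ^ u) ⟩
        x ⊗ (p ⊗ C ⊕ (q ⊗ x) ⊗ x ^ u) ⊕ p ⊗ ((q ⊗ x) ⊗ Y)
          ≈⟨ +-congʳ (*-congˡ ih) ⟩
        x ⊗ ((q ⊗ x) ⊗ Y) ⊕ p ⊗ ((q ⊗ x) ⊗ Y)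
          ≈⟨ solve 4 (λ x q Y p → x :* ((q :* x) :* Y) :+ p :* ((q :* x) :* Y) := (q :* x) :* ((x :+ p) :* Y)) refl x q Y p ⟩
        (q ⊗ x) ⊗ ((x ⊕ p) ⊗ Y)
          ≈⟨ *-congˡ (*-congʳ e) ⟨
        (q ⊗ x) ⊗ ((1# ⊕ q ⊗ x) ⊗ Y) ∎
      step false = trans (solve 6 (λ p C q x Y X → p :* (con 1 :* C :+ (con 0 :* (q :* x)) :* Y) :+ (q :* x) :* X := p :* C :+ (q :* x) :* X) refl p C q x Y (x ^ u)) ih

  tableauTerm : ∀ {hs} → ℕ → Carrier → Filling hs → Carrier
  tableauTerm {hs} h x T = χ (valid T) ⊗ (q ^ ones T ⊗ q⁻¹ ^ length hs) ⊗ x ^ countBelow h (free T)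

  -- The rank generating function, in which in addition each free row counts x.
  tableauSum : List ℕ → ℕ → Carrier → Carrier
  tableauSum hs h x = ∑[ fillings hs ] (tableauTerm h x)

  -- The new top row meets no column, so it has no box and is free in every filling.
  tableauSum-row : ∀ hs h x → All (_≤ h) hs → tableauSum hs (suc h) x ≈ x ⊗ tableauSum hs h x
  tableauSum-row hs h x hs≤h = trans (∑-cong (fillings hs) step) (∑-⊗ˡ (fillings hs) x _)
    where
    step : ∀ T → tableauTerm (suc h) x T ≈ x ⊗ tableauTerm h x T
    step T = trans (*-congˡ (reflexive (≡.cong (x ^_) (countBelow-top h (free T) (free-above T hs≤h)))))
      (solve 3 (λ a x b → a :* (x :* b) := x :* (a :* b)) refl _ x _)

  -- The new column has the full height h, so `columnSum` runs over the same rows as the exponent of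
  -- x.
  tableauSum-column : ∀ h hs x → tableauSum (h ∷ hs) h x ≈
    ∑[ fillings hs ] (λ T → (χ (valid T) ⊗ (q ^ ones T ⊗ q⁻¹ ^ length hs)) ⊗ (q⁻¹ ⊗ columnSum x false h (free T)))
  tableauSum-column h hs x = begin
    tableauSum (h ∷ hs) h x                                                      ≈⟨ ∑-cartesianProductWith _∷_ (bits h) (fillings hs) _ ⟩
    ∑[ bits h ] (λ v → ∑[ fillings hs ] (λ T → tableauTerm h x (v ∷ T)))         ≈⟨ ∑-swap (bits h) (fillings hs) _ ⟩
    ∑[ fillings hs ] (λ T → ∑[ bits h ] (λ v → tableauTerm h x (v ∷ T)))         ≈⟨ ∑-cong (fillings hs) column ⟩
    ∑[ fillings hs ] (λ T → (χ (valid T) ⊗ (q ^ ones T ⊗ q⁻¹ ^ length hs)) ⊗ (q⁻¹ ⊗ columnSum x false h (free T))) ∎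
    where
    column : ∀ T → ∑[ bits h ] (λ v → tableauTerm h x (v ∷ T)) ≈ (χ (valid T) ⊗ (q ^ ones T ⊗ q⁻¹ ^ length hs)) ⊗ (q⁻¹ ⊗ columnSum x false h (free T))
    column T = begin
      ∑[ bits h ] (λ v → tableauTerm h x (v ∷ T))                   ≈⟨ ∑-cong (bits h) factor ⟩
      ∑[ bits h ] (λ v → k ⊗ (q⁻¹ ⊗ columnTerm x false (free T) v)) ≈⟨ ∑-⊗ˡ (bits h) k _ ⟩
      k ⊗ ∑[ bits h ] (λ v → q⁻¹ ⊗ columnTerm x false (free T) v)   ≈⟨ *-congˡ (∑-⊗ˡ (bits h) q⁻¹ _) ⟩
      k ⊗ (q⁻¹ ⊗ columnSum x false h (free T))                      ∎
      where
      k = χ (valid T) ⊗ (q ^ ones T ⊗ q⁻¹ ^ length hs)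
      factor : ∀ v → tableauTerm h x (v ∷ T) ≈ k ⊗ (q⁻¹ ⊗ columnTerm x false (free T) v)
      factor v = begin
        χ (valid T ∧ (hasOne v ∧ fits v (free T))) ⊗ (q ^ (Vec.count T? v + ones T) ⊗ (q⁻¹ ⊗ q⁻¹ ^ length hs)) ⊗ X
          ≈⟨ *-congʳ (*-cong (χ-∧ (valid T) _) (*-congʳ (^-homo-* q (Vec.count T? v) (ones T)))) ⟩
        (χ (valid T) ⊗ χ (hasOne v ∧ fits v (free T))) ⊗ ((q ^ Vec.count T? v ⊗ q ^ ones T) ⊗ (q⁻¹ ⊗ q⁻¹ ^ length hs)) ⊗ X
          ≈⟨ solve 7 (λ a b c d e f X → (a :* b) :* ((c :* d) :* (e :* f)) :* X := (a :* (d :* f)) :* (e :* (b :* (c :* X)))) refl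
               (χ (valid T)) (χ (hasOne v ∧ fits v (free T))) (q ^ Vec.count T? v) (q ^ ones T) q⁻¹ (q⁻¹ ^ length hs) X ⟩
        k ⊗ (q⁻¹ ⊗ columnTerm x false (free T) v) ∎
        where X = x ^ countBelow h (free (v ∷ T))

  tableauSum-bump : ∀ h hs k → q ^ k ⊗ tableauSum (h ∷ hs) h [ k ]q ⊕ [ k ]q ⊗ tableauSum hs h [ k ]q ≈ [ k ]q ⊗ tableauSum hs h [ suc k ]q
  tableauSum-bump h hs k = begin
    q ^ k ⊗ tableauSum (h ∷ hs) h x ⊕ x ⊗ tableauSum hs h x
      ≈⟨ +-congʳ (*-congˡ (tableauSum-column h hs x)) ⟩
    q ^ k ⊗ ∑[ fillings hs ] (λ T → w T ⊗ (q⁻¹ ⊗ columnSum x false h (free T))) ⊕ x ⊗ tableauSum hs h x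
      ≈⟨ +-cong (∑-⊗ˡ (fillings hs) _ _) (∑-⊗ˡ (fillings hs) _ _) ⟨
    ∑[ fillings hs ] (λ T → q ^ k ⊗ (w T ⊗ (q⁻¹ ⊗ columnSum x false h (free T)))) ⊕ ∑[ fillings hs ] (λ T → x ⊗ tableauTerm h x T)
      ≈⟨ ∑-⊕ (fillings hs) _ _ ⟨
    ∑[ fillings hs ] (λ T → q ^ k ⊗ (w T ⊗ (q⁻¹ ⊗ columnSum x false h (free T))) ⊕ x ⊗ tableauTerm h x T)
      ≈⟨ ∑-cong (fillings hs) step ⟩
    ∑[ fillings hs ] (λ T → x ⊗ tableauTerm h [ suc k ]q T)
      ≈⟨ ∑-⊗ˡ (fillings hs) _ _ ⟩
    x ⊗ tableauSum hs h [ suc k ]q ∎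
    where
    x = [ k ]q
    w : Filling hs → Carrier
    w T = χ (valid T) ⊗ (q ^ ones T ⊗ q⁻¹ ^ length hs)
    step : ∀ T → q ^ k ⊗ (w T ⊗ (q⁻¹ ⊗ columnSum x false h (free T))) ⊕ x ⊗ tableauTerm h x T ≈ x ⊗ tableauTerm h [ suc k ]q T
    step T = begin
      q ^ k ⊗ (w T ⊗ (q⁻¹ ⊗ C)) ⊕ x ⊗ (w T ⊗ x ^ u)
        ≈⟨ +-congˡ (*-identityˡ _) ⟨
      q ^ k ⊗ (w T ⊗ (q⁻¹ ⊗ C)) ⊕ 1# ⊗ (x ⊗ (w T ⊗ x ^ u))
        -- The q⁻¹ that the rank assigns to the new column is missing in the second term; writing 1
        -- as q q⁻¹ supplies it along with the q needed next.
        ≈⟨ +-congˡ (*-congʳ q*q⁻¹≈1) ⟨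
      q ^ k ⊗ (w T ⊗ (q⁻¹ ⊗ C)) ⊕ (q ⊗ q⁻¹) ⊗ (x ⊗ (w T ⊗ x ^ u))
        ≈⟨ solve 7 (λ p w r C q x X → p :* (w :* (r :* C)) :+ (q :* r) :* (x :* (w :* X)) := (w :* r) :* (p :* C :+ (q :* x) :* X)) refl (q ^ k) (w T) q⁻¹ C q x (x ^ u) ⟩
      (w T ⊗ q⁻¹) ⊗ (q ^ k ⊗ C ⊕ (q ⊗ x) ⊗ x ^ u)
        ≈⟨ *-congˡ (columnSum-unseen x (trans (sym ([suc]q k)) ([suc]q′ k)) h (free T)) ⟩
      (w T ⊗ q⁻¹) ⊗ ((q ⊗ x) ⊗ (1# ⊕ q ⊗ x) ^ u)
        ≈⟨ *-congˡ (*-congˡ (^-congˡ u ([suc]q k))) ⟨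
      (w T ⊗ q⁻¹) ⊗ ((q ⊗ x) ⊗ [ suc k ]q ^ u)
        ≈⟨ solve 5 (λ w r q x Y → (w :* r) :* ((q :* x) :* Y) := (q :* r) :* (x :* (w :* Y))) refl (w T) q⁻¹ q x ([ suc k ]q ^ u) ⟩
      (q ⊗ q⁻¹) ⊗ (x ⊗ (w T ⊗ [ suc k ]q ^ u))
        ≈⟨ trans (*-congʳ q*q⁻¹≈1) (*-identityˡ _) ⟩
      x ⊗ (w T ⊗ [ suc k ]q ^ u) ∎
      where
      u = countBelow h (free T)
      C = columnSum x false h (free T)

  PT : Composition → ℕ → Carrier
  PT I k = tableauSum (columnLengths I) (ℓ I) [ k ]q

  PT-one : ∀ I k → PT (one∷ I) k ≈ [ k ]q ⊗ PT I k
  PT-one (comp I _) k = tableauSum-row (columns I) (length I) [ k ]q (columns-≤ I)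

  -- Raising the first part adds one column of full height at the left. The first part has to be a
  -- successor, since `pred` would swallow a step from 0 to 1.
  PT-bump : ∀ i I .(pos : All (0 <_) (i ∷ I)) k → let I₀ = comp (i ∷ I) pos in
    q ^ k ⊗ PT (bump I₀) k ⊕ [ k ]q ⊗ PT I₀ k ≈ [ k ]q ⊗ PT I₀ (suc k)
  PT-bump zero    I pos k = 0∷-impossible pos
  PT-bump (suc i) I pos k = tableauSum-bump (length (suc i ∷ I)) (columns (suc i ∷ I)) k

  PTA : Composition → Carrier
  PTA I = ∑[ permutationTableaux I ] (λ T → q^ (rank T))

  ^-one : ∀ {x} n → x ≈ 1# → x ^ n ≈ 1#
  ^-one zero    e = refl
  ^-one (suc n) e = trans (*-cong e (^-one n e)) (*-identityˡ 1#)

  -- At k = 1 a free row is marked by [1] = 1, so the refinement by free rows disappears.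
  PTA≈PT : ∀ I → PTA I ≈ PT I 1
  PTA≈PT I = trans (∑-filter (isPermutationTableau? I) (fillings (columnLengths I)) _) (∑-cong (fillings (columnLengths I)) step)
    where
    step : ∀ T → ⟦ isPermutationTableau? I T ⟧ ⊗ q^ (rank T) ≈ tableauTerm (ℓ I) [ 1 ]q T
    step T = trans (*-cong indicator (trans (reflexive (≡.cong q^_ (m-n≡m⊖n (ones T) (length (columnLengths I))))) (q^-⊖ (ones T) (length (columnLengths I)))))
      (sym (trans (*-congˡ (^-one (countBelow (ℓ I) (free T)) [1]q)) (*-identityʳ _)))
      where
      χ-⟦⟧ : ∀ b → (valid T ≡ b) → ⟦ isPermutationTableau? I T ⟧ ≈ χ b
      χ-⟦⟧ true  e = ⟦⟧-true (isPermutationTableau? I T) (valid⁻ T (columns-≤ (parts I)) e)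
      χ-⟦⟧ false e = ⟦⟧-false (isPermutationTableau? I T) λ t → contradiction (≡.trans (≡.sym e) (valid⁺ T (columns-≤ (parts I)) t)) λ ()
      indicator : ⟦ isPermutationTableau? I T ⟧ ≈ χ (valid T)
      indicator = χ-⟦⟧ (valid T) ≡.refl

  -- Diagonalization of the column operator

  -- The value of F_m at x = [k].
  rising : ℕ → ℕ → Carrier
  rising zero    k = 1#
  rising (suc m) k = [ m + k ]q ⊗ rising m k

  -- Both sides are the product of [k + i] over i ≤ m.
  rising-shift : ∀ m k → [ k ]q ⊗ rising m (suc k) ≈ [ m + k ]q ⊗ rising m k
  rising-shift zero    k = refl
  rising-shift (suc m) k = begin
    [ k ]q ⊗ ([ m + suc k ]q ⊗ rising m (suc k))      ≈⟨ solve 3 (λ a b c → a :* (b :* c) := b :* (a :* c)) refl [ k ]q [ m + suc k ]q (rising m (suc k)) ⟩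
    [ m + suc k ]q ⊗ ([ k ]q ⊗ rising m (suc k))      ≈⟨ *-cong (reflexive (≡.cong [_]q (+-suc m k))) (rising-shift m k) ⟩
    [ suc (m + k) ]q ⊗ rising (suc m) k               ∎

  -- This is the relation of `PT-bump` with the column operator replaced by the scalar [m]; it rests
  -- on [k] + q^k [m] = [k + m].
  rising-eigen : ∀ m k → q ^ k ⊗ ([ m ]q ⊗ rising m k) ⊕ [ k ]q ⊗ rising m k ≈ [ k ]q ⊗ rising m (suc k)
  rising-eigen m k = begin
    q ^ k ⊗ ([ m ]q ⊗ rising m k) ⊕ [ k ]q ⊗ rising m k   ≈⟨ solve 4 (λ p m f k → p :* (m :* f) :+ k :* f := (k :+ p :* m) :* f) refl (q ^ k) [ m ]q (rising m k) [ k ]q ⟩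
    ([ k ]q ⊕ q ^ k ⊗ [ m ]q) ⊗ rising m k                ≈⟨ *-congʳ ([+]q k m) ⟨
    [ k + m ]q ⊗ rising m k                               ≡⟨ ≡.cong (λ n → [ n ]q ⊗ rising m k) (+-comm k m) ⟩
    [ m + k ]q ⊗ rising m k                               ≈⟨ rising-shift m k ⟨
    [ k ]q ⊗ rising m (suc k)                             ∎

  PTtransform : Composition → ℕ → Carrier
  PTtransform I k = transform (λ J → PT J k) I

  module _ i I .(pos : All (0 <_) (i ∷ I)) where
    private
      I₀ = comp (i ∷ I) pos
      m  = ℓ I₀

    -- The coefficients in `PT-bump` do not depend on the composition, and the transform commutes
    -- with `bump`, so the relation survives summation.
    PTtransform-bump : ∀ k → q ^ k ⊗ PTtransform (bump I₀) k ⊕ [ k ]q ⊗ PTtransform I₀ k ≈ [ k ]q ⊗ PTtransform I₀ (suc k)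
    PTtransform-bump k = begin
      q ^ k ⊗ PTtransform (bump I₀) k ⊕ [ k ]q ⊗ PTtransform I₀ k
        ≈⟨ +-congʳ (*-congˡ (transform-bump i I pos _)) ⟩
      q ^ k ⊗ transform (λ J → PT (bump J) k) I₀ ⊕ [ k ]q ⊗ PTtransform I₀ k
        ≈⟨ +-cong (∑-⊗ˡ (coarserThan I₀) _ _) (∑-⊗ˡ (coarserThan I₀) _ _) ⟨
      ∑[ coarserThan I₀ ] (λ J → q ^ k ⊗ (q ^ st I₀ J ⊗ PT (bump J) k)) ⊕ ∑[ coarserThan I₀ ] (λ J → [ k ]q ⊗ (q ^ st I₀ J ⊗ PT J k))
        ≈⟨ ∑-⊕ (coarserThan I₀) _ _ ⟨
      ∑[ coarserThan I₀ ] (λ J → q ^ k ⊗ (q ^ st I₀ J ⊗ PT (bump J) k) ⊕ [ k ]q ⊗ (q ^ st I₀ J ⊗ PT J k))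
        ≈⟨ ∑-coarser-cong⁺ i I pos (λ j J p′ _ → step j J p′) ⟩
      ∑[ coarserThan I₀ ] (λ J → [ k ]q ⊗ (q ^ st I₀ J ⊗ PT J (suc k)))
        ≈⟨ ∑-⊗ˡ (coarserThan I₀) _ _ ⟩
      [ k ]q ⊗ PTtransform I₀ (suc k) ∎
      where
      step : ∀ j J .(p′ : All (0 <_) (j ∷ J)) → let J₀ = comp (j ∷ J) p′ in
        q ^ k ⊗ (q ^ st I₀ J₀ ⊗ PT (bump J₀) k) ⊕ [ k ]q ⊗ (q ^ st I₀ J₀ ⊗ PT J₀ k) ≈ [ k ]q ⊗ (q ^ st I₀ J₀ ⊗ PT J₀ (suc k))
      step j J p′ = begin
        q ^ k ⊗ (s ⊗ PT (bump J₀) k) ⊕ [ k ]q ⊗ (s ⊗ PT J₀ k)    ≈⟨ solve 5 (λ p s b k a → p :* (s :* b) :+ k :* (s :* a) := s :* (p :* b :+ k :* a)) refl (q ^ k) s (PT (bump J₀) k) [ k ]q (PT J₀ k) ⟩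
        s ⊗ (q ^ k ⊗ PT (bump J₀) k ⊕ [ k ]q ⊗ PT J₀ k)          ≈⟨ *-congˡ (PT-bump j J p′ k) ⟩
        s ⊗ ([ k ]q ⊗ PT J₀ (suc k))                             ≈⟨ solve 3 (λ s k a → s :* (k :* a) := k :* (s :* a)) refl s [ k ]q (PT J₀ (suc k)) ⟩
        [ k ]q ⊗ (s ⊗ PT J₀ (suc k))                             ∎
        where
        J₀ = comp (j ∷ J) p′
        s  = q ^ st I₀ J₀

    PTtransform-one : ∀ k → PTtransform (one∷ I₀) k ≈ q ^ m ⊗ ([ k ]q ⊗ PTtransform I₀ k) ⊕ PTtransform (bump I₀) k
    PTtransform-one k = trans (transform-one i I pos _) (+-cong (*-congˡ
      (trans (∑-cong (coarserThan I₀) λ J → trans (*-congˡ (PT-one J k)) (solve 3 (λ s k a → s :* (k :* a) := k :* (s :* a)) refl (q ^ st I₀ J) [ k ]q (PT J k)))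
             (∑-⊗ˡ (coarserThan I₀) [ k ]q _))) (sym (transform-bump i I pos _)))

    module _ E (eigen : ∀ k → PTtransform I₀ k ≈ E ⊗ rising m k) where

      -- `PTtransform-bump` involves the hypothesis at k and at `suc k`, which is why `eigen` ranges
      -- over all k. The claimed value satisfies the same relation, and q^k cancels.
      eigen-bump : ∀ k → PTtransform (bump I₀) k ≈ ([ m ]q ⊗ E) ⊗ rising m k
      eigen-bump k = q^-cancelˡ k (+-cancelʳ ([ k ]q ⊗ PTtransform I₀ k) _ _ (begin
        q ^ k ⊗ PTtransform (bump I₀) k ⊕ [ k ]q ⊗ PTtransform I₀ k                  ≈⟨ PTtransform-bump k ⟩
        [ k ]q ⊗ PTtransform I₀ (suc k)                                              ≈⟨ *-congˡ (eigen (suc k)) ⟩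
        [ k ]q ⊗ (E ⊗ rising m (suc k))                                              ≈⟨ solve 3 (λ k e r → k :* (e :* r) := e :* (k :* r)) refl [ k ]q E (rising m (suc k)) ⟩
        E ⊗ ([ k ]q ⊗ rising m (suc k))                                              ≈⟨ *-congˡ (rising-eigen m k) ⟨
        E ⊗ (q ^ k ⊗ ([ m ]q ⊗ rising m k) ⊕ [ k ]q ⊗ rising m k)                    ≈⟨ solve 5 (λ e p m r k → e :* (p :* (m :* r) :+ k :* r) := p :* ((m :* e) :* r) :+ k :* (e :* r)) refl E (q ^ k) [ m ]q (rising m k) [ k ]q ⟩
        q ^ k ⊗ (([ m ]q ⊗ E) ⊗ rising m k) ⊕ [ k ]q ⊗ (E ⊗ rising m k)              ≈⟨ +-congˡ (*-congˡ (eigen k)) ⟨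
        q ^ k ⊗ (([ m ]q ⊗ E) ⊗ rising m k) ⊕ [ k ]q ⊗ PTtransform I₀ k              ∎))

      eigen-one : ∀ k → PTtransform (one∷ I₀) k ≈ E ⊗ rising (suc m) k
      eigen-one k = begin
        PTtransform (one∷ I₀) k                                                      ≈⟨ PTtransform-one k ⟩
        q ^ m ⊗ ([ k ]q ⊗ PTtransform I₀ k) ⊕ PTtransform (bump I₀) k                ≈⟨ +-cong (*-congˡ (*-congˡ (eigen k))) (eigen-bump k) ⟩
        q ^ m ⊗ ([ k ]q ⊗ (E ⊗ rising m k)) ⊕ ([ m ]q ⊗ E) ⊗ rising m k              ≈⟨ solve 5 (λ p k e r m → p :* (k :* (e :* r)) :+ (m :* e) :* r := e :* ((m :+ p :* k) :* r)) refl (q ^ m) [ k ]q E (rising m k) [ m ]q ⟩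
        E ⊗ (([ m ]q ⊕ q ^ m ⊗ [ k ]q) ⊗ rising m k)                                 ≈⟨ *-congˡ (*-congʳ ([+]q m k)) ⟨
        E ⊗ rising (suc m) k                                                         ∎

  qfact-one : ∀ I → qfact (1 ∷ I) ≈ [ suc (length I) ]q ⊗ qfact I
  qfact-one I = trans (qfact-∷ 1 I) (*-congʳ (*-identityʳ _))

  qfact-suc : ∀ i I → qfact (suc i ∷ I) ≈ [ suc (length I) ]q ⊗ qfact (i ∷ I)
  qfact-suc i I = trans (qfact-∷ (suc i) I) (trans (*-assoc _ _ _) (*-congˡ (sym (qfact-∷ i I))))

  -- E gathers a factor [m] for each unit added to the first of m parts, and `rising m 1` = [m] ⋯
  -- [1] accounts for the unit with which each part began. Together a part j with m - 1 parts after
  -- it receives [m]^j.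
  PTtransform-eigen : ∀ {I} → Built I → ∃ λ E → (∀ k → PTtransform I k ≈ E ⊗ rising (ℓ I) k) × E ⊗ rising (ℓ I) 1 ≈ qfact (parts I)
  PTtransform-eigen empty = 1# ,
    (λ k → solve 0 (con 1 :* (con 1 :* (con 1 :* con 1) :* con 1 :+ con 0) :+ con 0 := con 1 :* con 1) refl) ,
    trans (*-identityˡ 1#) (sym qfact-[])
  PTtransform-eigen (prepend {comp [] _} _) = 1# ,
    (λ k → solve 1 (λ x → con 1 :* (con 1 :* (con 1 :* con 1) :* (x :* con 1) :+ con 0) :+ con 0 := con 1 :* (x :* con 1)) refl [ k ]q) ,
    trans (*-identityˡ _) (sym (trans (qfact-one []) (*-congˡ qfact-[])))
  PTtransform-eigen (prepend {comp (i ∷ I) pos} b) with PTtransform-eigen b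
  ... | E , eigen , eq = E , eigen-one i I pos E eigen , (begin
    E ⊗ ([ m + 1 ]q ⊗ rising m 1)             ≡⟨ ≡.cong (λ n → E ⊗ ([ n ]q ⊗ rising m 1)) (+-comm m 1) ⟩
    E ⊗ ([ suc m ]q ⊗ rising m 1)             ≈⟨ solve 3 (λ e m r → e :* (m :* r) := m :* (e :* r)) refl E [ suc m ]q (rising m 1) ⟩
    [ suc m ]q ⊗ (E ⊗ rising m 1)             ≈⟨ *-congˡ eq ⟩
    [ suc m ]q ⊗ qfact (i ∷ I)                ≈⟨ qfact-one (i ∷ I) ⟨
    qfact (1 ∷ i ∷ I)                         ∎)
    where m = suc (length I)
  PTtransform-eigen (grow {i} {I} {pos} b) with PTtransform-eigen b
  ... | E , eigen , eq = [ m ]q ⊗ E , eigen-bump i I pos E eigen , trans (*-assoc _ _ _) (trans (*-congˡ eq) (sym (qfact-suc i I)))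
    where m = suc (length I)

  transform-PTA : ∀ I → transform PTA I ≈ qfact (parts I)
  transform-PTA I = trans (∑-cong (coarserThan I) (λ J → *-congˡ (PTA≈PT J)))
    (let (E , eigen , eq) = PTtransform-eigen (built I) in trans (eigen 1) eq)

  -- From here on the definitions of Algebraic are repeated over R; at K⟨q⟩ they
  -- unfold to the original ones.

  Free : ∀ {a} → Set a → Set (c ⊔ a)
  Free A = List (Carrier × A)

  module _ {a} {A : Set a} where

    η : A → Free A
    η x = (1# , x) ∷ []

    infixr 7 _•_
    _•_ : Carrier → Free A → Free A
    k • x = map (λ (k′ , b) → k ⊗ k′ , b) x

    infixl 6 _⊟_
    _⊟_ : Free A → Free A → Free A
    x ⊟ y = x ++ (- 1#) • y

    linear : ∀ {b} {B : Set b} → (B → Free A) → Free B → Free A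
    linear f = concatMap (λ (k , b) → k • f b)

    coefficient : DecidableEquality A → Free A → A → Carrier
    coefficient _≟_ x b = ∑[ filter (λ (_ , b′) → b′ ≟ b) x ] proj₁

    -- The linear functional with values φ on the basis. It can be computed on a list with repeated
    -- basis elements without collecting terms.
    ⟨_,_⟩ : Free A → (A → Carrier) → Carrier
    ⟨ x , φ ⟩ = ∑[ x ] (λ (k , b) → k ⊗ φ b)

    pair-cong : ∀ (x : Free A) {φ ψ} → (∀ b → φ b ≈ ψ b) → ⟨ x , φ ⟩ ≈ ⟨ x , ψ ⟩
    pair-cong x e = ∑-cong x (λ (k , b) → *-congˡ (e b))

    pair-η : ∀ b φ → ⟨ η b , φ ⟩ ≈ φ b
    pair-η b φ = trans (+-identityʳ _) (*-identityˡ _)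

    pair-• : ∀ k (x : Free A) φ → ⟨ k • x , φ ⟩ ≈ k ⊗ ⟨ x , φ ⟩
    pair-• k x φ = trans (∑-map _ x _) (trans (∑-cong x (λ (k′ , b) → *-assoc k k′ (φ b))) (∑-⊗ˡ x k _))

    pair-⊟ : ∀ (x y : Free A) φ → ⟨ x ⊟ y , φ ⟩ ≈ ⟨ x , φ ⟩ ⊝ ⟨ y , φ ⟩
    pair-⊟ x y φ = trans (∑-++ x ((- 1#) • y) _) (+-congˡ (trans (pair-• (- 1#) y φ) (-1*x≈-x _)))

    coefficient-pair : ∀ (_≟_ : DecidableEquality A) x b → coefficient _≟_ x b ≈ ⟨ x , (λ b′ → ⟦ b′ ≟ b ⟧) ⟩
    coefficient-pair _≟_ x b = trans (∑-filter (λ (_ , b′) → b′ ≟ b) x proj₁) (∑-cong x (λ _ → ⊗-comm _ _))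

    -- Repeated basis elements may cancel only jointly. Spreading the sum over the distinct elements
    -- of the list groups the terms into coefficients.
    pair-null : ∀ (_≟_ : DecidableEquality A) x → (∀ b → coefficient _≟_ x b ≈ 0#) → ∀ φ → ⟨ x , φ ⟩ ≈ 0#
    pair-null _≟_ x null φ = begin
      ∑[ x ] (λ (k , b) → k ⊗ φ b)
        ≈⟨ ∑-cong-∈ x (λ {(k , b)} kb∈ → *-congˡ (∑-δ _≟_ φ (deduplicate-! _≟_ (map proj₂ x)) (∈-deduplicate⁺ _≟_ (∈-map⁺ proj₂ kb∈)))) ⟨
      ∑[ x ] (λ (k , b) → k ⊗ ∑[ support ] (λ s → ⟦ s ≟ b ⟧ ⊗ φ s))
        ≈⟨ ∑-cong x (λ (k , b) → ∑-⊗ˡ support k _) ⟨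
      ∑[ x ] (λ (k , b) → ∑[ support ] (λ s → k ⊗ (⟦ s ≟ b ⟧ ⊗ φ s)))
        ≈⟨ ∑-swap x support _ ⟩
      ∑[ support ] (λ s → ∑[ x ] (λ (k , b) → k ⊗ (⟦ s ≟ b ⟧ ⊗ φ s)))
        ≈⟨ ∑-zero support vanish ⟩
      0# ∎
      where
      support = deduplicate _≟_ (map proj₂ x)
      vanish : ∀ s → ∑[ x ] (λ (k , b) → k ⊗ (⟦ s ≟ b ⟧ ⊗ φ s)) ≈ 0#
      vanish s = begin
        ∑[ x ] (λ (k , b) → k ⊗ (⟦ s ≟ b ⟧ ⊗ φ s))   ≈⟨ ∑-cong x (λ (k , b) → trans (*-congˡ (*-congʳ (⟦⟧-cong (s ≟ b) (b ≟ s) ≡.sym ≡.sym)))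
                                                          (solve 3 (λ k d p → k :* (d :* p) := p :* (k :* d)) refl k ⟦ b ≟ s ⟧ (φ s))) ⟩
        ∑[ x ] (λ (k , b) → φ s ⊗ (k ⊗ ⟦ b ≟ s ⟧))   ≈⟨ ∑-⊗ˡ x (φ s) _ ⟩
        φ s ⊗ ⟨ x , (λ b → ⟦ b ≟ s ⟧) ⟩              ≈⟨ *-congˡ (trans (sym (coefficient-pair _≟_ x s)) (null s)) ⟩
        φ s ⊗ 0#                                     ≈⟨ zeroʳ _ ⟩
        0#                                           ∎

  pair-linear : ∀ {a b} {A : Set a} {B : Set b} (f : B → Free A) x φ → ⟨ linear f x , φ ⟩ ≈ ⟨ x , (λ b → ⟨ f b , φ ⟩) ⟩
  pair-linear f x φ = trans (∑-concatMap _ x _) (∑-cong x (λ (k , b) → pair-• k (f b) φ))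

  -- The quotient Sym

  WQSym : Set c
  WQSym = Free PackedWord

  Relator : Set
  Relator = Σ (PackedWord × PackedWord) λ (u , v) → WC u ≡ WC v

  relator : Relator → WQSym
  relator = λ ((u , v) , _) → η u ⊟ η v

  infix 4 _≈ˢ_
  _≈ˢ_ : WQSym → WQSym → Set (c ⊔ ℓ₁)
  x ≈ˢ y = ∃ λ (r : Free Relator) → ∀ u → coefficient _≟ʷ_ (x ⊟ y) u ≈ coefficient _≟ʷ_ (linear relator r) u

  -- A functional through `WC` takes the same value on both words of a relator and therefore kills
  -- every combination of relators.
  ≈ˢ⇒pair : ∀ {x y} → x ≈ˢ y → ∀ (φ : Composition → Carrier) → ⟨ x , φ ∘ WC ⟩ ≈ ⟨ y , φ ∘ WC ⟩
  ≈ˢ⇒pair {x} {y} (r , e) φ = x-y≈0⇒x≈y _ _ (begin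
    ⟨ x , φ ∘ WC ⟩ ⊝ ⟨ y , φ ∘ WC ⟩                              ≈⟨ pair-⊟ x y (φ ∘ WC) ⟨
    ⟨ x ⊟ y , φ ∘ WC ⟩                                             ≈⟨ x-y≈0⇒x≈y _ _ (trans (sym (pair-⊟ (x ⊟ y) (linear relator r) (φ ∘ WC))) (pair-null _≟ʷ_ ((x ⊟ y) ⊟ linear relator r) null (φ ∘ WC))) ⟩
    ⟨ linear relator r , φ ∘ WC ⟩                                  ≈⟨ pair-linear relator r (φ ∘ WC) ⟩
    ⟨ r , (λ ρ → ⟨ relator ρ , φ ∘ WC ⟩) ⟩                         ≈⟨ ∑-zero r (λ (k , ρ) → trans (*-congˡ (vanish ρ)) (zeroʳ k)) ⟩
    0#                                                             ∎)
    where
    vanish : ∀ ρ → ⟨ relator ρ , φ ∘ WC ⟩ ≈ 0#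
    vanish ((u , v) , e) = begin
      ⟨ η u ⊟ η v , φ ∘ WC ⟩                   ≈⟨ pair-⊟ (η u) (η v) (φ ∘ WC) ⟩
      ⟨ η u , φ ∘ WC ⟩ ⊝ ⟨ η v , φ ∘ WC ⟩    ≈⟨ +-cong (pair-η u (φ ∘ WC)) (-‿cong (pair-η v (φ ∘ WC))) ⟩
      φ (WC u) ⊝ φ (WC v)                    ≈⟨ x≈y⇒x-y≈0 (reflexive (≡.cong φ e)) ⟩
      0#                                       ∎

    null : ∀ u → coefficient _≟ʷ_ ((x ⊟ y) ⊟ linear relator r) u ≈ 0#
    null u = begin
      coefficient _≟ʷ_ ((x ⊟ y) ⊟ linear relator r) u                    ≈⟨ coefficient-pair _≟ʷ_ ((x ⊟ y) ⊟ linear relator r) u ⟩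
      ⟨ (x ⊟ y) ⊟ linear relator r , (λ u′ → ⟦ u′ ≟ʷ u ⟧) ⟩              ≈⟨ pair-⊟ (x ⊟ y) (linear relator r) _ ⟩
      ⟨ x ⊟ y , (λ u′ → ⟦ u′ ≟ʷ u ⟧) ⟩ ⊝ ⟨ linear relator r , (λ u′ → ⟦ u′ ≟ʷ u ⟧) ⟩
        ≈⟨ x≈y⇒x-y≈0 (trans (sym (coefficient-pair _≟ʷ_ (x ⊟ y) u)) (trans (e u) (coefficient-pair _≟ʷ_ (linear relator r) u))) ⟩
      0#                                                                 ∎

  -- Each word u in `x ⊟ y` is moved to the representative `blockWord (WC u)` by one relator, with
  -- its own coefficient. What accumulates at the representatives is zero, by the hypothesis for the
  -- functionals `δ v ∘ blockWord`.
  pair⇒≈ˢ : ∀ {x y} → (∀ (φ : Composition → Carrier) → ⟨ x , φ ∘ WC ⟩ ≈ ⟨ y , φ ∘ WC ⟩) → x ≈ˢ y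
  pair⇒≈ˢ {x} {y} e = map (λ (k , u) → k , collapse u) (x ⊟ y) , λ v → begin
    coefficient _≟ʷ_ (x ⊟ y) v
      ≈⟨ coefficient-pair _≟ʷ_ (x ⊟ y) v ⟩
    ⟨ x ⊟ y , δ v ⟩
      ≈⟨ trans (+-congˡ -0#≈0#) (+-identityʳ _) ⟨
    ⟨ x ⊟ y , δ v ⟩ ⊝ 0#
      ≈⟨ +-congˡ (-‿cong (trans (pair-⊟ x y _) (x≈y⇒x-y≈0 (e (δ v ∘ blockWord))))) ⟨
    ⟨ x ⊟ y , δ v ⟩ ⊝ ⟨ x ⊟ y , (δ v ∘ blockWord) ∘ WC ⟩
      ≈⟨ +-congˡ (trans (sym (-1*x≈-x _)) (sym (∑-⊗ˡ (x ⊟ y) (- 1#) _))) ⟩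
    ⟨ x ⊟ y , δ v ⟩ ⊕ ∑[ x ⊟ y ] (λ (k , u) → (- 1#) ⊗ (k ⊗ δ v (blockWord (WC u))))
      ≈⟨ ∑-⊕ (x ⊟ y) _ _ ⟨
    ∑[ x ⊟ y ] (λ (k , u) → k ⊗ δ v u ⊕ (- 1#) ⊗ (k ⊗ δ v (blockWord (WC u))))
      ≈⟨ ∑-cong (x ⊟ y) (λ (k , u) → step v k u) ⟩
    ∑[ x ⊟ y ] (λ (k , u) → k ⊗ ⟨ relator (collapse u) , δ v ⟩)
      ≈⟨ ∑-map (λ (k , u) → k , collapse u) (x ⊟ y) _ ⟨
    ⟨ map (λ (k , u) → k , collapse u) (x ⊟ y) , (λ ρ → ⟨ relator ρ , δ v ⟩) ⟩
      ≈⟨ pair-linear relator (map (λ (k , u) → k , collapse u) (x ⊟ y)) (δ v) ⟨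
    ⟨ linear relator (map (λ (k , u) → k , collapse u) (x ⊟ y)) , δ v ⟩
      ≈⟨ coefficient-pair _≟ʷ_ (linear relator (map (λ (k , u) → k , collapse u) (x ⊟ y))) v ⟨
    coefficient _≟ʷ_ (linear relator (map (λ (k , u) → k , collapse u) (x ⊟ y))) v ∎
    where
    collapse : PackedWord → Relator
    collapse u = (u , blockWord (WC u)) , ≡.sym (WC-blockWord (WC u))

    δ : PackedWord → PackedWord → Carrier
    δ v u = ⟦ u ≟ʷ v ⟧

    step : ∀ v k u → k ⊗ δ v u ⊕ (- 1#) ⊗ (k ⊗ δ v (blockWord (WC u))) ≈ k ⊗ ⟨ relator (collapse u) , δ v ⟩
    step v k u = begin
      k ⊗ δ v u ⊕ (- 1#) ⊗ (k ⊗ δ v b)       ≈⟨ solve 4 (λ k a n d → k :* a :+ n :* (k :* d) := k :* (a :+ n :* d)) refl k (δ v u) (- 1#) (δ v b) ⟩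
      k ⊗ (δ v u ⊕ (- 1#) ⊗ δ v b)           ≈⟨ *-congˡ (+-cong (pair-η u (δ v)) (*-congˡ (pair-η b (δ v)))) ⟨
      k ⊗ (⟨ η u , δ v ⟩ ⊕ (- 1#) ⊗ ⟨ η b , δ v ⟩)  ≈⟨ *-congˡ (+-congˡ (-1*x≈-x _)) ⟩
      k ⊗ (⟨ η u , δ v ⟩ ⊝ ⟨ η b , δ v ⟩)  ≈⟨ *-congˡ (pair-⊟ (η u) (η b) (δ v)) ⟨
      k ⊗ ⟨ η u ⊟ η b , δ v ⟩                ∎
      where b = blockWord (WC u)

  -- Sums over all compositions

  ∑-compositions-suc : ∀ n f → ∑[ compositions (suc n) ] f ≈ ∑[ compositions n ] (λ J → ∑[ extend J ] f)
  ∑-compositions-suc n f = ∑-concatMap extend (compositions n) f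

  -- In summed form: the enumeration contains each composition of n exactly once and no other
  -- composition.
  ∑-compositions-δ : ∀ {I} → Built I → ∀ n (g : Composition → Carrier) → ∑[ compositions n ] (λ J → ⟦ J ≟ᶜ I ⟧ ⊗ g J) ≈ ⟦ size I ≟ n ⟧ ⊗ g I
  ∑-compositions-δ empty zero g = +-identityʳ _
  ∑-compositions-δ empty (suc n) g = trans (∑-compositions-suc n _) (trans (∑-zero (compositions n) step) (sym (zeroˡ _)))
    where
    step : ∀ J → ∑[ extend J ] (λ J⁺ → ⟦ J⁺ ≟ᶜ comp [] [] ⟧ ⊗ g J⁺) ≈ 0#
    step (comp [] p)      = solve 1 (λ x → con 0 :* x :+ con 0 := con 0) refl (g (comp (1 ∷ []) (z<s ∷ [])))
    step (comp (j ∷ J) p) = solve 2 (λ x y → con 0 :* x :+ (con 0 :* y :+ con 0) := con 0) refl (g (one∷ comp (j ∷ J) p)) (g (bump (comp (j ∷ J) p)))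
  ∑-compositions-δ (prepend {I} _) zero g =
    solve 2 (λ x y → con 0 :* x :+ con 0 := con 0 :* y) refl (g (comp [] [])) (g (one∷ I))
  ∑-compositions-δ (grow {i} {I} {pos} _) zero g =
    solve 2 (λ x y → con 0 :* x :+ con 0 := con 0 :* y) refl (g (comp [] [])) (g (bump (comp (i ∷ I) pos)))
  ∑-compositions-δ (prepend {I} b) (suc n) g = begin
    ∑[ compositions (suc n) ] (λ J → ⟦ J ≟ᶜ one∷ I ⟧ ⊗ g J)                       ≈⟨ ∑-compositions-suc n _ ⟩
    ∑[ compositions n ] (λ J → ∑[ extend J ] (λ J⁺ → ⟦ J⁺ ≟ᶜ one∷ I ⟧ ⊗ g J⁺))    ≈⟨ ∑-cong (compositions n) step ⟩
    ∑[ compositions n ] (λ J → ⟦ J ≟ᶜ I ⟧ ⊗ g (one∷ J))                           ≈⟨ ∑-compositions-δ b n (g ∘ one∷_) ⟩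
    ⟦ size I ≟ n ⟧ ⊗ g (one∷ I)                                                   ≈⟨ *-congʳ (⟦⟧-cong (size I ≟ n) (suc (size I) ≟ suc n) (≡.cong suc) suc-injective) ⟩
    ⟦ suc (size I) ≟ suc n ⟧ ⊗ g (one∷ I)                                         ∎
    where
    δ-one : ∀ J → ⟦ one∷ J ≟ᶜ one∷ I ⟧ ≈ ⟦ J ≟ᶜ I ⟧
    δ-one J = ⟦⟧-cong (one∷ J ≟ᶜ one∷ I) (J ≟ᶜ I) (one∷-injective J I) (≡.cong one∷_)

    step : ∀ J → ∑[ extend J ] (λ J⁺ → ⟦ J⁺ ≟ᶜ one∷ I ⟧ ⊗ g J⁺) ≈ ⟦ J ≟ᶜ I ⟧ ⊗ g (one∷ J)
    step (comp [] p) = trans (+-identityʳ _) (*-congʳ (δ-one (comp [] p)))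
    step J@(comp (j ∷ J′) p) = trans
      (+-cong (*-congʳ (δ-one J)) (+-congʳ (*-congʳ (⟦⟧-false (bump J ≟ᶜ one∷ I) (λ e → one≢bump I j J′ p (≡.sym e))))))
      (solve 3 (λ d x y → d :* x :+ (con 0 :* y :+ con 0) := d :* x) refl ⟦ J ≟ᶜ I ⟧ (g (one∷ J)) (g (bump J)))
  ∑-compositions-δ (grow {i} {I} {pos} b) (suc n) g = begin
    ∑[ compositions (suc n) ] (λ J → ⟦ J ≟ᶜ bump I₀ ⟧ ⊗ g J)                      ≈⟨ ∑-compositions-suc n _ ⟩
    ∑[ compositions n ] (λ J → ∑[ extend J ] (λ J⁺ → ⟦ J⁺ ≟ᶜ bump I₀ ⟧ ⊗ g J⁺))   ≈⟨ ∑-cong (compositions n) step ⟩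
    ∑[ compositions n ] (λ J → ⟦ J ≟ᶜ I₀ ⟧ ⊗ g (bump J))                          ≈⟨ ∑-compositions-δ b n (g ∘ bump) ⟩
    ⟦ size I₀ ≟ n ⟧ ⊗ g (bump I₀)                                                 ≈⟨ *-congʳ (⟦⟧-cong (size I₀ ≟ n) (suc (size I₀) ≟ suc n) (≡.cong suc) suc-injective) ⟩
    ⟦ suc (size I₀) ≟ suc n ⟧ ⊗ g (bump I₀)                                       ∎
    where
    I₀ = comp (i ∷ I) pos

    step : ∀ J → ∑[ extend J ] (λ J⁺ → ⟦ J⁺ ≟ᶜ bump I₀ ⟧ ⊗ g J⁺) ≈ ⟦ J ≟ᶜ I₀ ⟧ ⊗ g (bump J)
    step (comp [] p) = trans (+-congʳ (*-congʳ (⟦⟧-false (one∷ comp [] p ≟ᶜ bump I₀) (one≢bump (comp [] p) i I pos))))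
      (trans (solve 2 (λ x y → con 0 :* x :+ con 0 := con 0 :* y) refl (g (one∷ comp [] p)) (g (comp [] p)))
             (*-congʳ (sym (⟦⟧-false (comp [] p ≟ᶜ I₀) (λ ())))))
    step J@(comp (j ∷ J′) p) = trans
      (+-cong (*-congʳ (⟦⟧-false (one∷ J ≟ᶜ bump I₀) (one≢bump J i I pos)))
              (+-congʳ (*-congʳ (⟦⟧-cong (bump J ≟ᶜ bump I₀) (J ≟ᶜ I₀) (bump-injective j J′ p i I pos) (≡.cong bump)))))
      (solve 3 (λ d x y → con 0 :* x :+ (d :* y :+ con 0) := d :* y) refl ⟦ J ≟ᶜ I₀ ⟧ (g (one∷ J)) (g (bump J)))

  -- Expansions in the basis L

  Ψ : Composition → WQSym
  Ψ I = η (blockWord I)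

  L : Composition → WQSym
  L J = linear Ψ (map (λ I → q ^ st I J , I) (finerThan J))

  pair-L : ∀ J (φ : Composition → Carrier) → ⟨ L J , φ ∘ WC ⟩ ≈ ∑[ compositions (size J) ] (λ I → ⟦ I ⪯? J ⟧ ⊗ (q ^ st I J ⊗ φ I))
  pair-L J φ = begin
    ⟨ L J , φ ∘ WC ⟩
      ≈⟨ pair-linear Ψ (map (λ I → q ^ st I J , I) (finerThan J)) (φ ∘ WC) ⟩
    ⟨ map (λ I → q ^ st I J , I) (finerThan J) , (λ I → ⟨ Ψ I , φ ∘ WC ⟩) ⟩
      ≈⟨ ∑-map (λ I → q ^ st I J , I) (finerThan J) _ ⟩
    ∑[ finerThan J ] (λ I → q ^ st I J ⊗ ⟨ Ψ I , φ ∘ WC ⟩)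
      ≈⟨ ∑-cong (finerThan J) (λ I → *-congˡ (trans (pair-η (blockWord I) (φ ∘ WC)) (reflexive (≡.cong φ (WC-blockWord I))))) ⟩
    ∑[ finerThan J ] (λ I → q ^ st I J ⊗ φ I)
      ≈⟨ ∑-filter (_⪯? J) (compositions (size J)) _ ⟩
    ∑[ compositions (size J) ] (λ I → ⟦ I ⪯? J ⟧ ⊗ (q ^ st I J ⊗ φ I)) ∎

  coef : Free Composition → Composition → Carrier
  coef e I = coefficient _≟ᶜ_ e I

  -- The right side reads off the coefficient of `Ψ I`. The list `e` may repeat compositions and
  -- contain any sizes: repetitions are collected by `coef`, and foreign sizes are discarded by the
  -- size condition in `⪯`.
  transform-coef : ∀ e I → transform (coef e) I ≈ ⟨ linear L e , (λ I′ → ⟦ I′ ≟ᶜ I ⟧) ∘ WC ⟩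
  transform-coef e I = trans lhs (sym rhs)
    where
    lhs : transform (coef e) I ≈ ⟨ e , (λ J → ⟦ I ⪯? J ⟧ ⊗ q ^ st I J) ⟩
    lhs = begin
      ∑[ coarserThan I ] (λ J → q ^ st I J ⊗ coef e J)
        ≈⟨ ∑-filter (I ⪯?_) (compositions (size I)) _ ⟩
      ∑[ compositions (size I) ] (λ J → ⟦ I ⪯? J ⟧ ⊗ (q ^ st I J ⊗ coef e J))
        ≈⟨ ∑-cong (compositions (size I)) (λ J → trans (sym (*-assoc _ _ _)) (trans (*-congˡ (coefficient-pair _≟ᶜ_ e J)) (sym (∑-⊗ˡ e _ _)))) ⟩
      ∑[ compositions (size I) ] (λ J → ∑[ e ] (λ (k , J′) → (⟦ I ⪯? J ⟧ ⊗ q ^ st I J) ⊗ (k ⊗ ⟦ J′ ≟ᶜ J ⟧)))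
        ≈⟨ ∑-swap (compositions (size I)) e _ ⟩
      ∑[ e ] (λ (k , J′) → ∑[ compositions (size I) ] (λ J → (⟦ I ⪯? J ⟧ ⊗ q ^ st I J) ⊗ (k ⊗ ⟦ J′ ≟ᶜ J ⟧)))
        ≈⟨ ∑-cong e (λ (k , J′) → collapse k J′) ⟩
      ⟨ e , (λ J → ⟦ I ⪯? J ⟧ ⊗ q ^ st I J) ⟩ ∎
      where
      collapse : ∀ k J′ → ∑[ compositions (size I) ] (λ J → (⟦ I ⪯? J ⟧ ⊗ q ^ st I J) ⊗ (k ⊗ ⟦ J′ ≟ᶜ J ⟧)) ≈ k ⊗ (⟦ I ⪯? J′ ⟧ ⊗ q ^ st I J′)
      collapse k J′ = begin
        ∑[ compositions (size I) ] (λ J → (⟦ I ⪯? J ⟧ ⊗ q ^ st I J) ⊗ (k ⊗ ⟦ J′ ≟ᶜ J ⟧))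
          ≈⟨ ∑-cong (compositions (size I)) (λ J → trans (*-congˡ (*-congˡ (⟦⟧-cong (J′ ≟ᶜ J) (J ≟ᶜ J′) ≡.sym ≡.sym))) (solve 3 (λ a k d → a :* (k :* d) := d :* (k :* a)) refl (⟦ I ⪯? J ⟧ ⊗ q ^ st I J) k ⟦ J ≟ᶜ J′ ⟧)) ⟩
        ∑[ compositions (size I) ] (λ J → ⟦ J ≟ᶜ J′ ⟧ ⊗ (k ⊗ (⟦ I ⪯? J ⟧ ⊗ q ^ st I J)))
          ≈⟨ ∑-compositions-δ (built J′) (size I) _ ⟩
        ⟦ size J′ ≟ size I ⟧ ⊗ (k ⊗ (⟦ I ⪯? J′ ⟧ ⊗ q ^ st I J′))
          ≈⟨ solve 4 (λ a k b c → a :* (k :* (b :* c)) := k :* (b :* (a :* c))) refl ⟦ size J′ ≟ size I ⟧ k ⟦ I ⪯? J′ ⟧ (q ^ st I J′) ⟩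
        k ⊗ (⟦ I ⪯? J′ ⟧ ⊗ (⟦ size J′ ≟ size I ⟧ ⊗ q ^ st I J′))
          ≈⟨ *-congˡ (⟦⟧-⊗-cong (I ⪯? J′) (λ h → trans (*-congʳ (⟦⟧-true (size J′ ≟ size I) (≡.sym (proj₁ h)))) (*-identityˡ _))) ⟩
        k ⊗ (⟦ I ⪯? J′ ⟧ ⊗ q ^ st I J′) ∎

    rhs : ⟨ linear L e , (λ I′ → ⟦ I′ ≟ᶜ I ⟧) ∘ WC ⟩ ≈ ⟨ e , (λ J → ⟦ I ⪯? J ⟧ ⊗ q ^ st I J) ⟩
    rhs = trans (pair-linear L e _) (pair-cong e λ J → begin
      ⟨ L J , (λ I′ → ⟦ I′ ≟ᶜ I ⟧) ∘ WC ⟩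
        ≈⟨ pair-L J (λ I′ → ⟦ I′ ≟ᶜ I ⟧) ⟩
      ∑[ compositions (size J) ] (λ I′ → ⟦ I′ ⪯? J ⟧ ⊗ (q ^ st I′ J ⊗ ⟦ I′ ≟ᶜ I ⟧))
        ≈⟨ ∑-cong (compositions (size J)) (λ I′ → solve 3 (λ a b d → a :* (b :* d) := d :* (a :* b)) refl ⟦ I′ ⪯? J ⟧ (q ^ st I′ J) ⟦ I′ ≟ᶜ I ⟧) ⟩
      ∑[ compositions (size J) ] (λ I′ → ⟦ I′ ≟ᶜ I ⟧ ⊗ (⟦ I′ ⪯? J ⟧ ⊗ q ^ st I′ J))
        ≈⟨ ∑-compositions-δ (built I) (size J) _ ⟩
      ⟦ size I ≟ size J ⟧ ⊗ (⟦ I ⪯? J ⟧ ⊗ q ^ st I J)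
        ≈⟨ solve 3 (λ a b c → a :* (b :* c) := b :* (a :* c)) refl ⟦ size I ≟ size J ⟧ ⟦ I ⪯? J ⟧ (q ^ st I J) ⟩
      ⟦ I ⪯? J ⟧ ⊗ (⟦ size I ≟ size J ⟧ ⊗ q ^ st I J)
        ≈⟨ ⟦⟧-⊗-cong (I ⪯? J) (λ h → trans (*-congʳ (⟦⟧-true (size I ≟ size J) (proj₁ h))) (*-identityˡ _)) ⟩
      ⟦ I ⪯? J ⟧ ⊗ q ^ st I J ∎)

  expansion : ℕ → Free Composition
  expansion n = map (λ J → PTA J , J) (compositions n)

  coef-expansion : ∀ n I → size I ≡ n → coef (expansion n) I ≈ PTA I
  coef-expansion n I e = begin
    coef (expansion n) I                                          ≈⟨ coefficient-pair _≟ᶜ_ (expansion n) I ⟩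
    ⟨ expansion n , (λ J → ⟦ J ≟ᶜ I ⟧) ⟩                          ≈⟨ ∑-map (λ J → PTA J , J) (compositions n) _ ⟩
    ∑[ compositions n ] (λ J → PTA J ⊗ ⟦ J ≟ᶜ I ⟧)                ≈⟨ ∑-cong (compositions n) (λ J → ⊗-comm _ _) ⟩
    ∑[ compositions n ] (λ J → ⟦ J ≟ᶜ I ⟧ ⊗ PTA J)                ≈⟨ ∑-compositions-δ (built I) n PTA ⟩
    ⟦ size I ≟ n ⟧ ⊗ PTA I                                        ≈⟨ trans (*-congʳ (⟦⟧-true (size I ≟ n) e)) (*-identityˡ _) ⟩
    PTA I                                                         ∎

  -- After exchanging the two sums over compositions, each I carries the transform of `PTA`, which
  -- `transform-PTA` evaluates.
  pair-expansion : ∀ n (φ : Composition → Carrier) → ⟨ linear L (expansion n) , φ ∘ WC ⟩ ≈ ∑[ compositions n ] (λ I → qfact (parts I) ⊗ φ I)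
  pair-expansion n φ = begin
    ⟨ linear L (expansion n) , φ ∘ WC ⟩
      ≈⟨ pair-linear L (expansion n) _ ⟩
    ⟨ expansion n , (λ J → ⟨ L J , φ ∘ WC ⟩) ⟩
      ≈⟨ ∑-map (λ J → PTA J , J) (compositions n) _ ⟩
    ∑[ compositions n ] (λ J → PTA J ⊗ ⟨ L J , φ ∘ WC ⟩)
      ≈⟨ ∑-cong-∈ (compositions n) (λ {J} J∈ → trans (*-congˡ (trans (pair-L J φ) (reflexive (≡.cong (λ k → ∑[ compositions k ] (λ I → ⟦ I ⪯? J ⟧ ⊗ (q ^ st I J ⊗ φ I))) (All.lookup (compositions-size n) J∈))))) (sym (∑-⊗ˡ (compositions n) (PTA J) _))) ⟩
    ∑[ compositions n ] (λ J → ∑[ compositions n ] (λ I → PTA J ⊗ (⟦ I ⪯? J ⟧ ⊗ (q ^ st I J ⊗ φ I))))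
      ≈⟨ ∑-swap (compositions n) (compositions n) _ ⟩
    ∑[ compositions n ] (λ I → ∑[ compositions n ] (λ J → PTA J ⊗ (⟦ I ⪯? J ⟧ ⊗ (q ^ st I J ⊗ φ I))))
      ≈⟨ ∑-cong-∈ (compositions n) (λ {I} I∈ → inner I (All.lookup (compositions-size n) I∈)) ⟩
    ∑[ compositions n ] (λ I → qfact (parts I) ⊗ φ I) ∎
    where
    inner : ∀ I → size I ≡ n → ∑[ compositions n ] (λ J → PTA J ⊗ (⟦ I ⪯? J ⟧ ⊗ (q ^ st I J ⊗ φ I))) ≈ qfact (parts I) ⊗ φ I
    inner I ≡.refl = begin
      ∑[ compositions n ] (λ J → PTA J ⊗ (⟦ I ⪯? J ⟧ ⊗ (q ^ st I J ⊗ φ I)))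
        ≈⟨ ∑-cong (compositions n) (λ J → solve 4 (λ p d s f → p :* (d :* (s :* f)) := f :* (d :* (s :* p))) refl (PTA J) ⟦ I ⪯? J ⟧ (q ^ st I J) (φ I)) ⟩
      ∑[ compositions n ] (λ J → φ I ⊗ (⟦ I ⪯? J ⟧ ⊗ (q ^ st I J ⊗ PTA J)))
        ≈⟨ ∑-⊗ˡ (compositions n) (φ I) _ ⟩
      φ I ⊗ ∑[ compositions n ] (λ J → ⟦ I ⪯? J ⟧ ⊗ (q ^ st I J ⊗ PTA J))
        ≈⟨ *-congˡ (trans (sym (∑-filter (I ⪯?_) (compositions n) _)) (transform-PTA I)) ⟩
      φ I ⊗ qfact (parts I)
        ≈⟨ ⊗-comm _ _ ⟩
      qfact (parts I) ⊗ φ I ∎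

  -- The product with M₁

  M⋆M : PackedWord → PackedWord → WQSym
  M⋆M u′ u″ = map (λ u → q^ (sinv (letters u) ℤ.- sinv (letters u′) ℤ.- sinv (letters u″)) , u)
    (filter (λ u → ≡-dec _≟_ (pack (take ∣ u′ ∣ (letters u))) (letters u′)
                   ×-dec ≡-dec _≟_ (pack (drop ∣ u′ ∣ (letters u))) (letters u″))
      (packedWords (∣ u′ ∣ + ∣ u″ ∣)))

  infixr 7 _⋆_
  _⋆_ : WQSym → WQSym → WQSym
  x ⋆ y = linear (λ u′ → linear (λ u″ → M⋆M u′ u″) y) x

  S̃ : ℕ → WQSym
  S̃ m = map (1# ,_) (filter (λ u → linked? _≤?_ (letters u)) (packedWords m))

  S : Composition → WQSym
  S J = foldr (λ j x → S̃ j ⋆ x) (η ε) (parts J)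

  -- Packedness becomes an indicator on bare lists, which can then be split at the first letter.
  ∑-packedWords : ∀ n (g : List ℕ → Carrier) → ∑[ packedWords n ] (g ∘ letters) ≈ ∑[ words n n ] (λ w → ⟦ packed? w ⟧ ⊗ g w)
  ∑-packedWords n g = go (words n n)
    where
    go : ∀ ws → ∑[ mapMaybe (λ w → Maybe.map (λ p → word w p) (dec⇒maybe (packed? w))) ws ] (g ∘ letters) ≈ ∑[ ws ] (λ w → ⟦ packed? w ⟧ ⊗ g w)
    go []       = refl
    go (w ∷ ws) with packed? w
    ... | yes _ = +-cong (sym (*-identityˡ _)) (go ws)
    ... | no _  = trans (go ws) (solve 2 (λ x y → y := con 0 :* x :+ y) refl (g w) (∑[ ws ] (λ w → ⟦ packed? w ⟧ ⊗ g w)))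

  -- The enumeration offers one first letter per position of the longer word; only m repeated or m +
  -- 1 new ones give packed words.
  ∑-upTo-< : ∀ {m N} → m ≤ N → (f : ℕ → Carrier) → ∑[ upTo N ] (λ b → ⟦ b <? m ⟧ ⊗ f b) ≈ ∑[ upTo m ] f
  ∑-upTo-< {zero}  {N}     m≤N       f = ∑-zero (upTo N) (λ b → trans (*-congʳ (⟦⟧-false (b <? 0) (λ ()))) (zeroˡ _))
  ∑-upTo-< {suc m} {suc N} (s≤s m≤N) f = +-cong (*-identityˡ _) (begin
    ∑[ applyUpTo suc N ] (λ b → ⟦ b <? suc m ⟧ ⊗ f b)     ≡⟨ ≡.cong (λ bs → ∑[ bs ] (λ b → ⟦ b <? suc m ⟧ ⊗ f b)) (map-upTo suc N) ⟨
    ∑[ map suc (upTo N) ] (λ b → ⟦ b <? suc m ⟧ ⊗ f b)    ≈⟨ ∑-map suc (upTo N) _ ⟩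
    ∑[ upTo N ] (λ b → ⟦ suc b <? suc m ⟧ ⊗ f (suc b))    ≈⟨ ∑-cong (upTo N) (λ b → *-congʳ (⟦⟧-cong (suc b <? suc m) (b <? m) ≤-pred s≤s)) ⟩
    ∑[ upTo N ] (λ b → ⟦ b <? m ⟧ ⊗ f (suc b))            ≈⟨ ∑-upTo-< m≤N (f ∘ suc) ⟩
    ∑[ upTo m ] (f ∘ suc)                                 ≈⟨ ∑-map suc (upTo m) f ⟨
    ∑[ map suc (upTo m) ] f                               ≡⟨ ≡.cong (λ bs → ∑[ bs ] f) (map-upTo suc m) ⟩
    ∑[ applyUpTo suc m ] f                                ∎)

  ∑-q-upTo-< : ∀ {m N} → m ≤ N → ∀ x → ∑[ upTo N ] (λ b → ⟦ b <? m ⟧ ⊗ (q ^ b ⊗ x)) ≈ [ m ]q ⊗ x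
  ∑-q-upTo-< {m} m≤N x = trans (∑-upTo-< m≤N _) (trans (∑-cong (upTo m) (λ b → ⊗-comm _ _)) (trans (∑-⊗ˡ (upTo m) x _) (⊗-comm _ _)))

  ⟦⟧-merge : ∀ {p r} {P : Set p} {Q : Set r} (d : Dec P) (e : Dec Q) x → ⟦ d ⟧ ⊗ (⟦ e ⟧ ⊗ x) ≈ ⟦ d ×-dec e ⟧ ⊗ x
  ⟦⟧-merge d e x = trans (sym (*-assoc _ _ _)) (*-congʳ (sym (⟦×-dec⟧ d e)))

  one : PackedWord
  one = blockWord (1^ 1)

  module _ (u : PackedWord) where
    private
      w₀ = letters u
      m  = ℓ (WC u)
      n  = length w₀
      N  = suc n

      packed-u : Packed w₀
      packed-u = letters-packed u

      m≡ : proj₁ packed-u ≡ m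
      m≡ = ≡.trans (≡.sym (lasts-packed w₀ (proj₂ packed-u))) (≡.sym (length-cut 0 w₀))

      h : ∀ x → x ∈ w₀ ⇔ (1 ≤ x × x ≤ m)
      h = ≡.subst (λ k → ∀ x → x ∈ w₀ ⇔ (1 ≤ x × x ≤ k)) m≡ (proj₂ packed-u)

      m≤n : m ≤ n
      m≤n = ≤-trans (≤-reflexive (length-cut 0 w₀)) (length-lasts-≤ w₀)

      C? : ∀ w → Dec (pack (take 1 w) ≡ 1 ∷ [] × pack (drop 1 w) ≡ w₀)
      C? w = ≡-dec _≟_ (pack (take 1 w)) (1 ∷ []) ×-dec ≡-dec _≟_ (pack (drop 1 w)) w₀

      pack-single : ∀ a → pack (a ∷ []) ≡ 1 ∷ []
      pack-single a = ≡.cong (λ xs → length xs ∷ []) (filter-accept (_≤? a) {a} {[]} ≤-refl)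

      _≟ˡ_ : DecidableEquality (List ℕ)
      _≟ˡ_ = ≡-dec _≟_

    module _ (F : List ℕ → Carrier) (b : ℕ) where
      private
        a  = suc b
        w₁ = map (punchIn a) w₀

        old new : List ℕ → Carrier
        old w = ⟦ w ≟ˡ w₀ ⟧ ⊗ (⟦ b <? m ⟧ ⊗ F (a ∷ w₀))
        new w = ⟦ w ≟ˡ w₁ ⟧ ⊗ (⟦ b <? suc m ⟧ ⊗ F (a ∷ w₁))

        merged : ∀ w → ⟦ packed? (a ∷ w) ⟧ ⊗ (⟦ C? (a ∷ w) ⟧ ⊗ F (a ∷ w)) ≈ ⟦ packed? (a ∷ w) ×-dec C? (a ∷ w) ⟧ ⊗ F (a ∷ w)
        merged w = ⟦⟧-merge (packed? (a ∷ w)) (C? (a ∷ w)) (F (a ∷ w))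

        replace : ∀ {w v k} {P : Set} (P? : Dec P) → (P → w ≡ v × b < k) → (w ≡ v × b < k → P) →
          ⟦ P? ⟧ ⊗ F (a ∷ w) ≈ ⟦ w ≟ˡ v ⟧ ⊗ (⟦ b <? k ⟧ ⊗ F (a ∷ v))
        replace {w} {v} {k} P? to from = begin
          ⟦ P? ⟧ ⊗ F (a ∷ w)                             ≈⟨ ⟦⟧-⊗-cong P? (λ p → reflexive (≡.cong (λ w → F (a ∷ w)) (proj₁ (to p)))) ⟩
          ⟦ P? ⟧ ⊗ F (a ∷ v)                             ≈⟨ *-congʳ (⟦⟧-cong P? ((w ≟ˡ v) ×-dec (b <? k)) to from) ⟩
          ⟦ (w ≟ˡ v) ×-dec (b <? k) ⟧ ⊗ F (a ∷ v)        ≈⟨ ⟦⟧-merge (w ≟ˡ v) (b <? k) _ ⟨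
          ⟦ w ≟ˡ v ⟧ ⊗ (⟦ b <? k ⟧ ⊗ F (a ∷ v))          ∎

        old-to : ∀ {w} → a ∈ w → Packed (a ∷ w) × (pack (a ∷ []) ≡ 1 ∷ [] × pack w ≡ w₀) → w ≡ w₀ × b < m
        old-to a∈w (p , _ , e) = packed-tail-old h p a∈w e

        old-from : ∀ {w} → w ≡ w₀ × b < m → Packed (a ∷ w) × (pack (a ∷ []) ≡ 1 ∷ [] × pack w ≡ w₀)
        old-from (≡.refl , b<m) = packed-old h (s≤s z≤n) b<m , pack-single a , pack-packed packed-u

        new-to : ∀ {w} → a ∉ w → Packed (a ∷ w) × (pack (a ∷ []) ≡ 1 ∷ [] × pack w ≡ w₀) → w ≡ w₁ × b < suc m
        new-to a∉w (p , _ , e) = packed-tail-new h p a∉w e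

        new-from : ∀ {w} → w ≡ w₁ × b < suc m → Packed (a ∷ w) × (pack (a ∷ []) ≡ 1 ∷ [] × pack w ≡ w₀)
        new-from (≡.refl , b<) = packed-new h (s≤s z≤n) b< , pack-single a , PunchIn.pack-map a packed-u

        -- At most one term survives. If a occurs in w, then w is not `w₁`, which avoids a; if it
        -- does not, then w is `w₀` only when b ≥ m, because `w₀` contains all letters up to m.
        split : ∀ w → ⟦ packed? (a ∷ w) ⟧ ⊗ (⟦ C? (a ∷ w) ⟧ ⊗ F (a ∷ w)) ≈ old w ⊕ new w
        split w with mem? _≟_ a w
        ... | yes a∈w = trans (merged w) (trans (replace (packed? (a ∷ w) ×-dec C? (a ∷ w)) (old-to a∈w) old-from)
                          (sym (trans (+-congˡ (trans (*-congʳ (⟦⟧-false (w ≟ˡ w₁) λ { ≡.refl → ∉-punchIn a w₀ a∈w })) (zeroˡ _))) (+-identityʳ _))))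
        ... | no a∉w  = trans (merged w) (trans (replace (packed? (a ∷ w) ×-dec C? (a ∷ w)) (new-to a∉w) new-from)
                          (sym (trans (+-congʳ (trans (⟦⟧-merge (w ≟ˡ w₀) (b <? m) _)
                            (trans (*-congʳ (⟦⟧-false ((w ≟ˡ w₀) ×-dec (b <? m)) λ { (≡.refl , b<m) → a∉w (Equivalence.from (h a) (s≤s z≤n , b<m)) })) (zeroˡ _)))) (+-identityˡ _))))

        w₀∈ : w₀ ∈ words N n
        w₀∈ = ∈-words N w₀ (All.tabulate λ {x} x∈ → let (p , p′) = Equivalence.to (h x) x∈ in p , ≤-trans p′ (≤-trans m≤n (n≤1+n n)))

        w₁∈ : w₁ ∈ words N n
        w₁∈ = ≡.subst (λ k → w₁ ∈ words N k) (length-map (punchIn a) w₀) (∈-words N w₁ (All-map⁺ (All.tabulate λ {x} x∈ →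
          let (p , p′) = Equivalence.to (h x) x∈ in ≤-trans p (≤-punchIn a x) , ≤-trans (punchIn-≤ a x) (s≤s (≤-trans p′ m≤n)))))

      ∑-first-letter : ∑[ words N n ] (λ w → ⟦ packed? (a ∷ w) ⟧ ⊗ (⟦ C? (a ∷ w) ⟧ ⊗ F (a ∷ w))) ≈ ⟦ b <? m ⟧ ⊗ F (a ∷ w₀) ⊕ ⟦ b <? suc m ⟧ ⊗ F (a ∷ w₁)
      ∑-first-letter = trans (∑-cong (words N n) split) (trans (∑-⊕ (words N n) old new)
        (+-cong (∑-δ _≟ˡ_ _ (words-unique N n) w₀∈) (∑-δ _≟ˡ_ _ (words-unique N n) w₁∈)))

    private
      exponent : ∀ b s → ℤ.+ (b + s) ℤ.- ℤ.+ 0 ℤ.- ℤ.+ s ≡ ℤ.+ b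
      exponent b s = ≡.trans (≡.cong (ℤ._- ℤ.+ s) (ℤ.+-identityʳ (ℤ.+ (b + s)))) (ℤ-cancel b s)
        where
        ℤ-cancel : ∀ b s → ℤ.+ (b + s) ℤ.- ℤ.+ s ≡ ℤ.+ b
        ℤ-cancel b s = ≡.trans (ℤ.+-assoc (ℤ.+ b) (ℤ.+ s) (ℤ.- ℤ.+ s)) (≡.trans (≡.cong (λ x → ℤ.+ b ℤ.+ x) (ℤ.+-inverseʳ (ℤ.+ s))) (ℤ.+-identityʳ (ℤ.+ b)))

    pair-M₁⋆M : ∀ (φ : Composition → Carrier) → ⟨ M⋆M one u , φ ∘ WC ⟩ ≈ [ m ]q ⊗ φ (bump (WC u)) ⊕ [ suc m ]q ⊗ φ (one∷ WC u)
    pair-M₁⋆M φ = begin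
      ⟨ M⋆M one u , φ ∘ WC ⟩
        ≈⟨ ∑-map (λ v → q^ (sinv (letters v) ℤ.- sinv (letters one) ℤ.- sinv w₀) , v) (filter (λ v → C? (letters v)) (packedWords N)) _ ⟩
      ∑[ filter (λ v → C? (letters v)) (packedWords N) ] (F ∘ letters)
        ≈⟨ ∑-filter (λ v → C? (letters v)) (packedWords N) (F ∘ letters) ⟩
      ∑[ packedWords N ] (λ v → ⟦ C? (letters v) ⟧ ⊗ F (letters v))
        ≈⟨ ∑-packedWords N (λ w → ⟦ C? w ⟧ ⊗ F w) ⟩
      ∑[ words N N ] (λ w → ⟦ packed? w ⟧ ⊗ (⟦ C? w ⟧ ⊗ F w))
        ≈⟨ ∑-cartesianProductWith _∷_ (applyUpTo suc N) (words N n) _ ⟩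
      ∑[ applyUpTo suc N ] (λ a → ∑[ words N n ] (λ w → ⟦ packed? (a ∷ w) ⟧ ⊗ (⟦ C? (a ∷ w) ⟧ ⊗ F (a ∷ w))))
        ≡⟨ ≡.cong (λ as → ∑[ as ] (λ a → ∑[ words N n ] (λ w → ⟦ packed? (a ∷ w) ⟧ ⊗ (⟦ C? (a ∷ w) ⟧ ⊗ F (a ∷ w))))) (map-upTo suc N) ⟨
      ∑[ map suc (upTo N) ] (λ a → ∑[ words N n ] (λ w → ⟦ packed? (a ∷ w) ⟧ ⊗ (⟦ C? (a ∷ w) ⟧ ⊗ F (a ∷ w))))
        ≈⟨ ∑-map suc (upTo N) _ ⟩
      ∑[ upTo N ] (λ b → ∑[ words N n ] (λ w → ⟦ packed? (suc b ∷ w) ⟧ ⊗ (⟦ C? (suc b ∷ w) ⟧ ⊗ F (suc b ∷ w))))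
        ≈⟨ ∑-cong (upTo N) (λ b → trans (∑-first-letter F b) (+-cong (⟦⟧-⊗-cong (b <? m) (F-old b)) (⟦⟧-⊗-cong (b <? suc m) (F-new b)))) ⟩
      ∑[ upTo N ] (λ b → ⟦ b <? m ⟧ ⊗ (q ^ b ⊗ φ (bump (WC u))) ⊕ ⟦ b <? suc m ⟧ ⊗ (q ^ b ⊗ φ (one∷ WC u)))
        ≈⟨ ∑-⊕ (upTo N) _ _ ⟩
      ∑[ upTo N ] (λ b → ⟦ b <? m ⟧ ⊗ (q ^ b ⊗ φ (bump (WC u)))) ⊕ ∑[ upTo N ] (λ b → ⟦ b <? suc m ⟧ ⊗ (q ^ b ⊗ φ (one∷ WC u)))
        ≈⟨ +-cong (∑-q-upTo-< (≤-trans m≤n (n≤1+n n)) _) (∑-q-upTo-< (s≤s m≤n) _) ⟩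
      [ m ]q ⊗ φ (bump (WC u)) ⊕ [ suc m ]q ⊗ φ (one∷ WC u) ∎
      where
      F : List ℕ → Carrier
      F w = q^ (sinv w ℤ.- sinv (1 ∷ []) ℤ.- sinv w₀) ⊗ φ (WCʷ w)

      F-value : ∀ b w {I} → sinvCount w ≡ b + sinvCount w₀ → WCʷ w ≡ I → F w ≈ q ^ b ⊗ φ I
      F-value b w e ≡.refl = *-congʳ (trans (reflexive (≡.cong q^_
        (≡.trans (≡.cong (λ k → ℤ.+ k ℤ.- ℤ.+ 0 ℤ.- sinv w₀) e) (exponent b (sinvCount w₀))))) (q^-nonneg b))

      F-old : ∀ b → b < m → F (suc b ∷ w₀) ≈ q ^ b ⊗ φ (bump (WC u))
      F-old b b<m = F-value b (suc b ∷ w₀) (sinvCount-old h (<⇒≤ b<m)) (WC-old (Equivalence.from (h (suc b)) (s≤s z≤n , b<m)))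

      F-new : ∀ b → b < suc m → F (suc b ∷ map (punchIn (suc b)) w₀) ≈ q ^ b ⊗ φ (one∷ WC u)
      F-new b b<m = F-value b (suc b ∷ map (punchIn (suc b)) w₀) (sinvCount-new h (≤-pred b<m))
        (≡.trans (WC-new (∉-punchIn (suc b) w₀)) (≡.cong one∷_ (WC-punchIn h)))

  -- Left multiplication by the word 1 is carried over to the functional, turning φ into ψ, so the
  -- induction runs over all φ.
  pair-S : ∀ n (φ : Composition → Carrier) → ⟨ S (1^ n) , φ ∘ WC ⟩ ≈ ∑[ compositions n ] (λ I → qfact (parts I) ⊗ φ I)
  pair-S zero    φ = +-congʳ (*-congʳ (sym qfact-[]))
  pair-S (suc n) φ = begin
    ⟨ S̃ 1 ⋆ S (1^ n) , φ ∘ WC ⟩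
      ≈⟨ pair-linear (λ u′ → linear (M⋆M u′) (S (1^ n))) (S̃ 1) (φ ∘ WC) ⟩
    ⟨ S̃ 1 , (λ u′ → ⟨ linear (M⋆M u′) (S (1^ n)) , φ ∘ WC ⟩) ⟩
      -- `S̃ 1` computes to the single basis word `one`.
      ≈⟨ pair-η one (λ u′ → ⟨ linear (M⋆M u′) (S (1^ n)) , φ ∘ WC ⟩) ⟩
    ⟨ linear (M⋆M one) (S (1^ n)) , φ ∘ WC ⟩
      ≈⟨ pair-linear (M⋆M one) (S (1^ n)) (φ ∘ WC) ⟩
    ⟨ S (1^ n) , (λ u → ⟨ M⋆M one u , φ ∘ WC ⟩) ⟩
      ≈⟨ pair-cong (S (1^ n)) (λ u → pair-M₁⋆M u φ) ⟩
    ⟨ S (1^ n) , ψ ∘ WC ⟩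
      ≈⟨ pair-S n ψ ⟩
    ∑[ compositions n ] (λ I → qfact (parts I) ⊗ ψ I)
      ≈⟨ ∑-cong (compositions n) step ⟨
    ∑[ compositions n ] (λ I → ∑[ extend I ] (λ I⁺ → qfact (parts I⁺) ⊗ φ I⁺))
      ≈⟨ ∑-compositions-suc n _ ⟨
    ∑[ compositions (suc n) ] (λ I → qfact (parts I) ⊗ φ I) ∎
    where
    ψ : Composition → Carrier
    -- At the empty composition the first factor is [0] = 0, which silences the default value of
    -- `bump`.
    ψ I = [ ℓ I ]q ⊗ φ (bump I) ⊕ [ suc (ℓ I) ]q ⊗ φ (one∷ I)

    step : ∀ I → ∑[ extend I ] (λ I⁺ → qfact (parts I⁺) ⊗ φ I⁺) ≈ qfact (parts I) ⊗ ψ I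
    step (comp [] p) = trans (+-congʳ (*-congʳ (qfact-one [])))
      (solve 4 (λ a f y x → (a :* f) :* y :+ con 0 := f :* (con 0 :* x :+ a :* y)) refl [ 1 ]q (qfact []) (φ (one∷ comp [] p)) (φ (comp [] [])))
    step I₀@(comp (i ∷ I) p) = trans (+-cong (*-congʳ (qfact-one (i ∷ I))) (+-congʳ (*-congʳ (qfact-suc i I))))
      (solve 5 (λ a f y b x → (a :* f) :* y :+ ((b :* f) :* x :+ con 0) := f :* (b :* x :+ a :* y)) refl
        [ suc (suc (length I)) ]q (qfact (i ∷ I)) (φ (one∷ I₀)) [ suc (length I) ]q (φ (bump I₀)))

  -- The expansion of S (1^ n)

  -- Pairing with the indicator of J reads the transform of `coef e` off `S (1^ n)`, and `inverse`
  -- recovers `coef e`; the resulting expression no longer mentions e.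
  coef-unique : ∀ n e → linear L e ≈ˢ S (1^ n) → ∀ I → coef e I ≈ inverse (λ J → ∑[ compositions n ] (λ I′ → qfact (parts I′) ⊗ ⟦ I′ ≟ᶜ J ⟧)) I
  coef-unique n e exp I = trans (sym (inverse-transform (built I) (coef e))) (inverse-cong I λ J _ →
    trans (transform-coef e J) (trans (≈ˢ⇒pair {linear L e} {S (1^ n)} exp (λ I′ → ⟦ I′ ≟ᶜ J ⟧)) (pair-S n (λ I′ → ⟦ I′ ≟ᶜ J ⟧))))

  expansion-correct : ∀ n → linear L (expansion n) ≈ˢ S (1^ n)
  expansion-correct n = pair⇒≈ˢ {linear L (expansion n)} {S (1^ n)} (λ φ → trans (pair-expansion n φ) (sym (pair-S n φ)))

  PTA-formula : ∀ I → PTA I ≈ ∑[ coarserThan I ] (λ J → (- q⁻¹) ^ (ℓ I ∸ ℓ J) ⊗ q^ (ℤ.- ℤ.+ st′ I J) ⊗ qfact (parts J))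
  PTA-formula I = trans (sym (inverse-transform (built I) PTA)) (inverse-cong I (λ J _ → transform-PTA J))

  theorem : (n : ℕ) →
    Σ[ e ∈ Free Composition ]
      (linear L e ≈ˢ S (1^ n)) ×
      ((e′ : Free Composition) → linear L e′ ≈ˢ S (1^ n) → ∀ I → coef e′ I ≈ coef e I) ×
      ((I : Composition) → size I ≡ n →
        (PTA I ≈ coef e I) ×
        (coef e I ≈ ∑[ coarserThan I ] (λ J → (- q⁻¹) ^ (ℓ I ∸ ℓ J) ⊗ q^ (ℤ.- ℤ.+ st′ I J) ⊗ qfact (parts J))))
  theorem n = expansion n , expansion-correct n ,
    (λ e′ h I → trans (coef-unique n e′ h I) (sym (coef-unique n (expansion n) (expansion-correct n) I))) ,
    (λ I e → sym (coef-expansion n I e) , trans (coef-expansion n I e) (PTA-formula I))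

-- Specialization to the rational functions over K.

K⟨q⟩-weights : ∀ {c ℓ₁ ℓ₂} → HeytingField c ℓ₁ ℓ₂ → WeightRing (c ⊔ ℓ₂) ℓ₁
K⟨q⟩-weights K = record
  { R         = K⟨q⟩
  ; q         = q
  ; q⁻¹       = q⁻¹
  ; q*q⁻¹≈1   = q*q⁻¹≃1
  ; q^_       = q^_
  ; q^-nonneg = λ n → R.refl {q ^ n}
  ; q^-neg    = λ n → R.refl {q⁻¹ ^ suc n}
  ; qfact     = qfact
  ; qfact-[]  = R.refl {R.1#}
  ; qfact-∷   = λ j J → R.refl {qfact (j ∷ J)}
  }
  where
  open Algebraic K using (K⟨q⟩; q; q⁻¹; q^_; _^_; qfact)
  open RationalFunctions K using (q*q⁻¹≃1)
  module R = CommutativeRing K⟨q⟩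

mainTheorem1 : ∀ {c ℓ₁ ℓ₂} (K : HeytingField c ℓ₁ ℓ₂) → CharacteristicZero K →
    let open Algebraic K in
    (n : ℕ) → 1 ≤ n →
    -- the expansion of S^(1^n)(q) in the basis (L_J(q)), and its uniqueness
    Σ[ e ∈ Free Composition ]
      (e IsLExpansionOf S (1^ n)) ×
      ((e′ : Free Composition) → e′ IsLExpansionOf S (1^ n) → e′ ≈ᶜ e) ×
      ((I : Composition) → size I ≡ n →
        (PTA I ≈ coefficient _≟ᶜ_ e I) ×
        (coefficient _≟ᶜ_ e I ≈
          ∑[ coarserThan I ] λ J → (- q⁻¹) ^ (ℓ I ∸ ℓ J) ⊗ q^ (ℤ.- ℤ.+ st′ I J) ⊗ QFactA J))
mainTheorem1 K _ n _ = Weighted.theorem (K⟨q⟩-weights K) n
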